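{- The family $\{X'_{ -\lambda}\}_{\lambda\in\mathcal{P}}$, indexed by all partitions, is a basis of $\Lambda_{\mathbb{Q}(\alpha)}$ over $\mathbb{Q}(\alpha)$.
   Context: **Fock space and vertex operators.** Fix a positive integer $\alpha$. Let $V=\mathbb{C}[h_{ -1},h_{ -2},\dots]\otimes\mathbb{C}[\tfrac12\mathbb{Z}]$, where $\mathbb{C}[\tfrac12\mathbb{Z}]$ has basis $e^{mh}$ ($m\in\tfrac12\mathbb{Z}$). - For $n>0$, $h_{ -n}$ acts by multiplication on the first factor. - For $n>0$, $h_n$ acts by $\alpha^{ -1}n\,\partial/\partial h_{ -n}$ on the first factor. - For a formal variable $z$, $A$ acts by $A(v\otimes e^{mh})=z^{(2m+1)\alpha}\,v\otimes e^{(m+1)h}$. Define the operators $X_n$ ($n\in\mathbb{Z}$) by $$X(z)=\exp\Big(\sum_{n\ge1}\frac{\alpha h_{ -n}}{n}z^n\Big)\,A\,\exp\Big(-\sum_{n\ge1}\frac{2\alpha h_n}{n}z^{ -n}\Big)=\sum_{n\in\mathbb{Z}}X_nz^{ -n}.$$ For a partition $\lambda=(\lambda_1,\dots,\lambda_l)$ with $l=l(\lambda)$, set $X_{ -\lambda}=X_{ -\lambda_1}\cdots X_{ -\lambda_l}$. Let $T:V\to\Lambda_{\mathbb{Q}}\otimes\mathbb{C}$ be the linear map $T(h_{ -\mu_1}h_{ -\mu_2}\cdots\otimes e^{mh})=p_\mu$, where $p_\mu$ are power-sum symmetric functions. Put $c_s(\alpha)=(-1)^{s(s-1)\alpha/2}(s\alpha)!/(\alpha!)^s$.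 **Definition of $X'_{ -\lambda}$.** It is known that for every partition $\lambda$ there exists an element of $\Lambda_{\mathbb{Q}(\alpha)}$, with $\alpha$ now an indeterminate, with the following properties: - its coefficients in the power-sum basis are rational functions of $\alpha$ defined at every positive integer; - its specialization at every positive integer $\alpha$ equals $c_{l(\lambda)}(\alpha)^{ -1}T(X_{ -\lambda}e^{ -l(\lambda)h/2})$. Such an element is unique, and it is denoted $X'_{ -\lambda}$. -}

module Defs where

open import Data.Bool using (Bool; true; false; T; _∧_; if_then_else_)
open import Data.Nat as ℕ using (ℕ; zero; suc; _∸_; _!)
import Data.Nat.Properties as ℕP
open import Data.Integer as ℤ using (ℤ; +_; -[1+_])
open import Data.Rational as ℚ using (ℚ; 0ℚ; 1ℚ)
open import Data.List using (List; []; _∷_; _++_; map; concatMap; foldr; length; reverse; upTo; sum)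
import Data.List.Properties as LP
open import Data.Product using (_×_; _,_; proj₁; proj₂; Σ; ∃)
open import Data.List.Relation.Unary.All using (All)
open import Data.List.Relation.Unary.Unique.Propositional using (Unique)
open import Relation.Binary.PropositionalEquality using (_≡_; _≢_)
open import Relation.Nullary.Decidable using (⌊_⌋)

-- z / d as a rational; only ever used with d ≠ 0 (d = 0 gives 0).
frac : ℤ → ℕ → ℚ
frac z zero    = 0ℚ
frac z (suc d) = z ℚ./ suc d

powQ : ℚ → ℕ → ℚ
powQ q zero    = 1ℚ
powQ q (suc j) = q ℚ.* powQ q j

fromℕ : ℕ → ℚ
fromℕ n = frac (+ n) 1

decrPos : List ℕ → Bool
decrPos []            = true
decrPos (x ∷ [])      = ⌊ 1 ℕ.≤? x ⌋
decrPos (x ∷ y ∷ xs)  = ⌊ y ℕ.≤? x ⌋ ∧ decrPos (y ∷ xs)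

IsPartition : List ℕ → Set
IsPartition l = T (decrPos l)

Partition : Set
Partition = Σ (List ℕ) IsPartition

-- Monomials h_{-μ} in the Fock space / power sums p_μ, encoded by
-- multiplicity lists: [m₁, m₂, …] means the partition with m_i parts
-- equal to i.  Trailing zeros are irrelevant (compare after `strip`).

Mono : Set
Mono = List ℕ

strip : Mono → Mono
strip [] = []
strip (x ∷ xs) with strip xs
... | []     = if ⌊ x ℕ.≟ 0 ⌋ then [] else (x ∷ [])
... | y ∷ ys = x ∷ y ∷ ys

mult : ℕ → Mono → ℕ
mult _             []       = 0
mult zero          _        = 0
mult (suc zero)    (x ∷ _)  = x
mult (suc (suc n)) (_ ∷ xs) = mult (suc n) xs

incr : ℕ → Mono → Mono
incr zero          m        = m
incr (suc zero)    []       = 1 ∷ []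
incr (suc zero)    (x ∷ xs) = suc x ∷ xs
incr (suc (suc n)) []       = 0 ∷ incr (suc n) []
incr (suc (suc n)) (x ∷ xs) = x ∷ incr (suc n) xs

decr : ℕ → Mono → Mono
decr zero          m        = m
decr (suc zero)    []       = []
decr (suc zero)    (x ∷ xs) = (x ∸ 1) ∷ xs
decr (suc (suc n)) []       = []
decr (suc (suc n)) (x ∷ xs) = x ∷ decr (suc n) xs

weightFrom : ℕ → Mono → ℕ
weightFrom i []       = 0
weightFrom i (x ∷ xs) = i ℕ.* x ℕ.+ weightFrom (suc i) xs

weight : Mono → ℕ
weight = weightFrom 1

partsUpTo : ℕ → ℕ → List Mono
partsUpTo zero    n = if ⌊ n ℕ.≟ 0 ⌋ then ([] ∷ []) else []
partsUpTo (suc k) n =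
  concatMap (λ j → if ⌊ j ℕ.* suc k ℕ.≤? n ⌋
                   then map (λ m → m ++ (j ∷ [])) (partsUpTo k (n ∸ j ℕ.* suc k))
                   else [])
            (upTo (suc n))

partitionsOf : ℕ → List Mono
partitionsOf n = partsUpTo n n

-- Finite formal linear combinations of monomials with coefficients in K.
-- Used both for vectors in C[h_{-1},h_{-2},…] (monomials h_{-μ}) and for
-- symmetric functions in the power-sum basis (monomials p_μ).

Comb : Set → Set
Comb K = List (K × Mono)

coeffWith : {K : Set} → K → (K → K → K) → Comb K → Mono → K
coeffWith z _+_ [] μ = z
coeffWith z _+_ ((c , ν) ∷ f) μ =
  if ⌊ LP.≡-dec ℕ._≟_ (strip ν) (strip μ) ⌋
  then c + coeffWith z _+_ f μ else coeffWith z _+_ f μ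

-- The Fock space at a fixed positive integer α (a : ℕ), coefficients ℚ.
-- A vector v ⊗ e^{mh} is represented by v : Comb ℚ; the charge m is
-- tracked separately as the integer 2m.

FVec : Set
FVec = Comb ℚ

scaleV : ℚ → FVec → FVec
scaleV q = map (λ { (c , μ) → (q ℚ.* c , μ) })

hMinus : ℕ → FVec → FVec
hMinus n = map (λ { (c , μ) → (c , incr n μ) })

-- h_n = α⁻¹ n ∂/∂h_{-n}
hPlus : (a : ℕ) → ℕ → FVec → FVec
hPlus a n = map (λ { (c , μ) → (frac (+ n) a ℚ.* fromℕ (mult n μ) ℚ.* c , decr n μ) })

iter : ℕ → (FVec → FVec) → FVec → FVec
iter zero    f v = v
iter (suc j) f v = f (iter j f v)

applyMono : (ℕ → FVec → FVec) → Mono → FVec → FVec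
applyMono op js v = go 1 js v
  where
  go : ℕ → Mono → FVec → FVec
  go i []       v = v
  go i (j ∷ js) v = iter j (op i) (go (suc i) js v)

-- coefficient of x^b in exp(Σ_{n≥1} c_n x^n O_n) (commuting O_n):
-- Σ_{ν ⊢ b} ∏_n c_n^{j_n}/j_n! · ∏_n O_n^{j_n}
expCoeff : (ℕ → ℚ) → (ℕ → FVec → FVec) → ℕ → FVec → FVec
expCoeff c op b v =
  concatMap (λ js → scaleV (wt js) (applyMono op js v)) (partitionsOf b)
  where
  wtFrom : ℕ → Mono → ℚ
  wtFrom i []       = 1ℚ
  wtFrom i (j ∷ js) = powQ (c i) j ℚ.* frac (+ 1) (j !) ℚ.* wtFrom (suc i) js
  wt : Mono → ℚ
  wt = wtFrom 1

-- coefficient of z^{-b} in exp(-Σ_{n≥1} (2α h_n / n) z^{-n})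
Eplus : (a : ℕ) → ℕ → FVec → FVec
Eplus a = expCoeff (λ n → frac (ℤ.- (+ (2 ℕ.* a))) n) (hPlus a)

-- coefficient of z^{k} in exp(Σ_{n≥1} (α h_{-n} / n) z^{n})
Eminus : (a : ℕ) → ℕ → FVec → FVec
Eminus a = expCoeff (λ n → frac (+ a) n) hMinus

maxWeight : FVec → ℕ
maxWeight = foldr (λ { (_ , μ) r → weight μ ℕ.⊔ r }) 0

-- X_{-k} acting on v ⊗ e^{mh}, where t = 2m.  X_{-k} is the coefficient
-- of z^{k} in X(z).  A term z^{j}(from E₋) · z^{(t+1)α}(from A) ·
-- z^{-b}(from E₊) contributes when j + (t+1)α - b = k.  E₊'s z^{-b}
-- coefficient kills v when b > maxWeight v, so the sum over b is finite.
Xneg : (a : ℕ) → ℕ → ℤ → FVec → FVec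
Xneg a k t v = concatMap term (upTo (suc (maxWeight v)))
  where
  term : ℕ → FVec
  term b with (+ k) ℤ.+ (+ b) ℤ.- (t ℤ.+ (+ 1)) ℤ.* (+ a)
  ... | + j      = Eminus a j (Eplus a b v)
  ... | -[1+ _ ] = []

Xprod : (a : ℕ) → List ℕ → ℤ → FVec → FVec
Xprod a []       t v = v
Xprod a (k ∷ ks) t v = Xneg a k (t ℤ.+ + (2 ℕ.* length ks)) (Xprod a ks t v)

-- the vacuum-type vector 1 ⊗ e^{-l h/2}, i.e. t = -l
vacuumVec : FVec
vacuumVec = (1ℚ , []) ∷ []

cCoef : (s a : ℕ) → ℚ
cCoef s a = frac ((ℤ.- + 1) ℤ.^ ((s ℕ.* (s ∸ 1) ℕ./ 2) ℕ.* a) ℤ.* + ((s ℕ.* a) !))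
                 ((a !) ℕ.^ s)

cCoefInv : (s a : ℕ) → ℚ
cCoefInv s a = frac ((ℤ.- + 1) ℤ.^ ((s ℕ.* (s ∸ 1) ℕ./ 2) ℕ.* a) ℤ.* + ((a !) ℕ.^ s))
                    ((s ℕ.* a) !)

-- c_{l(λ)}(α)⁻¹ T(X_{-λ} e^{-l(λ)h/2}) ∈ Λ_ℚ, in the power-sum basis
-- (T sends h_{-μ} ⊗ e^{mh} to p_μ, i.e. is the identity on Comb ℚ).
target : (a : ℕ) → Partition → Comb ℚ
target a (l , _) =
  scaleV (cCoefInv (length l) a) (Xprod a l (ℤ.- (+ length l)) vacuumVec)

coeffℚ : Comb ℚ → Mono → ℚ
coeffℚ = coeffWith 0ℚ ℚ._+_

-- Polynomials ℚ[α] (coefficient lists, lowest degree first) and the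
-- field of rational functions ℚ(α) as a setoid of fractions.

Poly : Set
Poly = List ℚ

pcoeff : Poly → ℕ → ℚ
pcoeff []       _       = 0ℚ
pcoeff (c ∷ p)  zero    = c
pcoeff (c ∷ p)  (suc k) = pcoeff p k

_≈ₚ_ : Poly → Poly → Set
p ≈ₚ q = ∀ k → pcoeff p k ≡ pcoeff q k

_+ₚ_ : Poly → Poly → Poly
[]      +ₚ q       = q
(a ∷ p) +ₚ []      = a ∷ p
(a ∷ p) +ₚ (b ∷ q) = (a ℚ.+ b) ∷ (p +ₚ q)

_*ₚ_ : Poly → Poly → Poly
[]      *ₚ q = []
(a ∷ p) *ₚ q = map (a ℚ.*_) q +ₚ (0ℚ ∷ (p *ₚ q))

evalP : Poly → ℚ → ℚ
evalP []      x = 0ℚ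
evalP (c ∷ p) x = c ℚ.+ x ℚ.* evalP p x

NonZeroPoly : Poly → Set
NonZeroPoly q = ∃ λ k → pcoeff q k ≢ 0ℚ

record RatFun : Set where
  constructor _//_
  field
    num : Poly
    den : Poly
open RatFun public

ValidR : RatFun → Set
ValidR r = NonZeroPoly (den r)

_≈ᵣ_ : RatFun → RatFun → Set
r ≈ᵣ s = (num r *ₚ den s) ≈ₚ (num s *ₚ den r)

0ᵣ : RatFun
0ᵣ = [] // (1ℚ ∷ [])

_+ᵣ_ : RatFun → RatFun → RatFun
r +ᵣ s = ((num r *ₚ den s) +ₚ (num s *ₚ den r)) // (den r *ₚ den s)

_*ᵣ_ : RatFun → RatFun → RatFun
r *ᵣ s = (num r *ₚ num s) // (den r *ₚ den s)

SpecAt : RatFun → ℕ → ℚ → Set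
SpecAt r n v = Σ RatFun λ r' → r' ≈ᵣ r × evalP (den r') (fromℕ n) ≢ 0ℚ
                              × evalP (num r') (fromℕ n) ≡ v ℚ.* evalP (den r') (fromℕ n)

Λα : Set
Λα = Comb RatFun

ValidΛ : Λα → Set
ValidΛ f = All (λ e → ValidR (proj₁ e)) f

coeffᵣ : Λα → Mono → RatFun
coeffᵣ = coeffWith 0ᵣ _+ᵣ_

_≈Λ_ : Λα → Λα → Set
f ≈Λ g = ∀ μ → coeffᵣ f μ ≈ᵣ coeffᵣ g μ

scaleΛ : RatFun → Λα → Λα
scaleΛ r = map (λ { (c , μ) → (r *ᵣ c , μ) })

linComb : (Partition → Λα) → List (RatFun × Partition) → Λα
linComb F []             = []
linComb F ((c , λ') ∷ cs) = scaleΛ c (F λ') ++ linComb F cs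

-- X'_{-λ}: the element of Λ_{ℚ(α)} with coefficients defined at every
-- positive integer α and specialising there to c_l(α)⁻¹ T(X_{-λ}e^{-lh/2}).
IsXPrime : Partition → Λα → Set
IsXPrime λ' f = ValidΛ f ×
  (∀ (a : ℕ) → ∀ μ → SpecAt (coeffᵣ f μ) (suc a) (coeffℚ (target (suc a) λ') μ))

LinIndep : (Partition → Λα) → Set
LinIndep F = ∀ (cs : List (RatFun × Partition)) →
  All (λ e → ValidR (proj₁ e)) cs →
  Unique (map (λ e → proj₁ (proj₂ e)) cs) →
  linComb F cs ≈Λ [] →
  All (λ e → proj₁ e ≈ᵣ 0ᵣ) cs

Spans : (Partition → Λα) → Set
Spans F = ∀ (f : Λα) → ValidΛ f →
  Σ (List (RatFun × Partition)) λ cs →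
    All (λ e → ValidR (proj₁ e)) cs × (linComb F cs ≈Λ f)

IsBasis : (Partition → Λα) → Set
IsBasis F = LinIndep F × Spans F

{-# OPTIONS --safe #-}

-- Everything is decided at α = 1. The coefficients of the X′_{-λ} are regular there, so if the square matrix of
-- their values (rows λ and columns p_μ with |λ|, |μ| ≤ N) has trivial kernel, Gaussian elimination with pivots whose
-- value is nonzero inverts the matrix over ℚ(α). A coefficient of X′_{-λ} outside weight |λ| vanishes at every positive
-- integer, hence identically, so such a finite matrix sees all of X′_{-λ}.
--
-- At α = 1, X_{-λ}e^{-lh/2} is up to sign the coefficient of z^λ in Δ ∏ᵢ h(zᵢ), where Δ = ∏_{i≠j} (1 - zᵢ/zⱼ) and
-- h(z) is the generating function of the complete symmetric functions. Let φ be a linear functional killing all of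
-- them and F = φ(∏ᵢ h(zᵢ)), a symmetric polynomial in l variables. By induction on l it only contains monomials with
-- positive exponents, and at those ΔF has coefficient 0; hence the constant term of F(z⁻¹)ΔF vanishes. As
-- Δ = A(z)A(z⁻¹) with A = ∏_{i<j} (1 - zᵢ/zⱼ), this constant term is the sum of the squares of the coefficients of
-- A(z⁻¹)F, so F = 0. The complete symmetric functions generate, so φ = 0.
module Submission where

open import Defs
open import Algebra.Bundles using (CommutativeRing)
open import Algebra.Consequences.Setoid using (comm∧idˡ⇒id; comm∧invˡ⇒inv; comm∧distrˡ⇒distr)
import Algebra.Properties.CommutativeSemigroup
import Algebra.Properties.Ring as RingProperties
import Algebra.Properties.Semiring.Sum as SemiringSum
import Algebra.Solver.Ring.NaturalCoefficients.Default as SemiringSolver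
open import Data.Bool using (true; false; if_then_else_)
open import Data.Bool.Properties using (T-∧; T-irrelevant; T?)
open import Data.Empty using (⊥; ⊥-elim)
open import Data.Fin using (Fin; zero; suc; punchIn)
import Data.Fin.Properties as FinP
open import Data.Integer as ℤ using (ℤ; +_; -[1+_])
import Data.Integer.Properties as ℤP
import Data.Integer.Tactic.RingSolver as ℤRing
open import Data.List using (List; []; _∷_; _++_; map; foldr; concatMap; length; filter; upTo; deduplicate; lookup; tabulate; allFin)
import Data.List.Properties as LP
open import Data.List.Membership.Propositional using (_∈_)
open import Data.List.Membership.Propositional.Properties using (∈-lookup; ∈-allFin; ∈-upTo⁺; ∈-upTo⁻; ∈-map⁺; ∈-map⁻; ∈-concatMap⁺; ∈-concatMap⁻; ∈-deduplicate⁺; ∈-deduplicate⁻)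
open import Data.List.Relation.Binary.Permutation.Propositional as Perm using (_↭_)
import Data.List.Relation.Binary.Permutation.Propositional.Properties as PermP
open import Data.List.Relation.Unary.All as All using (All; []; _∷_)
import Data.List.Relation.Unary.All.Properties as AllP
open import Data.List.Relation.Unary.AllPairs using ([]; _∷_)
open import Data.List.Relation.Unary.Any as Any using (here; there; index)
open import Data.List.Relation.Unary.Any.Properties using (lookup-index)
open import Data.List.Relation.Unary.Linked using (Linked; []; [-]; _∷_)
open import Data.List.Relation.Unary.Unique.Propositional using (Unique)
import Data.List.Relation.Unary.Unique.DecPropositional.Properties as UniqueDec
open import Data.List.Relation.Unary.Unique.Propositional.Properties using (upTo⁺; allFin⁺)
import Data.List.Sort as Sort
open import Data.Nat as ℕ using (ℕ; zero; suc; _∸_; _!; s≤s; z≤n)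
open import Data.Nat.Induction using (<-rec)
open import Data.Nat.ListAction using (sum)
import Data.Nat.Properties as ℕP
import Data.Nat.Tactic.RingSolver as ℕRing
open import Data.Product using (_×_; _,_; proj₁; proj₂; Σ; ∃)
open import Data.Rational as ℚ using (ℚ; 0ℚ; 1ℚ)
import Data.Rational.Properties as ℚP
import Data.Rational.Solver as ℚSolver
import Data.Rational.Unnormalised as ℚᵘ
import Data.Rational.Unnormalised.Properties as ℚᵘP
open import Data.Sum using (_⊎_; inj₁; inj₂)
open import Data.Unit using (⊤; tt)
open import Data.Vec as Vec using (Vec; []; _∷_; zipWith; replicate)
open import Data.Vec.Functional using (insertAt)
import Data.Vec.Functional.Properties as VFP
import Data.Vec.Properties as VecP
open import Data.Vec.Relation.Unary.All as VecAll using ([]; _∷_)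
open import Data.Vec.Relation.Unary.Any as VecAny using (here; there)
open import Function using (_∘_; _$_)
open import Function.Bundles using (Equivalence)
open import Level using (0ℓ)
import Relation.Binary.Construct.Flip.EqAndOrd as Flip
open import Relation.Binary.Bundles using (Setoid)
open import Relation.Binary.PropositionalEquality using (_≡_; _≢_; refl; sym; trans; cong; cong₂; subst; module ≡-Reasoning)
open import Relation.Binary.Structures using (IsEquivalence)
open import Relation.Nullary using (Dec; yes; no; ¬_; ¬?)
open import Relation.Nullary.Decidable using (toWitness; fromWitness; map′; decidable-stable) renaming (⌊_⌋ to isYes)

-- Rational numbers and finite sums

-- A kernel vector of the matrix at α = 1 is a functional on symmetric functions, so invertibility
-- means that no nonzero functional of bounded weight kills all the vectors built from partitions.
-- The bound on the weight makes F a finite sum, hence the sum of squares a finite one in ℚ.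
--
-- The vanishing of ΔF is needed at all positive exponents in any order, whereas partitions are
-- weakly decreasing. Commutativity of the X operators at α = 1 closes this gap: in normal order
-- X(z)X(w) carries the factor (z - w)², up to a symmetric monomial, and this is symmetric in z and
-- w.
--
-- Exponentials of operators are not handled as formal series. Applying x d/dx gives a recurrence
-- for their coefficients, and the relations between vertex operators are proved by induction along
-- it, dividing by the index over ℚ.
--
-- For the other values of α nothing but homogeneity is used. The sign between Δ and the product of
-- the differences z^τ - 2 + z^(-τ) is not tracked, because only vanishing matters.

toℚ : ℤ → ℚ
toℚ z = z ℚ./ 1

toℚ-+ : ∀ x y → toℚ (x ℤ.+ y) ≡ toℚ x ℚ.+ toℚ y
toℚ-+ x y = ℚP.toℚᵘ-injective
  (ℚᵘP.≃-trans (ℚP.toℚᵘ-fromℚᵘ (ℚᵘ.mkℚᵘ (x ℤ.+ y) 0))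
  (ℚᵘP.≃-trans (ℚᵘ.*≡* (cong (ℤ._* + 1) (sym (cong₂ ℤ._+_ (ℤP.*-identityʳ x) (ℤP.*-identityʳ y)))))
  (ℚᵘP.≃-sym (ℚᵘP.≃-trans (ℚP.toℚᵘ-homo-+ (toℚ x) (toℚ y))
     (ℚᵘP.+-cong (ℚP.toℚᵘ-fromℚᵘ (ℚᵘ.mkℚᵘ x 0)) (ℚP.toℚᵘ-fromℚᵘ (ℚᵘ.mkℚᵘ y 0)))))))

toℚ-* : ∀ x y → toℚ (x ℤ.* y) ≡ toℚ x ℚ.* toℚ y
toℚ-* x y = ℚP.toℚᵘ-injective
  (ℚᵘP.≃-trans (ℚP.toℚᵘ-fromℚᵘ (ℚᵘ.mkℚᵘ (x ℤ.* y) 0))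
  (ℚᵘP.≃-sym (ℚᵘP.≃-trans (ℚP.toℚᵘ-homo-* (toℚ x) (toℚ y))
     (ℚᵘP.*-cong (ℚP.toℚᵘ-fromℚᵘ (ℚᵘ.mkℚᵘ x 0)) (ℚP.toℚᵘ-fromℚᵘ (ℚᵘ.mkℚᵘ y 0))))))

frac-cancel : ∀ z d → frac z (suc d) ℚ.* fromℕ (suc d) ≡ toℚ z
frac-cancel z d = ℚP.toℚᵘ-injective
  (ℚᵘP.≃-trans (ℚP.toℚᵘ-homo-* (z ℚ./ suc d) (toℚ (+ suc d)))
  (ℚᵘP.≃-trans (ℚᵘP.*-cong (ℚP.toℚᵘ-fromℚᵘ (ℚᵘ.mkℚᵘ z d)) (ℚP.toℚᵘ-fromℚᵘ (ℚᵘ.mkℚᵘ (+ suc d) 0)))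
  (ℚᵘP.≃-trans (ℚᵘ.*≡* lem)
  (ℚᵘP.≃-sym (ℚP.toℚᵘ-fromℚᵘ (ℚᵘ.mkℚᵘ z 0))))))
  where
  lem : z ℤ.* + suc d ℤ.* + 1 ≡ z ℤ.* (+ suc d ℤ.* + 1)
  lem = ℤP.*-assoc z (+ suc d) (+ 1)

toℚ-injective : ∀ {x y} → toℚ x ≡ toℚ y → x ≡ y
toℚ-injective {x} {y} e with ℚP.fromℚᵘ-injective {ℚᵘ.mkℚᵘ x 0} {ℚᵘ.mkℚᵘ y 0} e
... | ℚᵘ.*≡* p = trans (sym (ℤP.*-identityʳ x)) (trans p (ℤP.*-identityʳ y))

toℚ≢0 : ∀ {x} → x ≢ + 0 → toℚ x ≢ 0ℚ
toℚ≢0 x≢0 e = x≢0 (toℚ-injective e)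

fromℕ-suc≢0 : ∀ n → fromℕ (suc n) ≢ 0ℚ
fromℕ-suc≢0 n = toℚ≢0 {+ suc n} λ ()

fromℕ-suc : ∀ n → fromℕ (suc n) ≡ 1ℚ ℚ.+ fromℕ n
fromℕ-suc n = toℚ-+ (+ 1) (+ n)

inverse : ∀ {q} → q ≢ 0ℚ → ∃ λ r → q ℚ.* r ≡ 1ℚ
inverse {q} q≢0 = (ℚ.1/ q) , ℚP.*-inverseʳ q
  where instance _ = ℚ.≢-nonZero q≢0

*-cancelˡ : ∀ {q x y} → q ≢ 0ℚ → q ℚ.* x ≡ q ℚ.* y → x ≡ y
*-cancelˡ {q} {x} {y} q≢0 e = begin
  x                     ≡⟨ lem x ⟨
  r ℚ.* (q ℚ.* x)       ≡⟨ cong (r ℚ.*_) e ⟩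
  r ℚ.* (q ℚ.* y)       ≡⟨ lem y ⟩
  y ∎
  where
  open ≡-Reasoning
  r = proj₁ (inverse q≢0)
  lem : ∀ x → r ℚ.* (q ℚ.* x) ≡ x
  lem x = trans (sym (ℚP.*-assoc r q x))
         (trans (cong (ℚ._* x) (trans (ℚP.*-comm r q) (proj₂ (inverse q≢0)))) (ℚP.*-identityˡ x))

*≡0⇒ : ∀ {p q} → q ≢ 0ℚ → q ℚ.* p ≡ 0ℚ → p ≡ 0ℚ
*≡0⇒ {p} {q} q≢0 e = *-cancelˡ q≢0 (trans e (sym (ℚP.*-zeroʳ q)))

*≢0 : ∀ {p q} → p ≢ 0ℚ → q ≢ 0ℚ → p ℚ.* q ≢ 0ℚ
*≢0 p≢0 q≢0 e = q≢0 (*≡0⇒ p≢0 e)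

square-nonNeg : ∀ p → 0ℚ ℚ.≤ p ℚ.* p
square-nonNeg p = subst (0ℚ ℚ.≤_) (ℚP.∣p*q∣≡∣p∣*∣q∣ p p ⟨trans⟩ lem) (ℚP.0≤∣p∣ (p ℚ.* p))
  where
  _⟨trans⟩_ = trans
  lem : ℚ.∣ p ∣ ℚ.* ℚ.∣ p ∣ ≡ p ℚ.* p
  lem with ℚP.∣p∣≡p∨∣p∣≡-p p
  ... | inj₁ e rewrite e = refl
  ... | inj₂ e rewrite e = trans (sym (ℚP.neg-distribˡ-* p (ℚ.- p)))
          (trans (cong ℚ.-_ (sym (ℚP.neg-distribʳ-* p p))) (RingProperties.-‿involutive ℚP.+-*-ring (p ℚ.* p)))

square+nonNeg≡0 : ∀ {p q} → 0ℚ ℚ.≤ q → p ℚ.* p ℚ.+ q ≡ 0ℚ → p ≡ 0ℚ × q ≡ 0ℚ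
square+nonNeg≡0 {p} {q} 0≤q e = p≡0 , q≡0
  where
  q≡0 : q ≡ 0ℚ
  q≡0 = ℚP.≤-antisym (subst (q ℚ.≤_) e
          (subst (ℚ._≤ p ℚ.* p ℚ.+ q) (ℚP.+-identityˡ q) (ℚP.+-monoˡ-≤ q (square-nonNeg p)))) 0≤q
  pp≡0 : p ℚ.* p ≡ 0ℚ
  pp≡0 = trans (sym (ℚP.+-identityʳ (p ℚ.* p))) (trans (cong (p ℚ.* p ℚ.+_) (sym q≡0)) e)
  p≡0 : p ≡ 0ℚ
  p≡0 with p ℚP.≟ 0ℚ
  ... | yes r = r
  ... | no  r = *≡0⇒ r pp≡0

-- Used over ℚ and over ℚ(α). Sums run over lists because `expCoeff` and `Xneg` produce lists by
-- `concatMap`.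
module ListSum {c ℓ} (R : CommutativeRing c ℓ) where
  open CommutativeRing R renaming (refl to ≈-refl; sym to ≈-sym; trans to ≈-trans)
  open import Relation.Binary.Reasoning.Setoid setoid
  open import Algebra.Properties.CommutativeSemigroup +-commutativeSemigroup using (interchange)
  open RingProperties ring using (-0#≈0#; -‿+-comm)

  private variable
    A B : Set

  ∑ : List A → (A → Carrier) → Carrier
  ∑ []       f = 0#
  ∑ (x ∷ xs) f = f x + ∑ xs f

  ∑-cong : ∀ (xs : List A) {f g : A → Carrier} → (∀ x → f x ≈ g x) → ∑ xs f ≈ ∑ xs g
  ∑-cong []       e = ≈-refl
  ∑-cong (x ∷ xs) e = +-cong (e x) (∑-cong xs e)

  ∑-cong-All : ∀ {xs : List A} {f g : A → Carrier} → All (λ x → f x ≈ g x) xs → ∑ xs f ≈ ∑ xs g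
  ∑-cong-All []       = ≈-refl
  ∑-cong-All (e ∷ es) = +-cong e (∑-cong-All es)

  ∑-zero : ∀ (xs : List A) → ∑ xs (λ _ → 0#) ≈ 0#
  ∑-zero []       = ≈-refl
  ∑-zero (x ∷ xs) = ≈-trans (+-identityˡ _) (∑-zero xs)

  ∑-zero-All : ∀ {xs : List A} {f : A → Carrier} → All (λ x → f x ≈ 0#) xs → ∑ xs f ≈ 0#
  ∑-zero-All {xs = xs} es = ≈-trans (∑-cong-All es) (∑-zero xs)

  ∑-+ : ∀ (xs : List A) (f g : A → Carrier) → ∑ xs (λ x → f x + g x) ≈ ∑ xs f + ∑ xs g
  ∑-+ []       f g = ≈-sym (+-identityˡ 0#)
  ∑-+ (x ∷ xs) f g = ≈-trans (+-congˡ (∑-+ xs f g)) (interchange (f x) (g x) _ _)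

  ∑-* : ∀ (xs : List A) q (f : A → Carrier) → ∑ xs (λ x → q * f x) ≈ q * ∑ xs f
  ∑-* []       q f = ≈-sym (zeroʳ q)
  ∑-* (x ∷ xs) q f = ≈-trans (+-congˡ (∑-* xs q f)) (≈-sym (distribˡ q _ _))

  ∑-swap : ∀ (xs : List A) (ys : List B) (f : A → B → Carrier) →
           ∑ xs (λ x → ∑ ys (f x)) ≈ ∑ ys (λ y → ∑ xs (λ x → f x y))
  ∑-swap []       ys f = ≈-sym (∑-zero ys)
  ∑-swap (x ∷ xs) ys f = ≈-trans (+-congˡ (∑-swap xs ys f)) (≈-sym (∑-+ ys _ _))

  ∑-++ : ∀ (xs ys : List A) (f : A → Carrier) → ∑ (xs ++ ys) f ≈ ∑ xs f + ∑ ys f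
  ∑-++ []       ys f = ≈-sym (+-identityˡ _)
  ∑-++ (x ∷ xs) ys f = ≈-trans (+-congˡ (∑-++ xs ys f)) (≈-sym (+-assoc _ _ _))

  ∑-map : ∀ (g : A → B) (xs : List A) (f : B → Carrier) → ∑ (map g xs) f ≡ ∑ xs (λ x → f (g x))
  ∑-map g []       f = refl
  ∑-map g (x ∷ xs) f = cong (λ s → f (g x) + s) (∑-map g xs f)

  ∑-concatMap : ∀ (g : A → List B) (xs : List A) (f : B → Carrier) →
                ∑ (concatMap g xs) f ≈ ∑ xs (λ x → ∑ (g x) f)
  ∑-concatMap g []       f = ≈-refl
  ∑-concatMap g (x ∷ xs) f = ≈-trans (∑-++ (g x) _ f) (+-congˡ (∑-concatMap g xs f))

  upTo-suc : ∀ n → upTo (suc n) ≡ 0 ∷ map suc (upTo n)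
  upTo-suc n = cong (0 ∷_) (sym (LP.map-applyUpTo (λ x → x) suc n))

  ∑-upTo-suc : ∀ n (f : ℕ → Carrier) → ∑ (upTo (suc n)) f ≡ f 0 + ∑ (upTo n) (λ i → f (suc i))
  ∑-upTo-suc n f = trans (cong (λ l → ∑ l f) (upTo-suc n)) (cong (λ s → f 0 + s) (∑-map suc (upTo n) f))

  ∑-upTo-last : ∀ n (f : ℕ → Carrier) → ∑ (upTo (suc n)) f ≈ ∑ (upTo n) f + f n
  ∑-upTo-last zero    f = ≈-trans (+-identityʳ _) (≈-sym (+-identityˡ _))
  ∑-upTo-last (suc n) f = begin
    ∑ (upTo (suc (suc n))) f                              ≡⟨ ∑-upTo-suc (suc n) f ⟩
    f 0 + ∑ (upTo (suc n)) (λ i → f (suc i))              ≈⟨ +-congˡ (∑-upTo-last n (λ i → f (suc i))) ⟩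
    f 0 + (∑ (upTo n) (λ i → f (suc i)) + f (suc n))      ≈⟨ +-assoc _ _ _ ⟨
    f 0 + ∑ (upTo n) (λ i → f (suc i)) + f (suc n)        ≡⟨ cong (_+ f (suc n)) (∑-upTo-suc n f) ⟨
    ∑ (upTo (suc n)) f + f (suc n) ∎

  ∑-upTo-extend : ∀ {m n} (f : ℕ → Carrier) → m ℕ.≤ n → (∀ i → m ℕ.≤ i → f i ≈ 0#) →
                  ∑ (upTo n) f ≈ ∑ (upTo m) f
  ∑-upTo-extend {zero} {zero} f _ z = ≈-refl
  ∑-upTo-extend {zero} {suc n} f _ z = ≈-trans (∑-upTo-last n f)
    (≈-trans (+-cong (∑-upTo-extend {ℕ.zero} {n} f ℕ.z≤n z) (z n ℕ.z≤n)) (+-identityʳ _))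
  ∑-upTo-extend {suc m} {suc n} f (ℕ.s≤s m≤n) z = begin
    ∑ (upTo (suc n)) f   ≡⟨ ∑-upTo-suc n f ⟩
    f 0 + ∑ (upTo n) (λ i → f (suc i)) ≈⟨ +-congˡ (∑-upTo-extend (λ i → f (suc i)) m≤n (λ i m≤i → z (suc i) (ℕ.s≤s m≤i))) ⟩
    f 0 + ∑ (upTo m) (λ i → f (suc i)) ≡⟨ ∑-upTo-suc m f ⟨
    ∑ (upTo (suc m)) f ∎

  ∑-single : ∀ {xs : List A} {y} (f : A → Carrier) → Unique xs → y ∈ xs → (∀ x → x ≢ y → f x ≈ 0#) →
             ∑ xs f ≈ f y
  ∑-single {y = y} f (x∉ ∷ u) (here refl) z =
    ≈-trans (+-congˡ (∑-zero-All (All.map (λ {x} ne → z x (λ e → ne (sym e))) x∉))) (+-identityʳ _)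
  ∑-single {y = y} f (x∉ ∷ u) (there y∈) z =
    ≈-trans (+-cong (z _ (λ e → All.lookup x∉ y∈ e)) (∑-single f u y∈ z)) (+-identityˡ _)

-- Elimination

module ℚΣ = SemiringSum (CommutativeRing.semiring ℚP.+-*-commutativeRing)

module Elimination {ℓ₁ ℓ₂} (R : CommutativeRing ℓ₁ ℓ₂) where
  open CommutativeRing R hiding (zero) renaming (refl to ≈-refl; sym to ≈-sym; trans to ≈-trans)
  open SemiringSum semiring renaming (sum to sumᴿ)
  open import Relation.Binary.Reasoning.Setoid setoid
  private module S = SemiringSolver commutativeSemiring

  -- Asking for the inverse of -x keeps every computation below within semiring identities.
  module _ (Spec : Carrier → ℚ → Set)
    (Spec-* : ∀ {x y p q} → Spec x p → Spec y q → Spec (x * y) (p ℚ.* q))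
    (Spec-+ : ∀ {x y p q} → Spec x p → Spec y q → Spec (x + y) (p ℚ.+ q))
    (Spec-negated-inverse : ∀ {x p} → Spec x p → p ≢ 0ℚ →
      ∃ λ y → ∃ λ q → x * y + 1# ≈ 0# × p ℚ.* q ℚ.+ 1ℚ ≡ 0ℚ × Spec y q)
    where

    -- Elimination along the first column. The kernel hypothesis supplies a row whose first entry
    -- has nonzero value and is therefore invertible. The hypothesis passes to the Schur complement,
    -- where the induction applies. The combinations `c` run over rows, the kernel vectors `φ` over
    -- columns.
    kernel-free⇒basis : ∀ n (M : Fin n → Fin n → Carrier) (m : Fin n → Fin n → ℚ) →
      (∀ i j → Spec (M i j) (m i j)) →
      (∀ (φ : Fin n → ℚ) → (∀ i → ℚΣ.sum (λ j → m i j ℚ.* φ j) ≡ 0ℚ) → ∀ j → φ j ≡ 0ℚ) →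
      (∀ (w : Fin n → Carrier) → Σ (Fin n → Carrier) λ c → ∀ j → sumᴿ (λ i → c i * M i j) ≈ w j) ×
      (∀ (c : Fin n → Carrier) → (∀ j → sumᴿ (λ i → c i * M i j) ≈ 0#) → ∀ i → c i ≈ 0#)
    kernel-free⇒basis zero M m spec ker = (λ w → (λ ()) , λ ()) , λ c _ ()
    kernel-free⇒basis (suc n) M m spec ker with FinP.any? (λ i → ¬? (m i zero ℚP.≟ 0ℚ))
    -- A first column with only zero values puts the first unit vector into the kernel.
    ... | no no-pivot = ⊥-elim (1≢0 (ker δ δ-ker zero))
      where
      1≢0 : 1ℚ ≢ 0ℚ
      1≢0 ()
      δ : Fin (suc n) → ℚ
      δ zero    = 1ℚ
      δ (suc _) = 0ℚ
      δ-ker : ∀ i → ℚΣ.sum (λ j → m i j ℚ.* δ j) ≡ 0ℚ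
      δ-ker i = trans (cong₂ ℚ._+_
          (cong (ℚ._* 1ℚ) (decidable-stable (m i zero ℚP.≟ 0ℚ) (λ ne → no-pivot (i , ne))))
          (trans (ℚΣ.sum-cong-≗ {n} (λ j → ℚP.*-zeroʳ (m i (suc j)))) (ℚΣ.sum-replicate-zero n)))
          (ℚP.+-identityʳ 0ℚ)
    ... | yes (i , pivot) = spans , independent
      where
      inv = Spec-negated-inverse (spec i zero) pivot
      u = proj₁ inv
      v = proj₁ (proj₂ inv)
      Mu+1≈0 : M i zero * u + 1# ≈ 0#
      Mu+1≈0 = proj₁ (proj₂ (proj₂ inv))
      mv+1≡0 : m i zero ℚ.* v ℚ.+ 1ℚ ≡ 0ℚ
      mv+1≡0 = proj₁ (proj₂ (proj₂ (proj₂ inv)))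
      spec-u : Spec u v
      spec-u = proj₂ (proj₂ (proj₂ (proj₂ inv)))
      -- The Schur complement of the pivot; the sign is plus because `u` is minus the inverse of the
      -- pivot.
      M′ : Fin n → Fin n → Carrier
      M′ r s = M (punchIn i r) (suc s) + M (punchIn i r) zero * (u * M i (suc s))
      m′ : Fin n → Fin n → ℚ
      m′ r s = m (punchIn i r) (suc s) ℚ.+ m (punchIn i r) zero ℚ.* (v ℚ.* m i (suc s))
      spec′ : ∀ r s → Spec (M′ r s) (m′ r s)
      spec′ r s = Spec-+ (spec _ _) (Spec-* (spec _ _) (Spec-* spec-u (spec _ _)))

      ker′ : ∀ (φ : Fin n → ℚ) → (∀ r → ℚΣ.sum (λ s → m′ r s ℚ.* φ s) ≡ 0ℚ) → ∀ s → φ s ≡ 0ℚ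
      ker′ φ φ-ker s = ker φ⁺ φ⁺-ker (suc s)
        where
        open ℚSolver.+-*-Solver
        tail-sum : Fin (suc n) → ℚ
        tail-sum k = ℚΣ.sum (λ s → m k (suc s) ℚ.* φ s)
        -- The new coordinate is the one that makes the pivot row kill `φ⁺`. On every other row it
        -- turns the full sum into that of the reduced row.
        φ⁺ : Fin (suc n) → ℚ
        φ⁺ zero    = v ℚ.* tail-sum i
        φ⁺ (suc s) = φ s
        pivot-row : ℚΣ.sum (λ j → m i j ℚ.* φ⁺ j) ≡ 0ℚ
        pivot-row = trans (solve 3 (λ a b t → a :* (b :* t) :+ t := (a :* b :+ con 1ℚ) :* t) refl (m i zero) v (tail-sum i))
          (trans (cong (ℚ._* tail-sum i) mv+1≡0) (ℚP.*-zeroˡ (tail-sum i)))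
        other-row : ∀ r → ℚΣ.sum (λ j → m (punchIn i r) j ℚ.* φ⁺ j) ≡ 0ℚ
        other-row r = trans (sym eq) (φ-ker r)
          where
          k = punchIn i r
          eq : ℚΣ.sum (λ s → m′ r s ℚ.* φ s) ≡ m k zero ℚ.* (v ℚ.* tail-sum i) ℚ.+ tail-sum k
          eq = trans (ℚΣ.sum-cong-≗ {n} (λ s →
                 solve 5 (λ a b c d e → (a :+ b :* (c :* d)) :* e := a :* e :+ (b :* c) :* (d :* e)) refl
                   (m k (suc s)) (m k zero) v (m i (suc s)) (φ s)))
               (trans (ℚΣ.∑-distrib-+ {n} _ _)
               (trans (cong (tail-sum k ℚ.+_) (sym (ℚΣ.*-distribˡ-sum {n} (m k zero ℚ.* v) _)))
                 (solve 4 (λ t a b c → t :+ (a :* b) :* c := a :* (b :* c) :+ t) refl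
                   (tail-sum k) (m k zero) v (tail-sum i))))
        φ⁺-ker : ∀ k → ℚΣ.sum (λ j → m k j ℚ.* φ⁺ j) ≡ 0ℚ
        φ⁺-ker k with i FinP.≟ k
        ... | yes refl = pivot-row
        ... | no i≢k = subst (λ k → ℚΣ.sum (λ j → m k j ℚ.* φ⁺ j) ≡ 0ℚ)
                         (FinP.punchIn-punchOut i≢k) (other-row _)

      ih = kernel-free⇒basis n M′ m′ spec′ ker′

      sum-M′ : ∀ (c : Fin n → Carrier) s → sumᴿ (λ r → c r * M′ r s) ≈
        sumᴿ (λ r → c r * M (punchIn i r) (suc s)) + sumᴿ (λ r → c r * M (punchIn i r) zero) * (u * M i (suc s))
      sum-M′ c s = begin
        sumᴿ (λ r → c r * M′ r s)
          ≈⟨ sum-cong-≋ {n} (λ r → S.solve 4 (λ c a b d → let open S in c :* (a :+ b :* d) := c :* a :+ (c :* b) :* d) ≈-refl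
               (c r) (M (punchIn i r) (suc s)) (M (punchIn i r) zero) (u * M i (suc s))) ⟩
        sumᴿ (λ r → c r * M (punchIn i r) (suc s) + c r * M (punchIn i r) zero * (u * M i (suc s)))
          ≈⟨ ∑-distrib-+ {n} _ _ ⟩
        sumᴿ (λ r → c r * M (punchIn i r) (suc s)) + sumᴿ (λ r → c r * M (punchIn i r) zero * (u * M i (suc s)))
          ≈⟨ +-congˡ (*-distribʳ-sum {n} _ _) ⟨
        _ ∎

      remove : ∀ (c : Fin (suc n) → Carrier) j →
        sumᴿ (λ k → c k * M k j) ≈ c i * M i j + sumᴿ (λ r → c (punchIn i r) * M (punchIn i r) j)
      remove c j = sum-remove {n} {i} (λ k → c k * M k j)

      spans : ∀ (w : Fin (suc n) → Carrier) → Σ (Fin (suc n) → Carrier) λ c → ∀ j → sumᴿ (λ i → c i * M i j) ≈ w j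
      spans w = d , eq
        where
        -- What is left of `w` after a multiple of the pivot row has cleared its first coordinate.
        w′ : Fin n → Carrier
        w′ s = w (suc s) + w zero * (u * M i (suc s))
        c′ = proj₁ (proj₁ ih w′)
        Σ₀ = sumᴿ (λ r → c′ r * M (punchIn i r) zero)
        -w₀ = - w zero
        -- Column 0 forces the pivot coefficient: as `u` is minus the inverse of the pivot, this is
        -- w₀ - Σ₀ divided by the pivot.
        d = insertAt c′ i (u * (Σ₀ + -w₀))
        expand : ∀ j → sumᴿ (λ k → d k * M k j) ≈
                 u * (Σ₀ + -w₀) * M i j + sumᴿ (λ r → c′ r * M (punchIn i r) j)
        expand j = ≈-trans (remove d j) (+-cong
          (*-congʳ (reflexive (VFP.insertAt-lookup c′ i _)))
          (sum-cong-≋ {n} (λ r → *-congʳ (reflexive (VFP.insertAt-punchIn c′ i _ r)))))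
        eq : ∀ j → sumᴿ (λ k → d k * M k j) ≈ w j
        eq zero = begin
          sumᴿ (λ k → d k * M k zero)
            ≈⟨ expand zero ⟩
          u * (Σ₀ + -w₀) * M i zero + Σ₀
            ≈⟨ ≈-trans (+-congˡ (-‿inverseˡ (w zero))) (+-identityʳ _) ⟨
          u * (Σ₀ + -w₀) * M i zero + Σ₀ + (-w₀ + w zero)
            ≈⟨ S.solve 5 (λ u t n m w → let open S in u :* (t :+ n) :* m :+ t :+ (n :+ w) := (m :* u :+ con 1) :* (t :+ n) :+ w) ≈-refl
                 u Σ₀ -w₀ (M i zero) (w zero) ⟩
          (M i zero * u + 1#) * (Σ₀ + -w₀) + w zero
            ≈⟨ +-congʳ (≈-trans (*-congʳ Mu+1≈0) (zeroˡ _)) ⟩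
          0# + w zero
            ≈⟨ +-identityˡ _ ⟩
          w zero ∎
        eq (suc s) = begin
          sumᴿ (λ k → d k * M k (suc s))
            ≈⟨ expand (suc s) ⟩
          u * (Σ₀ + -w₀) * M i (suc s) + sumᴿ (λ r → c′ r * M (punchIn i r) (suc s))
            ≈⟨ S.solve 5 (λ u t n x y → let open S in u :* (t :+ n) :* x :+ y := (y :+ t :* (u :* x)) :+ n :* (u :* x)) ≈-refl
                 u Σ₀ -w₀ (M i (suc s)) _ ⟩
          (sumᴿ (λ r → c′ r * M (punchIn i r) (suc s)) + Σ₀ * (u * M i (suc s))) + -w₀ * (u * M i (suc s))
            ≈⟨ +-congʳ (≈-trans (≈-sym (sum-M′ c′ s)) (proj₂ (proj₁ ih w′) s)) ⟩
          w (suc s) + w zero * (u * M i (suc s)) + -w₀ * (u * M i (suc s))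
            ≈⟨ S.solve 4 (λ y w n z → let open S in y :+ w :* z :+ n :* z := y :+ (n :+ w) :* z) ≈-refl (w (suc s)) (w zero) -w₀ _ ⟩
          w (suc s) + (-w₀ + w zero) * (u * M i (suc s))
            ≈⟨ +-congˡ (≈-trans (*-congʳ (-‿inverseˡ (w zero))) (zeroˡ _)) ⟩
          w (suc s) + 0#
            ≈⟨ +-identityʳ _ ⟩
          w (suc s) ∎

      independent : ∀ (c : Fin (suc n) → Carrier) → (∀ j → sumᴿ (λ i → c i * M i j) ≈ 0#) → ∀ i → c i ≈ 0#
      independent c eq = all-zero
        where
        c′ : Fin n → Carrier
        c′ r = c (punchIn i r)
        Σ₀ = sumᴿ (λ r → c′ r * M (punchIn i r) zero)
        -- Adding `c i * x` times the vanishing `M i zero * u + 1#` completes the reduced sum to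
        -- column s + 1 plus a multiple of column 0. Both columns vanish by assumption.
        eq′ : ∀ s → sumᴿ (λ r → c′ r * M′ r s) ≈ 0#
        eq′ s = begin
          sumᴿ (λ r → c′ r * M′ r s)
            ≈⟨ sum-M′ c′ s ⟩
          Σₛ + Σ₀ * (u * x)
            ≈⟨ ≈-trans (+-congˡ (≈-trans (*-congˡ Mu+1≈0) (zeroʳ _))) (+-identityʳ _) ⟨
          Σₛ + Σ₀ * (u * x) + c i * x * (M i zero * u + 1#)
            ≈⟨ S.solve 6 (λ y t u x c m → let open S in y :+ t :* (u :* x) :+ c :* x :* (m :* u :+ con 1)
                           := (c :* x :+ y) :+ (c :* m :+ t) :* (u :* x)) ≈-refl Σₛ Σ₀ u x (c i) (M i zero) ⟩
          (c i * x + Σₛ) + (c i * M i zero + Σ₀) * (u * x)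
            ≈⟨ +-cong (≈-trans (≈-sym (remove c (suc s))) (eq (suc s)))
                      (≈-trans (*-congʳ (≈-trans (≈-sym (remove c zero)) (eq zero))) (zeroˡ _)) ⟩
          0# + 0#
            ≈⟨ +-identityʳ _ ⟩
          0# ∎
          where
          x = M i (suc s)
          Σₛ = sumᴿ (λ r → c′ r * M (punchIn i r) (suc s))
        c′≈0 : ∀ r → c′ r ≈ 0#
        c′≈0 = proj₂ ih c′ eq′
        Σ₀≈0 : Σ₀ ≈ 0#
        Σ₀≈0 = ≈-trans (sum-cong-≋ {n} (λ r → ≈-trans (*-congʳ (c′≈0 r)) (zeroˡ _))) (sum-replicate-zero n)
        ci≈0 : c i ≈ 0#
        ci≈0 = begin
          c i
            ≈⟨ ≈-trans (+-congˡ (≈-trans (*-congʳ (≈-trans (≈-sym (remove c zero)) (eq zero))) (zeroˡ u))) (+-identityʳ _) ⟨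
          c i + (c i * M i zero + Σ₀) * u
            ≈⟨ S.solve 4 (λ c m t u → let open S in c :+ (c :* m :+ t) :* u := c :* (m :* u :+ con 1) :+ t :* u) ≈-refl
                 (c i) (M i zero) Σ₀ u ⟩
          c i * (M i zero * u + 1#) + Σ₀ * u
            ≈⟨ +-cong (≈-trans (*-congˡ Mu+1≈0) (zeroʳ _))
                      (≈-trans (*-congʳ Σ₀≈0) (zeroˡ u)) ⟩
          0# + 0#
            ≈⟨ +-identityʳ _ ⟩
          0# ∎
        all-zero : ∀ k → c k ≈ 0#
        all-zero k with i FinP.≟ k
        ... | yes refl = ci≈0
        ... | no i≢k = subst (λ k → c k ≈ 0#) (FinP.punchIn-punchOut i≢k) (c′≈0 _)

open ℚSolver.+-*-Solver using (solve; _:=_; _:+_; _:*_; _:-_; :-_; con)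

-- Polynomials and rational functions

evalP-+ : ∀ p q x → evalP (p +ₚ q) x ≡ evalP p x ℚ.+ evalP q x
evalP-+ []      q       x = sym (ℚP.+-identityˡ _)
evalP-+ (a ∷ p) []      x = sym (ℚP.+-identityʳ _)
evalP-+ (a ∷ p) (b ∷ q) x rewrite evalP-+ p q x =
  solve 5 (λ a b x p q → (a :+ b) :+ x :* (p :+ q) := (a :+ x :* p) :+ (b :+ x :* q)) refl
    a b x (evalP p x) (evalP q x)

evalP-scale : ∀ a q x → evalP (map (a ℚ.*_) q) x ≡ a ℚ.* evalP q x
evalP-scale a []      x = sym (ℚP.*-zeroʳ a)
evalP-scale a (b ∷ q) x rewrite evalP-scale a q x =
  solve 4 (λ a b x q → a :* b :+ x :* (a :* q) := a :* (b :+ x :* q)) refl a b x (evalP q x)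

evalP-* : ∀ p q x → evalP (p *ₚ q) x ≡ evalP p x ℚ.* evalP q x
evalP-* []      q x = sym (ℚP.*-zeroˡ (evalP q x))
evalP-* (a ∷ p) q x
  rewrite evalP-+ (map (a ℚ.*_) q) (0ℚ ∷ (p *ₚ q)) x | evalP-scale a q x | evalP-* p q x =
  solve 4 (λ a x p q → a :* q :+ (con 0ℚ :+ x :* (p :* q)) := (a :+ x :* p) :* q) refl
    a x (evalP p x) (evalP q x)

-ₚ_ : Poly → Poly
-ₚ p = map ((ℚ.- 1ℚ) ℚ.*_) p

evalP-neg : ∀ p x → evalP (-ₚ p) x ≡ ℚ.- evalP p x
evalP-neg p x = trans (evalP-scale (ℚ.- 1ℚ) p x)
  (solve 1 (λ p → con (ℚ.- 1ℚ) :* p := :- p) refl (evalP p x))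

pcoeff-+ : ∀ p q k → pcoeff (p +ₚ q) k ≡ pcoeff p k ℚ.+ pcoeff q k
pcoeff-+ []      q       k       = sym (ℚP.+-identityˡ _)
pcoeff-+ (a ∷ p) []      k       = sym (ℚP.+-identityʳ _)
pcoeff-+ (a ∷ p) (b ∷ q) zero    = refl
pcoeff-+ (a ∷ p) (b ∷ q) (suc k) = pcoeff-+ p q k

pcoeff-neg : ∀ p k → pcoeff (-ₚ p) k ≡ ℚ.- pcoeff p k
pcoeff-neg []      k       = refl
pcoeff-neg (a ∷ p) zero    = solve 1 (λ p → con (ℚ.- 1ℚ) :* p := :- p) refl a
pcoeff-neg (a ∷ p) (suc k) = pcoeff-neg p k

≈ₚ⇒evalP≡ : ∀ p q → p ≈ₚ q → ∀ x → evalP p x ≡ evalP q x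
≈ₚ⇒evalP≡ []      []      e x = refl
≈ₚ⇒evalP≡ []      (b ∷ q) e x = sym (trans (cong₂ (λ u v → u ℚ.+ x ℚ.* v) (sym (e 0)) (sym (≈ₚ⇒evalP≡ [] q (λ k → e (suc k)) x)))
  (solve 1 (λ x → con 0ℚ :+ x :* con 0ℚ := con 0ℚ) refl x))
≈ₚ⇒evalP≡ (a ∷ p) []      e x = trans (cong₂ (λ u v → u ℚ.+ x ℚ.* v) (e 0) (≈ₚ⇒evalP≡ p [] (λ k → e (suc k)) x))
  (solve 1 (λ x → con 0ℚ :+ x :* con 0ℚ := con 0ℚ) refl x)
≈ₚ⇒evalP≡ (a ∷ p) (b ∷ q) e x =
  cong₂ (λ u v → u ℚ.+ x ℚ.* v) (e 0) (≈ₚ⇒evalP≡ p q (λ k → e (suc k)) x)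

-- Synthetic division by x - c: the coefficients of the quotient are the values at c of the
-- successive tails.
quotient : ℚ → Poly → Poly
quotient c []          = []
quotient c (a ∷ [])    = []
quotient c (a ∷ b ∷ p) = evalP (b ∷ p) c ∷ quotient c (b ∷ p)

evalP-quotient : ∀ c p x → evalP p x ≡ (x ℚ.- c) ℚ.* evalP (quotient c p) x ℚ.+ evalP p c
evalP-quotient c []       x = solve 2 (λ x c → con 0ℚ := (x :- c) :* con 0ℚ :+ con 0ℚ) refl x c
evalP-quotient c (a ∷ []) x =
  solve 3 (λ x c a → a :+ x :* con 0ℚ := (x :- c) :* con 0ℚ :+ (a :+ c :* con 0ℚ)) refl x c a
evalP-quotient c (a ∷ p@(b ∷ _)) x =
  trans (cong (λ u → a ℚ.+ x ℚ.* u) (evalP-quotient c p x))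
  (solve 5 (λ x c a q r → a :+ x :* ((x :- c) :* q :+ r) := (x :- c) :* (r :+ x :* q) :+ (a :+ c :* r)) refl
    x c a (evalP (quotient c p) x) (evalP p c))

-- The lowest coefficient of the quotient is the value of the tail at c, so the tail satisfies the
-- same hypotheses and the recursion can proceed.
root∧quotient≈0⇒≈0 : ∀ c p → evalP p c ≡ 0ℚ → quotient c p ≈ₚ [] → p ≈ₚ []
root∧quotient≈0⇒≈0 c []       e z k = refl
root∧quotient≈0⇒≈0 c (a ∷ []) e z zero = trans (solve 2 (λ a c → a := a :+ c :* con 0ℚ) refl a c) e
root∧quotient≈0⇒≈0 c (a ∷ []) e z (suc k) = refl
root∧quotient≈0⇒≈0 c (a ∷ p@(b ∷ _)) e z zero =
  trans (trans (solve 2 (λ a c → a := a :+ c :* con 0ℚ) refl a c) (cong (λ u → a ℚ.+ c ℚ.* u) (sym (z 0)))) e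
root∧quotient≈0⇒≈0 c (a ∷ p@(b ∷ _)) e z (suc k) =
  root∧quotient≈0⇒≈0 c p (z 0) (λ j → z (suc j)) k

suc-length-quotient : ∀ c a p → length (quotient c (a ∷ p)) ≡ length p
suc-length-quotient c a []      = refl
suc-length-quotient c a (b ∷ p) = cong suc (suc-length-quotient c b p)

-- Division by x - k shortens the list by one. For m > k the factor m - k is invertible, so the
-- quotient vanishes from k + 1 on. The induction is on the length and not the degree, as top
-- coefficients may be zero.
vanishing⇒≈0 : ∀ n p → length p ≡ n → ∀ k → (∀ m → k ℕ.≤ m → evalP p (fromℕ m) ≡ 0ℚ) → p ≈ₚ []
vanishing⇒≈0 zero    []      refl k v = λ _ → refl
vanishing⇒≈0 (suc n) (a ∷ p) refl k v =
  root∧quotient≈0⇒≈0 (fromℕ k) (a ∷ p) (v k ℕP.≤-refl)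
    (vanishing⇒≈0 n (quotient (fromℕ k) (a ∷ p)) (suc-length-quotient _ a p) (suc k) step)
  where
  step : ∀ m → suc k ℕ.≤ m → evalP (quotient (fromℕ k) (a ∷ p)) (fromℕ m) ≡ 0ℚ
  step m k<m = *≡0⇒ m-k≢0 (begin
    (fromℕ m ℚ.- fromℕ k) ℚ.* q                           ≡⟨ ℚP.+-identityʳ _ ⟨
    (fromℕ m ℚ.- fromℕ k) ℚ.* q ℚ.+ 0ℚ                    ≡⟨ cong ((fromℕ m ℚ.- fromℕ k) ℚ.* q ℚ.+_) (v k ℕP.≤-refl) ⟨
    (fromℕ m ℚ.- fromℕ k) ℚ.* q ℚ.+ evalP (a ∷ p) (fromℕ k) ≡⟨ evalP-quotient (fromℕ k) (a ∷ p) (fromℕ m) ⟨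
    evalP (a ∷ p) (fromℕ m)                               ≡⟨ v m (ℕP.<⇒≤ k<m) ⟩
    0ℚ ∎)
    where
    open ≡-Reasoning
    q = evalP (quotient (fromℕ k) (a ∷ p)) (fromℕ m)
    m-k≢0 : fromℕ m ℚ.- fromℕ k ≢ 0ℚ
    m-k≢0 e = ℕP.<-irrefl (k≡m (toℚ-injective {+ m} {+ k} (RingProperties.x∙y⁻¹≈ε⇒x≈y ℚP.+-*-ring _ _ e))) k<m
      where
      k≡m : + m ≡ + k → k ≡ m
      k≡m refl = refl

-- Only positive integers are tested, since these are the points at which specialisations are given.
evalP≡⇒≈ₚ : ∀ p q → (∀ m → evalP p (fromℕ (suc m)) ≡ evalP q (fromℕ (suc m))) → p ≈ₚ q
evalP≡⇒≈ₚ p q e k = RingProperties.x∙y⁻¹≈ε⇒x≈y ℚP.+-*-ring _ _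
  (trans (trans (cong (pcoeff p k ℚ.+_) (sym (pcoeff-neg q k))) (sym (pcoeff-+ p (-ₚ q) k)))
    (vanishing⇒≈0 _ (p +ₚ (-ₚ q)) refl 1 v k))
  where
  v : ∀ m → 1 ℕ.≤ m → evalP (p +ₚ (-ₚ q)) (fromℕ m) ≡ 0ℚ
  v (suc m) _ = trans (evalP-+ p (-ₚ q) x) (trans (cong₂ ℚ._+_ (e m) (evalP-neg q x)) (ℚP.+-inverseʳ (evalP q x)))
    where x = fromℕ (suc m)

zero? : ∀ p → p ≈ₚ [] ⊎ NonZeroPoly p
zero? []      = inj₁ λ _ → refl
zero? (a ∷ p) with a ℚP.≟ 0ℚ | zero? p
... | no a≢0   | _             = inj₂ (0 , a≢0)
... | yes _    | inj₂ (k , ne) = inj₂ (suc k , ne)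
... | yes refl | inj₁ z        = inj₁ λ { zero → refl ; (suc k) → z k }

evalP≢0⇒NonZero : ∀ p x → evalP p x ≢ 0ℚ → NonZeroPoly p
evalP≢0⇒NonZero p x ne with zero? p
... | inj₁ z  = ⊥-elim (ne (≈ₚ⇒evalP≡ p [] z x))
... | inj₂ nz = nz

powQ≢0 : ∀ {x} → x ≢ 0ℚ → ∀ j → powQ x j ≢ 0ℚ
powQ≢0 ne zero    ()
powQ≢0 ne (suc j) = *≢0 ne (powQ≢0 ne j)

extract-power : ∀ p → NonZeroPoly p →
  ∃ λ j → ∃ λ p̂ → (∀ x → evalP p x ≡ powQ x j ℚ.* evalP p̂ x) × evalP p̂ 0ℚ ≢ 0ℚ
extract-power [] (k , ne) = ⊥-elim (ne refl)
extract-power (a ∷ p) nz with a ℚP.≟ 0ℚ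
... | no a≢0 = 0 , a ∷ p , (λ x → sym (ℚP.*-identityˡ _)) ,
      λ e → a≢0 (trans (solve 2 (λ a u → a := a :+ con 0ℚ :* u) refl a (evalP p 0ℚ)) e)
... | yes refl with nz
...   | zero , ne  = ⊥-elim (ne refl)
...   | suc k , ne with extract-power p (k , ne)
...     | j , p̂ , e , ne′ = suc j , p̂ ,
          (λ x → trans (cong (λ u → 0ℚ ℚ.+ x ℚ.* u) (e x))
            (solve 3 (λ x y z → con 0ℚ :+ x :* (y :* z) := (x :* y) :* z) refl x (powQ x j) (evalP p̂ x))) ,
          ne′

-- Dividing both factors by their largest power of x leaves a product that does not vanish at 0.
zero-product : ∀ q p → NonZeroPoly q → (∀ m → evalP q (fromℕ (suc m)) ℚ.* evalP p (fromℕ (suc m)) ≡ 0ℚ) → p ≈ₚ []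
zero-product q p nzq e with zero? p
... | inj₁ z  = z
... | inj₂ nzp with extract-power q nzq | extract-power p nzp
...   | i , q̂ , eq , q̂≢0 | j , p̂ , ep , p̂≢0 =
  ⊥-elim (*≢0 q̂≢0 p̂≢0 (trans (sym (evalP-* q̂ p̂ 0ℚ)) (≈ₚ⇒evalP≡ (q̂ *ₚ p̂) [] product≈0 0ℚ)))
  where
  product≈0 : (q̂ *ₚ p̂) ≈ₚ []
  product≈0 = evalP≡⇒≈ₚ (q̂ *ₚ p̂) [] λ m → let x = fromℕ (suc m) in
    *≡0⇒ (*≢0 (powQ≢0 (fromℕ-suc≢0 m) i) (powQ≢0 (fromℕ-suc≢0 m) j))
      (trans (trans (cong (powQ x i ℚ.* powQ x j ℚ.*_) (evalP-* q̂ p̂ x))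
        (trans (solve 4 (λ a b c d → (a :* b) :* (c :* d) := (a :* c) :* (b :* d)) refl
                 (powQ x i) (powQ x j) (evalP q̂ x) (evalP p̂ x))
          (sym (cong₂ ℚ._*_ (eq x) (ep x)))))
        (e m))

NonZeroPoly-* : ∀ p q → NonZeroPoly p → NonZeroPoly q → NonZeroPoly (p *ₚ q)
NonZeroPoly-* p q nzp (k , ne) with zero? (p *ₚ q)
... | inj₂ nz = nz
... | inj₁ z  = ⊥-elim (ne (zero-product p q nzp
        (λ m → trans (sym (evalP-* p q _)) (≈ₚ⇒evalP≡ (p *ₚ q) [] z _)) k))

-- Identities between fractions are checked on their values (numerator, denominator) at enough points.
Pair : Set
Pair = ℚ × ℚ

value : ℚ → RatFun → Pair
value x r = evalP (num r) x , evalP (den r) x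

infix 4 _~_
infixl 6 _⊕_
infixl 7 _⊗_

-- Zero denominators are allowed, so this relation is not transitive. It is a record because the two
-- pairs cannot be recovered from the bare cross-multiplied equation.
record _~_ (u v : Pair) : Set where
  constructor mk~
  field cross : proj₁ u ℚ.* proj₂ v ≡ proj₁ v ℚ.* proj₂ u
open _~_ public

_⊕_ _⊗_ : Pair → Pair → Pair
(n , d) ⊕ (m , e) = n ℚ.* e ℚ.+ m ℚ.* d , d ℚ.* e
(n , d) ⊗ (m , e) = n ℚ.* m , d ℚ.* e

⊝_ : Pair → Pair
⊝ (n , d) = ℚ.- n , d

-ᵣ_ : RatFun → RatFun
-ᵣ r = (-ₚ num r) // den r

1ᵣ : RatFun
1ᵣ = (1ℚ ∷ []) // (1ℚ ∷ [])

value-+ : ∀ x r s → value x (r +ᵣ s) ≡ value x r ⊕ value x s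
value-+ x (n // d) (m // e) = cong₂ _,_
  (trans (evalP-+ (n *ₚ e) (m *ₚ d) x) (cong₂ ℚ._+_ (evalP-* n e x) (evalP-* m d x))) (evalP-* d e x)

value-* : ∀ x r s → value x (r *ᵣ s) ≡ value x r ⊗ value x s
value-* x (n // d) (m // e) = cong₂ _,_ (evalP-* n m x) (evalP-* d e x)

value-neg : ∀ x r → value x (-ᵣ r) ≡ ⊝ value x r
value-neg x (n // d) = cong₂ _,_ (evalP-neg n x) refl

const-value : ∀ x c → evalP (c ∷ []) x ≡ c
const-value x c = solve 2 (λ x c → c :+ x :* con 0ℚ := c) refl x c

value-0 : ∀ x → value x 0ᵣ ≡ (0ℚ , 1ℚ)
value-0 x = cong₂ _,_ refl (const-value x 1ℚ)

value-1 : ∀ x → value x 1ᵣ ≡ (1ℚ , 1ℚ)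
value-1 x = cong₂ _,_ (const-value x 1ℚ) (const-value x 1ℚ)

≈ᵣ⇒~ : ∀ {r s} → r ≈ᵣ s → ∀ x → value x r ~ value x s
≈ᵣ⇒~ {n // d} {m // e} eq x = mk~
  (trans (sym (evalP-* n e x)) (trans (≈ₚ⇒evalP≡ (n *ₚ e) (m *ₚ d) eq x) (evalP-* m d x)))

~⇒≈ᵣ : ∀ {r s} → (∀ m → value (fromℕ (suc m)) r ~ value (fromℕ (suc m)) s) → r ≈ᵣ s
~⇒≈ᵣ {n // d} {m // e} eq = evalP≡⇒≈ₚ (n *ₚ e) (m *ₚ d) λ i →
  trans (evalP-* n e _) (trans (cross (eq i)) (sym (evalP-* m d _)))

~-via : ∀ {u u′ v v′} → u ≡ u′ → v ≡ v′ → u′ ~ v′ → u ~ v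
~-via refl refl e = e

⊕-cong : ∀ {u u′ v v′} → u ~ u′ → v ~ v′ → (u ⊕ v) ~ (u′ ⊕ v′)
⊕-cong {n , d} {n′ , d′} {m , e} {m′ , e′} (mk~ p) (mk~ q) = mk~ $
  trans (solve 6 (λ n d m e d′ e′ → (n :* e :+ m :* d) :* (d′ :* e′) := (n :* d′) :* (e :* e′) :+ (m :* e′) :* (d :* d′)) refl n d m e d′ e′)
  (trans (cong₂ (λ a b → a ℚ.* (e ℚ.* e′) ℚ.+ b ℚ.* (d ℚ.* d′)) p q)
    (solve 6 (λ n d m e d′ e′ → (n :* d′) :* (e′ :* e) :+ (m :* e′) :* (d′ :* d) := (n :* e :+ m :* d) :* (d′ :* e′)) refl n′ d′ m′ e′ d e))

⊗-cong : ∀ {u u′ v v′} → u ~ u′ → v ~ v′ → (u ⊗ v) ~ (u′ ⊗ v′)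
⊗-cong {n , d} {n′ , d′} {m , e} {m′ , e′} (mk~ p) (mk~ q) = mk~ $
  trans (solve 4 (λ n m d e → (n :* m) :* (d :* e) := (n :* d) :* (m :* e)) refl n m d′ e′)
  (trans (cong₂ ℚ._*_ p q)
    (solve 4 (λ n m d e → (n :* d) :* (m :* e) := (n :* m) :* (d :* e)) refl n′ m′ d e))

≈ᵣ-refl : ∀ {r} → r ≈ᵣ r
≈ᵣ-refl k = refl

≈ᵣ-sym : ∀ {r s} → r ≈ᵣ s → s ≈ᵣ r
≈ᵣ-sym e k = sym (e k)

-- Multiplied by the middle denominator, the difference of the cross products vanishes at every
-- point. That denominator is a nonzero polynomial, so `zero-product` cancels it.
≈ᵣ-trans : ∀ {r s t} → ValidR s → r ≈ᵣ s → s ≈ᵣ t → r ≈ᵣ t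
≈ᵣ-trans {n // d} {n′ // d′} {n″ // d″} v p q k =
  RingProperties.x∙y⁻¹≈ε⇒x≈y ℚP.+-*-ring _ _
    (trans (trans (cong (pcoeff (n *ₚ d″) k ℚ.+_) (sym (pcoeff-neg (n″ *ₚ d) k))) (sym (pcoeff-+ (n *ₚ d″) (-ₚ (n″ *ₚ d)) k)))
      (zero-product d′ ((n *ₚ d″) +ₚ (-ₚ (n″ *ₚ d))) v (λ m → lem (fromℕ (suc m))) k))
  where
  lem : ∀ x → evalP d′ x ℚ.* evalP ((n *ₚ d″) +ₚ (-ₚ (n″ *ₚ d))) x ≡ 0ℚ
  lem x = trans (cong (evalP d′ x ℚ.*_) (trans (evalP-+ (n *ₚ d″) (-ₚ (n″ *ₚ d)) x)
      (cong₂ ℚ._+_ (evalP-* n d″ x) (trans (evalP-neg (n″ *ₚ d) x) (cong ℚ.-_ (evalP-* n″ d x))))))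
    (trans (solve 5 (λ d′ n d″ n″ d → d′ :* (n :* d″ :- n″ :* d) := (n :* d′) :* d″ :- (n″ :* d′) :* d) refl
              (evalP d′ x) (evalP n x) (evalP d″ x) (evalP n″ x) (evalP d x))
    (trans (cong₂ (λ a b → a ℚ.* evalP d″ x ℚ.- b ℚ.* evalP d x) (cross (≈ᵣ⇒~ {n // d} {n′ // d′} p x)) (sym (cross (≈ᵣ⇒~ {n′ // d′} {n″ // d″} q x))))
      (solve 3 (λ n′ d d″ → (n′ :* d) :* d″ :- (n′ :* d″) :* d := con 0ℚ) refl (evalP n′ x) (evalP d x) (evalP d″ x))))

⊕-assoc : ∀ u v w → (u ⊕ v) ⊕ w ~ u ⊕ (v ⊕ w)
⊕-assoc (a , b) (c , d) (e , f) = mk~ (solve 6 (λ a b c d e f →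
  ((a :* d :+ c :* b) :* f :+ e :* (b :* d)) :* (b :* (d :* f))
    := (a :* (d :* f) :+ (c :* f :+ e :* d) :* b) :* ((b :* d) :* f)) refl a b c d e f)

⊕-comm : ∀ u v → u ⊕ v ~ v ⊕ u
⊕-comm (a , b) (c , d) = mk~ (solve 4 (λ a b c d →
  (a :* d :+ c :* b) :* (d :* b) := (c :* b :+ a :* d) :* (b :* d)) refl a b c d)

⊕-identityˡ : ∀ u → (0ℚ , 1ℚ) ⊕ u ~ u
⊕-identityˡ (n , d) = mk~ (solve 2 (λ n d → (con 0ℚ :* d :+ n :* con 1ℚ) :* d := n :* (con 1ℚ :* d)) refl n d)

⊕-inverseˡ : ∀ u → (⊝ u) ⊕ u ~ (0ℚ , 1ℚ)
⊕-inverseˡ (n , d) = mk~ (solve 2 (λ n d → ((:- n) :* d :+ n :* d) :* con 1ℚ := con 0ℚ :* (d :* d)) refl n d)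

⊝-cong : ∀ {u v} → u ~ v → ⊝ u ~ ⊝ v
⊝-cong {n , d} {m , e} (mk~ p) = mk~ (trans (sym (ℚP.neg-distribˡ-* n e)) (trans (cong ℚ.-_ p) (ℚP.neg-distribˡ-* m d)))

⊗-assoc : ∀ u v w → (u ⊗ v) ⊗ w ~ u ⊗ (v ⊗ w)
⊗-assoc (a , b) (c , d) (e , f) = mk~ (solve 6 (λ a b c d e f →
  ((a :* c) :* e) :* (b :* (d :* f)) := (a :* (c :* e)) :* ((b :* d) :* f)) refl a b c d e f)

⊗-comm : ∀ u v → u ⊗ v ~ v ⊗ u
⊗-comm (a , b) (c , d) = mk~ (solve 4 (λ a b c d →
  (a :* c) :* (d :* b) := (c :* a) :* (b :* d)) refl a b c d)

⊗-identityˡ : ∀ u → (1ℚ , 1ℚ) ⊗ u ~ u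
⊗-identityˡ (n , d) = mk~ (solve 2 (λ n d → (con 1ℚ :* n) :* d := n :* (con 1ℚ :* d)) refl n d)

⊗-distribˡ-⊕ : ∀ u v w → u ⊗ (v ⊕ w) ~ u ⊗ v ⊕ u ⊗ w
⊗-distribˡ-⊕ (a , b) (c , d) (e , f) = mk~ (solve 6 (λ a b c d e f →
  (a :* (c :* f :+ e :* d)) :* ((b :* d) :* (b :* f))
    := ((a :* c) :* (b :* f) :+ (a :* e) :* (b :* d)) :* (b :* (d :* f))) refl a b c d e f)

-- The ring of valid fractions

K : Set
K = Σ RatFun ValidR

-- Transitivity needs the validity of the middle fraction, so validity belongs to the carrier. The
-- relation does not mention the witnesses; the record wrapper lets them be inferred.
record _≈ᴷ_ (r s : K) : Set where
  constructor mk
  field un : proj₁ r ≈ᵣ proj₁ s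
open _≈ᴷ_ public

_+ᴷ_ _*ᴷ_ : K → K → K
(r , v) +ᴷ (s , w) = r +ᵣ s , NonZeroPoly-* (den r) (den s) v w
(r , v) *ᴷ (s , w) = r *ᵣ s , NonZeroPoly-* (den r) (den s) v w

-ᴷ_ : K → K
-ᴷ (r , v) = -ᵣ r , v

0ᴷ 1ᴷ : K
0ᴷ = 0ᵣ , 0 , λ ()
1ᴷ = 1ᵣ , 0 , λ ()

open import Algebra.Definitions _≈ᴷ_

private
  pointwise : ∀ (r s : K) (u v : ℚ → Pair) → (∀ x → value x (proj₁ r) ≡ u x) → (∀ x → value x (proj₁ s) ≡ v x) →
              (∀ x → u x ~ v x) → r ≈ᴷ s
  pointwise (r , _) (s , _) u v p q e = mk (~⇒≈ᵣ {r} {s} λ m → ~-via (p _) (q _) (e (fromℕ (suc m))))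

  agree : ∀ (r s : K) → r ≈ᴷ s → ∀ x → value x (proj₁ r) ~ value x (proj₁ s)
  agree (r , _) (s , _) e x = ≈ᵣ⇒~ {r} {s} (un e) x

≈ᴷ-isEquivalence : IsEquivalence _≈ᴷ_
≈ᴷ-isEquivalence = record
  { refl  = λ {r} → mk (≈ᵣ-refl {proj₁ r})
  ; sym   = λ {r} {s} e → mk (≈ᵣ-sym {proj₁ r} {proj₁ s} (un e))
  ; trans = λ {r} {s} {t} p q → mk (≈ᵣ-trans {proj₁ r} {proj₁ s} {proj₁ t} (proj₂ s) (un p) (un q))
  }

K-setoid : Setoid 0ℓ 0ℓ
K-setoid = record { isEquivalence = ≈ᴷ-isEquivalence }

+ᴷ-cong : Congruent₂ _+ᴷ_
+ᴷ-cong {r} {r′} {s} {s′} p q = pointwise (r +ᴷ s) (r′ +ᴷ s′) _ _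
  (λ x → value-+ x (proj₁ r) (proj₁ s)) (λ x → value-+ x (proj₁ r′) (proj₁ s′))
  (λ x → ⊕-cong (agree r r′ p x) (agree s s′ q x))

*ᴷ-cong : Congruent₂ _*ᴷ_
*ᴷ-cong {r} {r′} {s} {s′} p q = pointwise (r *ᴷ s) (r′ *ᴷ s′) _ _
  (λ x → value-* x (proj₁ r) (proj₁ s)) (λ x → value-* x (proj₁ r′) (proj₁ s′))
  (λ x → ⊗-cong (agree r r′ p x) (agree s s′ q x))

-ᴷ-cong : Congruent₁ -ᴷ_
-ᴷ-cong {r} {s} p = pointwise (-ᴷ r) (-ᴷ s) _ _ (λ x → value-neg x (proj₁ r)) (λ x → value-neg x (proj₁ s))
  (λ x → ⊝-cong (agree r s p x))

+ᴷ-assoc : Associative _+ᴷ_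
+ᴷ-assoc r@(r′ , _) s@(s′ , _) t@(t′ , _) = pointwise ((r +ᴷ s) +ᴷ t) (r +ᴷ (s +ᴷ t)) _ _
  (λ x → trans (value-+ x (r′ +ᵣ s′) t′) (cong (_⊕ value x t′) (value-+ x r′ s′)))
  (λ x → trans (value-+ x r′ (s′ +ᵣ t′)) (cong (value x r′ ⊕_) (value-+ x s′ t′)))
  (λ x → ⊕-assoc (value x r′) (value x s′) (value x t′))

*ᴷ-assoc : Associative _*ᴷ_
*ᴷ-assoc r@(r′ , _) s@(s′ , _) t@(t′ , _) = pointwise ((r *ᴷ s) *ᴷ t) (r *ᴷ (s *ᴷ t)) _ _
  (λ x → trans (value-* x (r′ *ᵣ s′) t′) (cong (_⊗ value x t′) (value-* x r′ s′)))
  (λ x → trans (value-* x r′ (s′ *ᵣ t′)) (cong (value x r′ ⊗_) (value-* x s′ t′)))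
  (λ x → ⊗-assoc (value x r′) (value x s′) (value x t′))

+ᴷ-comm : Commutative _+ᴷ_
+ᴷ-comm r s = pointwise (r +ᴷ s) (s +ᴷ r) _ _ (λ x → value-+ x (proj₁ r) (proj₁ s)) (λ x → value-+ x (proj₁ s) (proj₁ r))
  (λ x → ⊕-comm (value x (proj₁ r)) (value x (proj₁ s)))

*ᴷ-comm : Commutative _*ᴷ_
*ᴷ-comm r s = pointwise (r *ᴷ s) (s *ᴷ r) _ _ (λ x → value-* x (proj₁ r) (proj₁ s)) (λ x → value-* x (proj₁ s) (proj₁ r))
  (λ x → ⊗-comm (value x (proj₁ r)) (value x (proj₁ s)))

+ᴷ-identityˡ : LeftIdentity 0ᴷ _+ᴷ_
+ᴷ-identityˡ r = pointwise (0ᴷ +ᴷ r) r _ _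
  (λ x → trans (value-+ x 0ᵣ (proj₁ r)) (cong (_⊕ value x (proj₁ r)) (value-0 x))) (λ x → refl)
  (λ x → ⊕-identityˡ (value x (proj₁ r)))

*ᴷ-identityˡ : LeftIdentity 1ᴷ _*ᴷ_
*ᴷ-identityˡ r = pointwise (1ᴷ *ᴷ r) r _ _
  (λ x → trans (value-* x 1ᵣ (proj₁ r)) (cong (_⊗ value x (proj₁ r)) (value-1 x))) (λ x → refl)
  (λ x → ⊗-identityˡ (value x (proj₁ r)))

-ᴷ-inverseˡ : LeftInverse 0ᴷ -ᴷ_ _+ᴷ_
-ᴷ-inverseˡ r@(r′ , _) = pointwise ((-ᴷ r) +ᴷ r) 0ᴷ _ _
  (λ x → trans (value-+ x (-ᵣ r′) r′) (cong (_⊕ value x r′) (value-neg x r′))) value-0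
  (λ x → ⊕-inverseˡ (value x r′))

*ᴷ-distribˡ-+ᴷ : _DistributesOverˡ_ _*ᴷ_ _+ᴷ_
*ᴷ-distribˡ-+ᴷ r@(r′ , _) s@(s′ , _) t@(t′ , _) = pointwise (r *ᴷ (s +ᴷ t)) ((r *ᴷ s) +ᴷ (r *ᴷ t)) _ _
  (λ x → trans (value-* x r′ (s′ +ᵣ t′)) (cong (value x r′ ⊗_) (value-+ x s′ t′)))
  (λ x → trans (value-+ x (r′ *ᵣ s′) (r′ *ᵣ t′)) (cong₂ _⊕_ (value-* x r′ s′) (value-* x r′ t′)))
  (λ x → ⊗-distribˡ-⊕ (value x r′) (value x s′) (value x t′))

K-commutativeRing : CommutativeRing 0ℓ 0ℓ
K-commutativeRing = record
  { Carrier = K ; _≈_ = _≈ᴷ_ ; _+_ = _+ᴷ_ ; _*_ = _*ᴷ_ ; -_ = -ᴷ_ ; 0# = 0ᴷ ; 1# = 1ᴷ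
  ; isCommutativeRing = record
    { isRing = record
      { +-isAbelianGroup = record
        { isGroup = record
          { isMonoid = record
            { isSemigroup = record
              { isMagma = record { isEquivalence = ≈ᴷ-isEquivalence ; ∙-cong = λ {r} {r′} {s} {s′} → +ᴷ-cong {r} {r′} {s} {s′} }
              ; assoc = +ᴷ-assoc }
            ; identity = comm∧idˡ⇒id K-setoid {_+ᴷ_} +ᴷ-comm {0ᴷ} +ᴷ-identityˡ }
          ; inverse = comm∧invˡ⇒inv K-setoid {_+ᴷ_} { -ᴷ_} {0ᴷ} +ᴷ-comm -ᴷ-inverseˡ
          ; ⁻¹-cong = λ {r} {s} → -ᴷ-cong {r} {s} }
        ; comm = +ᴷ-comm }
      ; *-cong = λ {r} {r′} {s} {s′} → *ᴷ-cong {r} {r′} {s} {s′}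
      ; *-assoc = *ᴷ-assoc
      ; *-identity = comm∧idˡ⇒id K-setoid {_*ᴷ_} *ᴷ-comm {1ᴷ} *ᴷ-identityˡ
      ; distrib = comm∧distrˡ⇒distr K-setoid {_*ᴷ_} {_+ᴷ_} (λ {r} {r′} {s} {s′} → +ᴷ-cong {r} {r′} {s} {s′}) *ᴷ-comm *ᴷ-distribˡ-+ᴷ }
    ; *-comm = *ᴷ-comm }
  }

-- Specialisation at an integer

Spec : ℕ → K → ℚ → Set
Spec n r v = SpecAt (proj₁ r) n v

Spec-+ : ∀ n {r s v w} → Spec n r v → Spec n s w → Spec n (r +ᴷ s) (v ℚ.+ w)
Spec-+ n {r , _} {s , _} {v} {w} (r′ , r′≈r , dr≢0 , er) (s′ , s′≈s , ds≢0 , es) =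
  r′ +ᵣ s′ ,
  ~⇒≈ᵣ {r′ +ᵣ s′} {r +ᵣ s} (λ m → ~-via (value-+ _ r′ s′) (value-+ _ r s)
    (⊕-cong (≈ᵣ⇒~ {r′} {r} r′≈r _) (≈ᵣ⇒~ {s′} {s} s′≈s _))) ,
  (λ e → *≢0 dr≢0 ds≢0 (trans (sym (evalP-* (den r′) (den s′) x)) e)) ,
  (begin
    evalP (num (r′ +ᵣ s′)) x        ≡⟨ cong proj₁ (value-+ x r′ s′) ⟩
    nr ℚ.* ds ℚ.+ ns ℚ.* dr         ≡⟨ cong₂ (λ a b → a ℚ.* ds ℚ.+ b ℚ.* dr) er es ⟩
    v ℚ.* dr ℚ.* ds ℚ.+ w ℚ.* ds ℚ.* dr ≡⟨ solve 4 (λ v w d e → v :* d :* e :+ w :* e :* d := (v :+ w) :* (d :* e)) refl v w dr ds ⟩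
    (v ℚ.+ w) ℚ.* (dr ℚ.* ds)       ≡⟨ cong ((v ℚ.+ w) ℚ.*_) (evalP-* (den r′) (den s′) x) ⟨
    (v ℚ.+ w) ℚ.* evalP (den (r′ +ᵣ s′)) x ∎)
  where
  open ≡-Reasoning
  x = fromℕ n
  nr = evalP (num r′) x
  dr = evalP (den r′) x
  ns = evalP (num s′) x
  ds = evalP (den s′) x

Spec-* : ∀ n {r s v w} → Spec n r v → Spec n s w → Spec n (r *ᴷ s) (v ℚ.* w)
Spec-* n {r , _} {s , _} {v} {w} (r′ , r′≈r , dr≢0 , er) (s′ , s′≈s , ds≢0 , es) =
  r′ *ᵣ s′ ,
  ~⇒≈ᵣ {r′ *ᵣ s′} {r *ᵣ s} (λ m → ~-via (value-* _ r′ s′) (value-* _ r s)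
    (⊗-cong (≈ᵣ⇒~ {r′} {r} r′≈r _) (≈ᵣ⇒~ {s′} {s} s′≈s _))) ,
  (λ e → *≢0 dr≢0 ds≢0 (trans (sym (evalP-* (den r′) (den s′) x)) e)) ,
  (begin
    evalP (num (r′ *ᵣ s′)) x        ≡⟨ cong proj₁ (value-* x r′ s′) ⟩
    nr ℚ.* ns                       ≡⟨ cong₂ ℚ._*_ er es ⟩
    (v ℚ.* dr) ℚ.* (w ℚ.* ds)       ≡⟨ solve 4 (λ v w d e → (v :* d) :* (w :* e) := (v :* w) :* (d :* e)) refl v w dr ds ⟩
    (v ℚ.* w) ℚ.* (dr ℚ.* ds)       ≡⟨ cong ((v ℚ.* w) ℚ.*_) (evalP-* (den r′) (den s′) x) ⟨
    (v ℚ.* w) ℚ.* evalP (den (r′ *ᵣ s′)) x ∎)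
  where
  open ≡-Reasoning
  x = fromℕ n
  nr = evalP (num r′) x
  dr = evalP (den r′) x
  ns = evalP (num s′) x
  ds = evalP (den s′) x

-- In a representative n′/d′ regular at the point, n′ takes the value v·d′, which is nonzero there.
-- Hence -d′/n′ is a valid fraction and again regular at the point.
Spec-negated-inverse : ∀ n {r v} → Spec n r v → v ≢ 0ℚ →
  ∃ λ y → ∃ λ w → ((r *ᴷ y) +ᴷ 1ᴷ) ≈ᴷ 0ᴷ × v ℚ.* w ℚ.+ 1ℚ ≡ 0ℚ × Spec n y w
Spec-negated-inverse n {r , dr} {v} (r′@(n′ // d′) , r′≈r , d≢0 , e) v≢0 =
  y , w , pointwise (((r , dr) *ᴷ y) +ᴷ 1ᴷ) 0ᴷ _ _
      (λ x → trans (value-+ x (r *ᵣ proj₁ y) 1ᵣ) (cong₂ _⊕_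
        (trans (value-* x r (proj₁ y)) (cong (λ u → value x r ⊗ (u , evalP n′ x)) (evalP-neg d′ x))) (value-1 x)))
      value-0
      (λ x → mk~ (trans (solve 4 (λ n d n′ d′ → ((n :* :- d′) :* con 1ℚ :+ con 1ℚ :* (d :* n′)) :* con 1ℚ
                                 := n′ :* d :- n :* d′) refl (evalP (num r) x) (evalP (den r) x) (evalP n′ x) (evalP d′ x))
        (trans (cong (ℚ._- evalP (num r) x ℚ.* evalP d′ x) (cross (≈ᵣ⇒~ {r′} {r} r′≈r x)))
          (trans (ℚP.+-inverseʳ (evalP (num r) x ℚ.* evalP d′ x)) (sym (ℚP.*-zeroˡ (evalP (den r) x ℚ.* evalP n′ x ℚ.* 1ℚ))))))) ,
  (begin
    v ℚ.* (ℚ.- u) ℚ.+ 1ℚ ≡⟨ solve 2 (λ v u → v :* (:- u) :+ con 1ℚ := con 1ℚ :- v :* u) refl v u ⟩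
    1ℚ ℚ.- v ℚ.* u       ≡⟨ cong (λ z → 1ℚ ℚ.- z) (proj₂ (inverse v≢0)) ⟩
    1ℚ ℚ.- 1ℚ            ≡⟨⟩
    0ℚ ∎) ,
  proj₁ y , ≈ᵣ-refl {proj₁ y} , n′≢0 , (begin
    evalP (-ₚ d′) x        ≡⟨ evalP-neg d′ x ⟩
    ℚ.- evalP d′ x         ≡⟨ solve 1 (λ d → :- d := :- (con 1ℚ :* d)) refl (evalP d′ x) ⟩
    ℚ.- (1ℚ ℚ.* evalP d′ x) ≡⟨ cong (λ z → ℚ.- (z ℚ.* evalP d′ x)) (proj₂ (inverse v≢0)) ⟨
    ℚ.- (v ℚ.* u ℚ.* evalP d′ x) ≡⟨ solve 3 (λ v u d → :- (v :* u :* d) := (:- u) :* (v :* d)) refl v u (evalP d′ x) ⟩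
    (ℚ.- u) ℚ.* (v ℚ.* evalP d′ x) ≡⟨ cong ((ℚ.- u) ℚ.*_) e ⟨
    w ℚ.* evalP n′ x ∎)
  where
  open ≡-Reasoning
  x = fromℕ n
  u = proj₁ (inverse v≢0)
  w = ℚ.- u
  n′≢0 : evalP n′ x ≢ 0ℚ
  n′≢0 z = *≢0 v≢0 d≢0 (trans (sym e) z)
  y : K
  y = (-ₚ d′) // n′ , evalP≢0⇒NonZero n′ x n′≢0

-- The numerator vanishes at every positive integer, even where the denominator of `r` itself
-- vanishes: cross-multiplying with the regular representative leaves only the factor `den r′`,
-- which is nonzero there.
vanishing-specialisations⇒≈0 : ∀ r → (∀ a → Spec (suc a) r 0ℚ) → r ≈ᴷ 0ᴷ
vanishing-specialisations⇒≈0 (r , _) spec = mk (~⇒≈ᵣ {r} {0ᵣ} λ m → ~-via refl (value-0 (fromℕ (suc m))) (mk~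
  (trans (ℚP.*-identityʳ (evalP (num r) _)) (trans (num-vanishes m) (sym (ℚP.*-zeroˡ (evalP (den r) _)))))))
  where
  num-vanishes : ∀ m → evalP (num r) (fromℕ (suc m)) ≡ 0ℚ
  num-vanishes m with spec m
  ... | r′ , r′≈r , d≢0 , e = *≡0⇒ d≢0 (begin
      evalP (den r′) x ℚ.* evalP (num r) x ≡⟨ ℚP.*-comm (evalP (den r′) x) (evalP (num r) x) ⟩
      evalP (num r) x ℚ.* evalP (den r′) x ≡⟨ cross (≈ᵣ⇒~ {r′} {r} r′≈r x) ⟨
      evalP (num r′) x ℚ.* evalP (den r) x ≡⟨ cong (ℚ._* evalP (den r) x) (trans e (ℚP.*-zeroˡ (evalP (den r′) x))) ⟩
      0ℚ ℚ.* evalP (den r) x               ≡⟨ ℚP.*-zeroˡ (evalP (den r) x) ⟩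
      0ℚ ∎)
    where
    open ≡-Reasoning
    x = fromℕ (suc m)

-- Monomials and partitions

infix 4 _≃_
-- Equality up to trailing zeros, expressed by multiplicities and not by `strip`, because `incr` and
-- `decr` are easily described by their effect on multiplicities.
record _≃_ (μ ν : Mono) : Set where
  constructor mk≃
  field mult-≡ : ∀ n → mult (suc n) μ ≡ mult (suc n) ν
open _≃_ public

≃-refl : ∀ {μ} → μ ≃ μ
≃-refl = mk≃ λ n → refl

≃-sym : ∀ {μ ν} → μ ≃ ν → ν ≃ μ
≃-sym (mk≃ e) = mk≃ λ n → sym (e n)

≃-trans : ∀ {μ ν ρ} → μ ≃ ν → ν ≃ ρ → μ ≃ ρ
≃-trans (mk≃ e) (mk≃ f) = mk≃ λ n → trans (e n) (f n)

mult-incr-same : ∀ n μ → mult (suc n) (incr (suc n) μ) ≡ suc (mult (suc n) μ)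
mult-incr-same zero    []      = refl
mult-incr-same zero    (x ∷ μ) = refl
mult-incr-same (suc n) []      = mult-incr-same n []
mult-incr-same (suc n) (x ∷ μ) = mult-incr-same n μ

mult-incr-other : ∀ m n μ → m ≢ n → mult (suc m) (incr (suc n) μ) ≡ mult (suc m) μ
mult-incr-other zero    zero    μ       ne = ⊥-elim (ne refl)
mult-incr-other zero    (suc n) []      ne = refl
mult-incr-other zero    (suc n) (x ∷ μ) ne = refl
mult-incr-other (suc m) zero    []      ne = refl
mult-incr-other (suc m) zero    (x ∷ μ) ne = refl
mult-incr-other (suc m) (suc n) []      ne = mult-incr-other m n [] (ne ∘ cong suc)
mult-incr-other (suc m) (suc n) (x ∷ μ) ne = mult-incr-other m n μ (ne ∘ cong suc)

mult-decr-same : ∀ n μ → mult (suc n) (decr (suc n) μ) ≡ mult (suc n) μ ∸ 1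
mult-decr-same zero    []      = refl
mult-decr-same zero    (x ∷ μ) = refl
mult-decr-same (suc n) []      = refl
mult-decr-same (suc n) (x ∷ μ) = mult-decr-same n μ

mult-decr-other : ∀ m n μ → m ≢ n → mult (suc m) (decr (suc n) μ) ≡ mult (suc m) μ
mult-decr-other zero    zero    μ       ne = ⊥-elim (ne refl)
mult-decr-other zero    (suc n) []      ne = refl
mult-decr-other zero    (suc n) (x ∷ μ) ne = refl
mult-decr-other (suc m) zero    []      ne = refl
mult-decr-other (suc m) zero    (x ∷ μ) ne = refl
mult-decr-other (suc m) (suc n) []      ne = refl
mult-decr-other (suc m) (suc n) (x ∷ μ) ne = mult-decr-other m n μ (ne ∘ cong suc)

incr-cong : ∀ n {μ ν} → μ ≃ ν → incr (suc n) μ ≃ incr (suc n) ν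
incr-cong n {μ} {ν} (mk≃ e) = mk≃ lem
  where
  lem : ∀ m → mult (suc m) (incr (suc n) μ) ≡ mult (suc m) (incr (suc n) ν)
  lem m with m ℕ.≟ n
  ... | yes refl = trans (mult-incr-same n μ) (trans (cong suc (e n)) (sym (mult-incr-same n ν)))
  ... | no ne    = trans (mult-incr-other m n μ ne) (trans (e m) (sym (mult-incr-other m n ν ne)))

decr-cong : ∀ n {μ ν} → μ ≃ ν → decr (suc n) μ ≃ decr (suc n) ν
decr-cong n {μ} {ν} (mk≃ e) = mk≃ lem
  where
  lem : ∀ m → mult (suc m) (decr (suc n) μ) ≡ mult (suc m) (decr (suc n) ν)
  lem m with m ℕ.≟ n
  ... | yes refl = trans (mult-decr-same n μ) (trans (cong (_∸ 1) (e n)) (sym (mult-decr-same n ν)))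
  ... | no ne    = trans (mult-decr-other m n μ ne) (trans (e m) (sym (mult-decr-other m n ν ne)))

incr-comm : ∀ m n μ → incr (suc m) (incr (suc n) μ) ≃ incr (suc n) (incr (suc m) μ)
incr-comm m n μ = mk≃ lem
  where
  lem : ∀ k → mult (suc k) (incr (suc m) (incr (suc n) μ)) ≡ mult (suc k) (incr (suc n) (incr (suc m) μ))
  lem k with k ℕ.≟ m | k ℕ.≟ n
  ... | yes refl | yes refl = refl
  ... | yes refl | no k≢n   = trans (mult-incr-same k (incr (suc n) μ)) (trans (cong suc (mult-incr-other k n μ k≢n))
                                (sym (trans (mult-incr-other k n (incr (suc k) μ) k≢n) (mult-incr-same k μ))))
  ... | no k≢m   | yes refl = trans (mult-incr-other k m (incr (suc k) μ) k≢m) (trans (mult-incr-same k μ)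
                                (sym (trans (mult-incr-same k (incr (suc m) μ)) (cong suc (mult-incr-other k m μ k≢m)))))
  ... | no k≢m   | no k≢n   = trans (mult-incr-other k m (incr (suc n) μ) k≢m) (trans (mult-incr-other k n μ k≢n)
                                (sym (trans (mult-incr-other k n (incr (suc m) μ) k≢n) (mult-incr-other k m μ k≢m))))

decr-comm : ∀ m n μ → decr (suc m) (decr (suc n) μ) ≃ decr (suc n) (decr (suc m) μ)
decr-comm m n μ = mk≃ lem
  where
  lem : ∀ k → mult (suc k) (decr (suc m) (decr (suc n) μ)) ≡ mult (suc k) (decr (suc n) (decr (suc m) μ))
  lem k with k ℕ.≟ m | k ℕ.≟ n
  ... | yes refl | yes refl = refl
  ... | yes refl | no k≢n   = trans (mult-decr-same k (decr (suc n) μ)) (trans (cong (_∸ 1) (mult-decr-other k n μ k≢n))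
                                (sym (trans (mult-decr-other k n (decr (suc k) μ) k≢n) (mult-decr-same k μ))))
  ... | no k≢m   | yes refl = trans (mult-decr-other k m (decr (suc k) μ) k≢m) (trans (mult-decr-same k μ)
                                (sym (trans (mult-decr-same k (decr (suc m) μ)) (cong (_∸ 1) (mult-decr-other k m μ k≢m)))))
  ... | no k≢m   | no k≢n   = trans (mult-decr-other k m (decr (suc n) μ) k≢m) (trans (mult-decr-other k n μ k≢n)
                                (sym (trans (mult-decr-other k n (decr (suc m) μ) k≢n) (mult-decr-other k m μ k≢m))))

decr-incr-same : ∀ n μ → decr (suc n) (incr (suc n) μ) ≃ μ
decr-incr-same n μ = mk≃ lem
  where
  lem : ∀ k → mult (suc k) (decr (suc n) (incr (suc n) μ)) ≡ mult (suc k) μ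
  lem k with k ℕ.≟ n
  ... | yes refl = trans (mult-decr-same k (incr (suc k) μ)) (cong (_∸ 1) (mult-incr-same k μ))
  ... | no ne    = trans (mult-decr-other k n (incr (suc n) μ) ne) (mult-incr-other k n μ ne)

incr-decr-same : ∀ n μ → mult (suc n) μ ≢ 0 → incr (suc n) (decr (suc n) μ) ≃ μ
incr-decr-same n μ nz = mk≃ lem
  where
  suc-pred : ∀ {x} → x ≢ 0 → suc (x ∸ 1) ≡ x
  suc-pred {zero}  ne = ⊥-elim (ne refl)
  suc-pred {suc x} ne = refl
  lem : ∀ k → mult (suc k) (incr (suc n) (decr (suc n) μ)) ≡ mult (suc k) μ
  lem k with k ℕ.≟ n
  ... | yes refl = trans (mult-incr-same k (decr (suc k) μ)) (trans (cong suc (mult-decr-same k μ)) (suc-pred nz))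
  ... | no ne    = trans (mult-incr-other k n (decr (suc n) μ) ne) (mult-decr-other k n μ ne)

decr-incr-other : ∀ m n μ → m ≢ n → decr (suc m) (incr (suc n) μ) ≃ incr (suc n) (decr (suc m) μ)
decr-incr-other m n μ m≢n = mk≃ lem
  where
  lem : ∀ k → mult (suc k) (decr (suc m) (incr (suc n) μ)) ≡ mult (suc k) (incr (suc n) (decr (suc m) μ))
  lem k with k ℕ.≟ m | k ℕ.≟ n
  ... | yes refl | yes refl = ⊥-elim (m≢n refl)
  ... | yes refl | no k≢n   = trans (mult-decr-same k (incr (suc n) μ)) (trans (cong (_∸ 1) (mult-incr-other k n μ k≢n))
                                (sym (trans (mult-incr-other k n (decr (suc k) μ) k≢n) (mult-decr-same k μ))))
  ... | no k≢m   | yes refl = trans (mult-decr-other k m (incr (suc k) μ) k≢m) (trans (mult-incr-same k μ)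
                                (sym (trans (mult-incr-same k (decr (suc m) μ)) (cong suc (mult-decr-other k m μ k≢m)))))
  ... | no k≢m   | no k≢n   = trans (mult-decr-other k m (incr (suc n) μ) k≢m) (trans (mult-incr-other k n μ k≢n)
                                (sym (trans (mult-incr-other k n (decr (suc m) μ) k≢n) (mult-decr-other k m μ k≢m))))

weightFrom-zero : ∀ i μ → (∀ n → mult (suc n) μ ≡ 0) → weightFrom i μ ≡ 0
weightFrom-zero i []      z = refl
weightFrom-zero i (x ∷ μ) z rewrite z 0 | ℕP.*-zeroʳ i = weightFrom-zero (suc i) μ (λ n → z (suc n))

weightFrom-cong : ∀ i μ ν → (∀ n → mult (suc n) μ ≡ mult (suc n) ν) → weightFrom i μ ≡ weightFrom i ν
weightFrom-cong i []      ν       e = sym (weightFrom-zero i ν (λ n → sym (e n)))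
weightFrom-cong i (x ∷ μ) []      e = weightFrom-zero i (x ∷ μ) e
weightFrom-cong i (x ∷ μ) (y ∷ ν) e = cong₂ (λ a b → i ℕ.* a ℕ.+ b) (e 0) (weightFrom-cong (suc i) μ ν (λ n → e (suc n)))

weight-cong : ∀ {μ ν} → μ ≃ ν → weight μ ≡ weight ν
weight-cong {μ} {ν} (mk≃ e) = weightFrom-cong 1 μ ν e

weightFrom-incr : ∀ i n μ → weightFrom i (incr (suc n) μ) ≡ i ℕ.+ n ℕ.+ weightFrom i μ
weightFrom-incr i zero    []      = lem i
  where
  lem : ∀ i → i ℕ.* 1 ℕ.+ 0 ≡ i ℕ.+ 0 ℕ.+ 0
  lem = ℕRing.solve-∀
weightFrom-incr i zero    (x ∷ μ) = lem i x _
  where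
  lem : ∀ i x w → i ℕ.* suc x ℕ.+ w ≡ i ℕ.+ 0 ℕ.+ (i ℕ.* x ℕ.+ w)
  lem = ℕRing.solve-∀
weightFrom-incr i (suc n) []      = trans (cong (i ℕ.* 0 ℕ.+_) (weightFrom-incr (suc i) n [])) (lem i n)
  where
  lem : ∀ i n → i ℕ.* 0 ℕ.+ (suc i ℕ.+ n ℕ.+ 0) ≡ i ℕ.+ suc n ℕ.+ 0
  lem = ℕRing.solve-∀
weightFrom-incr i (suc n) (x ∷ μ) = trans (cong (i ℕ.* x ℕ.+_) (weightFrom-incr (suc i) n μ)) (lem i x n _)
  where
  lem : ∀ i x n w → i ℕ.* x ℕ.+ (suc i ℕ.+ n ℕ.+ w) ≡ i ℕ.+ suc n ℕ.+ (i ℕ.* x ℕ.+ w)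
  lem = ℕRing.solve-∀

weight-incr : ∀ n μ → weight (incr (suc n) μ) ≡ suc n ℕ.+ weight μ
weight-incr n μ = weightFrom-incr 1 n μ

weight-decr : ∀ n μ → mult (suc n) μ ≢ 0 → suc n ℕ.+ weight (decr (suc n) μ) ≡ weight μ
weight-decr n μ nz = trans (sym (weight-incr n (decr (suc n) μ))) (weight-cong (incr-decr-same n μ nz))

mult-strip : ∀ n μ → mult (suc n) (strip μ) ≡ mult (suc n) μ
mult-strip n [] = refl
mult-strip n (x ∷ μ) with strip μ in eq
mult-strip zero    (zero ∷ μ)  | []     = refl
mult-strip zero    (suc x ∷ μ) | []     = refl
mult-strip (suc n) (zero ∷ μ)  | []     = trans (cong (mult (suc n)) (sym eq)) (mult-strip n μ)
mult-strip (suc n) (suc x ∷ μ) | []     = trans (cong (mult (suc n)) (sym eq)) (mult-strip n μ)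
mult-strip zero    (x ∷ μ)     | y ∷ ys = refl
mult-strip (suc n) (x ∷ μ)     | y ∷ ys = trans (cong (mult (suc n)) (sym eq)) (mult-strip n μ)

strip-zero : ∀ μ → (∀ n → mult (suc n) μ ≡ 0) → strip μ ≡ []
strip-zero []      z = refl
strip-zero (x ∷ μ) z rewrite z 0 | strip-zero μ (λ n → z (suc n)) = refl

strip-∷ : ∀ x μ ν → strip μ ≡ strip ν → strip (x ∷ μ) ≡ strip (x ∷ ν)
strip-∷ x μ ν e with strip μ | strip ν
strip-∷ x μ ν refl | []     | .[]       = refl
strip-∷ x μ ν refl | y ∷ ys | .(y ∷ ys) = refl

strip≡⇒≃ : ∀ {μ ν} → strip μ ≡ strip ν → μ ≃ ν
strip≡⇒≃ {μ} {ν} e = mk≃ λ n → trans (sym (mult-strip n μ)) (trans (cong (mult (suc n)) e) (mult-strip n ν))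

≃⇒strip≡ : ∀ {μ ν} → μ ≃ ν → strip μ ≡ strip ν
≃⇒strip≡ {μ} {ν} (mk≃ e) = go μ ν e
  where
  go : ∀ μ ν → (∀ n → mult (suc n) μ ≡ mult (suc n) ν) → strip μ ≡ strip ν
  go []      ν       e = sym (strip-zero ν (λ n → sym (e n)))
  go (x ∷ μ) []      e = strip-zero (x ∷ μ) e
  go (x ∷ μ) (y ∷ ν) e rewrite e 0 = strip-∷ y μ ν (go μ ν (λ n → e (suc n)))

data SplitMono (μ : Mono) : Set where
  no-parts : μ ≃ [] → SplitMono μ
  has-part : ∀ n → mult (suc n) μ ≢ 0 → SplitMono μ

split-mono : ∀ μ → SplitMono μ
split-mono [] = no-parts ≃-refl
split-mono (suc x ∷ μ) = has-part 0 λ ()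
split-mono (zero ∷ μ) with split-mono μ
... | no-parts (mk≃ e) = no-parts (mk≃ λ { zero → refl ; (suc n) → e n })
... | has-part n nz = has-part (suc n) nz

-- Removing a part lowers the weight, which serves as fuel. The predicate must respect `≃`, as a
-- list with trailing zeros is reached from [] by `incr` only up to `≃`.
mono-induction : (Q : Mono → Set) → (∀ {μ ν} → μ ≃ ν → Q μ → Q ν) → Q [] →
                 (∀ n μ → Q μ → Q (incr (suc n) μ)) → ∀ μ → Q μ
mono-induction Q resp base step μ = go (weight μ) μ ℕP.≤-refl
  where
  go : ∀ w μ → weight μ ℕ.≤ w → Q μ
  go w μ le with split-mono μ
  ... | no-parts e = resp (≃-sym e) base
  go zero μ le | has-part n nz with trans (weight-decr n μ nz) (ℕP.n≤0⇒n≡0 le)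
  ... | ()
  go (suc w) μ le | has-part n nz = resp (incr-decr-same n μ nz) (step n (decr (suc n) μ)
    (go w (decr (suc n) μ) (ℕP.≤-pred (ℕP.≤-trans (ℕP.≤-trans (ℕ.s≤s (ℕP.m≤n+m (weight (decr (suc n) μ)) n)) (ℕP.≤-reflexive (weight-decr n μ nz))) le))))

-- Partitions as monomials

toMono : List ℕ → Mono
toMono = foldr incr []

Positive : List ℕ → Set
Positive = All (1 ℕ.≤_)

partition-split : ∀ x y ks → IsPartition (x ∷ y ∷ ks) → y ℕ.≤ x × IsPartition (y ∷ ks)
partition-split x y ks p with Equivalence.to (T-∧ {isYes (y ℕ.≤? x)} {decrPos (y ∷ ks)}) p
... | y≤x , q = toWitness y≤x , q

partition-positive′ : ∀ x ks → IsPartition (x ∷ ks) → Positive (x ∷ ks)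
partition-positive′ x []       p = toWitness p ∷ []
partition-positive′ x (y ∷ ks) p with partition-split x y ks p
... | y≤x , q with partition-positive′ y ks q
...   | 1≤y ∷ rest = ℕP.≤-trans 1≤y y≤x ∷ 1≤y ∷ rest

partition-positive : ∀ ks → IsPartition ks → Positive ks
partition-positive []       p = []
partition-positive (x ∷ ks) p = partition-positive′ x ks p

partition-tail : ∀ x ks → IsPartition (x ∷ ks) → IsPartition ks
partition-tail x []       p = tt
partition-tail x (y ∷ ks) p = proj₂ (partition-split x y ks p)

partition-head-max : ∀ x ks → IsPartition (x ∷ ks) → All (ℕ._≤ x) ks
partition-head-max x []       p = []
partition-head-max x (y ∷ ks) p =
  y≤x ∷ All.map (λ le → ℕP.≤-trans le y≤x) (partition-head-max y ks (proj₂ (partition-split x y ks p)))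
  where y≤x = proj₁ (partition-split x y ks p)

sorted⇒partition : ∀ {ks} → Positive ks → Linked ℕ._≥_ ks → IsPartition ks
sorted⇒partition []        []           = tt
sorted⇒partition (p ∷ [])  [-]          = fromWitness p
sorted⇒partition (p ∷ ps)  (y≤x ∷ rest) = Equivalence.from T-∧ (fromWitness y≤x , sorted⇒partition ps rest)

-- The flipped order makes `sort` produce weakly decreasing lists.
open Sort (Flip.decTotalOrder ℕP.≤-decTotalOrder) using (sort; sort-↭; sort-↗)

rearrange : ∀ ks → Positive ks → Σ Partition λ λ′ → proj₁ λ′ ↭ ks
rearrange ks pos = (sort ks , sorted⇒partition (PermP.All-resp-↭ (Perm.↭-sym (sort-↭ ks)) pos) (sort-↗ ks)) , sort-↭ ks

incr-cong′ : ∀ n {μ ν} → μ ≃ ν → incr n μ ≃ incr n ν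
incr-cong′ zero    e = e
incr-cong′ (suc n) e = incr-cong n e

incr-comm′ : ∀ m n μ → incr m (incr n μ) ≃ incr n (incr m μ)
incr-comm′ zero    n       μ = ≃-refl
incr-comm′ (suc m) zero    μ = ≃-refl
incr-comm′ (suc m) (suc n) μ = incr-comm m n μ

toMono-↭ : ∀ {ks ks′} → ks ↭ ks′ → toMono ks ≃ toMono ks′
toMono-↭ Perm.refl         = ≃-refl
toMono-↭ (Perm.prep k p)   = incr-cong′ k (toMono-↭ p)
toMono-↭ (Perm.swap x y p) = ≃-trans (incr-comm′ x y _) (incr-cong′ y (incr-cong′ x (toMono-↭ p)))
toMono-↭ (Perm.trans p q)  = ≃-trans (toMono-↭ p) (toMono-↭ q)

weight-toMono : ∀ ks → weight (toMono ks) ≡ sum ks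
weight-toMono []           = refl
weight-toMono (zero ∷ ks)  = weight-toMono ks
weight-toMono (suc k ∷ ks) = trans (weight-incr k (toMono ks)) (cong (suc k ℕ.+_) (weight-toMono ks))

toMono-surjective : ∀ μ → Σ Partition λ λ′ → toMono (proj₁ λ′) ≃ μ
toMono-surjective μ with mono-induction (λ μ → ∃ λ ks → Positive ks × toMono ks ≃ μ)
  (λ { e (ks , p , e′) → ks , p , ≃-trans e′ e })
  ([] , [] , ≃-refl)
  (λ { n μ (ks , p , e) → suc n ∷ ks , s≤s z≤n ∷ p , incr-cong n e }) μ
... | ks , pos , e with rearrange ks pos
...   | λ′ , p = λ′ , ≃-trans (toMono-↭ p) e

part-of-toMono : ∀ n ks → Positive ks → mult (suc n) (toMono ks) ≢ 0 → suc n ∈ ks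
part-of-toMono n []           []        nz = ⊥-elim (nz refl)
part-of-toMono n (suc k ∷ ks) (_ ∷ pos) nz with n ℕ.≟ k
... | yes refl = here refl
... | no n≢k   = there (part-of-toMono n ks pos (λ z → nz (trans (mult-incr-other n k (toMono ks) n≢k) z)))

private
  head-nonZero : ∀ k ks → mult (suc k) (toMono (suc k ∷ ks)) ≢ 0
  head-nonZero k ks z with trans (sym (mult-incr-same k (toMono ks))) z
  ... | ()

  head-≤ : ∀ x y xs ys → IsPartition (suc x ∷ xs) → IsPartition (suc y ∷ ys) →
           toMono (suc x ∷ xs) ≃ toMono (suc y ∷ ys) → suc x ℕ.≤ suc y
  head-≤ x y xs ys p q e with part-of-toMono x (suc y ∷ ys) (partition-positive (suc y ∷ ys) q)
                                (λ z → head-nonZero x xs (trans (mult-≡ e x) z))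
  ... | here refl = ℕP.≤-refl
  ... | there i   = All.lookup (partition-head-max (suc y) ys q) i

-- The head is the largest part, so it can be read off the multiplicities; `decr` then removes it
-- from both monomials.
toMono-injective : ∀ ks ks′ → IsPartition ks → IsPartition ks′ → toMono ks ≃ toMono ks′ → ks ≡ ks′
toMono-injective []       []       p q e = refl
toMono-injective []           (suc y ∷ ys) p q e = ⊥-elim (head-nonZero y ys (sym (mult-≡ e y)))
toMono-injective (suc x ∷ xs) []           p q e = ⊥-elim (head-nonZero x xs (mult-≡ e x))
toMono-injective ks           (zero ∷ ys)  p q e with partition-positive (zero ∷ ys) q
... | () ∷ _
toMono-injective (zero ∷ xs)  ks           p q e with partition-positive (zero ∷ xs) p
... | () ∷ _
toMono-injective (suc x ∷ xs) (suc y ∷ ys) p q e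
  with ℕP.≤-antisym (head-≤ x y xs ys p q e) (head-≤ y x ys xs q p (≃-sym e))
... | refl = cong (suc x ∷_) (toMono-injective xs ys (partition-tail (suc x) xs p) (partition-tail (suc x) ys q)
        (≃-trans (≃-sym (decr-incr-same x (toMono xs))) (≃-trans (decr-cong x e) (decr-incr-same x (toMono ys)))))

partition-≡ : ∀ {λ₁ λ₂ : Partition} → proj₁ λ₁ ≡ proj₁ λ₂ → λ₁ ≡ λ₂
partition-≡ {ks , p} {.ks , q} refl = cong (ks ,_) (T-irrelevant p q)

_≟ᵖ_ : (λ₁ λ₂ : Partition) → Dec (λ₁ ≡ λ₂)
λ₁ ≟ᵖ λ₂ = map′ partition-≡ (cong proj₁) (LP.≡-dec ℕ._≟_ (proj₁ λ₁) (proj₁ λ₂))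

-- Partitions of bounded size

words : ℕ → ℕ → List (List ℕ)
words N zero    = [] ∷ []
words N (suc m) = [] ∷ concatMap (λ k → map (k ∷_) (words N m)) (upTo (suc N))

∈-words : ∀ N m ks → length ks ℕ.≤ m → All (ℕ._≤ N) ks → ks ∈ words N m
∈-words N zero    []       le       []       = here refl
∈-words N (suc m) []       le       []       = here refl
∈-words N (suc m) (k ∷ ks) (s≤s le) (b ∷ bs) = there (∈-concatMap⁺ (λ k → map (k ∷_) (words N m))
  (Any.map (λ { refl → ∈-map⁺ (k ∷_) (∈-words N m ks le bs) }) (∈-upTo⁺ (s≤s b))))

asPartition : ℕ → List ℕ → List Partition
asPartition N ks with T? (decrPos ks) | sum ks ℕ.≤? N
... | yes p | yes _ = (ks , p) ∷ []
... | _     | _     = []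

-- Brute force is enough, as only membership and distinctness are used. Words of length at most `N`
-- suffice because parts are positive, and `deduplicate` yields distinctness without a study of
-- `words`.
partitionsUpTo : ℕ → List Partition
partitionsUpTo N = deduplicate _≟ᵖ_ (concatMap (asPartition N) (words N N))

partitionsUpTo-unique : ∀ N → Unique (partitionsUpTo N)
partitionsUpTo-unique N = UniqueDec.deduplicate-! _≟ᵖ_ (concatMap (asPartition N) (words N N))

∈-asPartition : ∀ N (λ′ : Partition) → sum (proj₁ λ′) ℕ.≤ N → λ′ ∈ asPartition N (proj₁ λ′)
∈-asPartition N (ks , p) le with T? (decrPos ks) | sum ks ℕ.≤? N
... | yes q | yes _ = here (partition-≡ refl)
... | no ¬p | _     = ⊥-elim (¬p p)
... | yes q | no gt = ⊥-elim (gt le)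

asPartition-sum : ∀ N ks {λ′} → λ′ ∈ asPartition N ks → sum (proj₁ λ′) ℕ.≤ N
asPartition-sum N ks i with T? (decrPos ks) | sum ks ℕ.≤? N
asPartition-sum N ks (here refl) | yes p | yes le = le

length≤sum : ∀ {ks} → Positive ks → length ks ℕ.≤ sum ks
length≤sum []       = z≤n
length≤sum (p ∷ ps) = ℕP.+-mono-≤ p (length≤sum ps)

parts≤sum : ∀ ks → All (ℕ._≤ sum ks) ks
parts≤sum []       = []
parts≤sum (k ∷ ks) = ℕP.m≤m+n k (sum ks) ∷ All.map (λ le → ℕP.≤-trans le (ℕP.m≤n+m (sum ks) k)) (parts≤sum ks)

∈-partitionsUpTo : ∀ N (λ′ : Partition) → sum (proj₁ λ′) ℕ.≤ N → λ′ ∈ partitionsUpTo N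
∈-partitionsUpTo N λ′@(ks , p) le = ∈-deduplicate⁺ _≟ᵖ_ (∈-concatMap⁺ (asPartition N)
  (Any.map (λ { refl → ∈-asPartition N λ′ le })
    (∈-words N N ks (ℕP.≤-trans (length≤sum (partition-positive ks p)) le) (All.map (λ b → ℕP.≤-trans b le) (parts≤sum ks)))))

partitionsUpTo-sum : ∀ N {λ′} → λ′ ∈ partitionsUpTo N → sum (proj₁ λ′) ℕ.≤ N
partitionsUpTo-sum N i with Any.satisfied (∈-concatMap⁻ (asPartition N) {xs = words N N} (∈-deduplicate⁻ _≟ᵖ_ (concatMap (asPartition N) (words N N)) i))
... | ks , j = asPartition-sum N ks j

open ListSum ℚP.+-*-commutativeRing

module VertexOperators where
  open ≡-Reasoning

  -- Functionals on the Fock space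

  -- applyMono, expCoeff and Xneg work through functions local to their where blocks. The metavariables below are
  -- solved by these functions once the literal arguments are abstracted away.
  mutual
    applyFrom : (ℕ → FVec → FVec) → ℕ → Mono → FVec → FVec
    applyFrom = _

    applyMono-0∷ : ∀ op js v → applyMono op (0 ∷ js) v ≡ applyFrom op 2 js v
    applyMono-0∷ op js v with 2
    ... | i = refl

  mutual
    expWeight : (ℕ → ℚ) → (ℕ → FVec → FVec) → ℕ → FVec → ℕ → Mono → ℚ
    expWeight = _

    expCoeff-singleton : ∀ c op b v js q ν → partitionsOf b ≡ js ∷ [] → applyMono op js v ≡ (q , ν) ∷ [] →
      expCoeff c op b v ≡ (expWeight c op b v 1 js ℚ.* q , ν) ∷ []
    expCoeff-singleton c op b v js q ν e₁ e₂ rewrite e₁ | e₂ with 1 | ℚ._*_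
    ... | i | m = refl

  -- Operators on the Fock space are studied through their transposes, which act on functionals; this reverses the
  -- order of composition.
  Functional : Set
  Functional = Mono → ℚ

  infix 4 _≗_
  _≗_ : Functional → Functional → Set
  φ ≗ ψ = ∀ μ → φ μ ≡ ψ μ

  Resp : Functional → Set
  Resp φ = ∀ {μ ν} → μ ≃ ν → φ μ ≡ φ ν

  ⟪_,_⟫ : Functional → FVec → ℚ
  ⟪ φ , v ⟫ = ∑ v (λ { (c , μ) → c ℚ.* φ μ })

  pairing-cong : ∀ {φ ψ} v → φ ≗ ψ → ⟪ φ , v ⟫ ≡ ⟪ ψ , v ⟫
  pairing-cong v e = ∑-cong v (λ { (c , μ) → cong (c ℚ.*_) (e μ) })

  pairing-sum : ∀ {A : Set} (xs : List A) (q : A → ℚ) (f : A → Functional) v →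
                ⟪ (λ μ → ∑ xs (λ x → q x ℚ.* f x μ)) , v ⟫ ≡ ∑ xs (λ x → q x ℚ.* ⟪ f x , v ⟫)
  pairing-sum xs q f v = begin
    ∑ v (λ { (c , μ) → c ℚ.* ∑ xs (λ x → q x ℚ.* f x μ) })
      ≡⟨ ∑-cong v (λ { (c , μ) → sym (∑-* xs c _) }) ⟩
    ∑ v (λ { (c , μ) → ∑ xs (λ x → c ℚ.* (q x ℚ.* f x μ)) })
      ≡⟨ ∑-cong v (λ { (c , μ) → ∑-cong xs (λ x → solve 3 (λ c q f → c :* (q :* f) := q :* (c :* f)) refl c (q x) (f x μ)) }) ⟩
    ∑ v (λ { (c , μ) → ∑ xs (λ x → q x ℚ.* (c ℚ.* f x μ)) })
      ≡⟨ ∑-swap v xs _ ⟩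
    ∑ xs (λ x → ∑ v (λ { (c , μ) → q x ℚ.* (c ℚ.* f x μ) }))
      ≡⟨ ∑-cong xs (λ x → ∑-* v (q x) _) ⟩
    ∑ xs (λ x → q x ℚ.* ⟪ f x , v ⟫) ∎

  pairing-scaleV : ∀ φ q v → ⟪ φ , scaleV q v ⟫ ≡ q ℚ.* ⟪ φ , v ⟫
  pairing-scaleV φ q v = trans (∑-map _ v _)
    (trans (∑-cong v (λ { (c , μ) → ℚP.*-assoc q c (φ μ) })) (∑-* v q _))

  -- Functionals are compared pointwise, so compatibility with `≗` has to be recorded alongside
  -- linearity.
  record Linear (T : Functional → Functional) : Set₁ where
    field
      lin-cong : ∀ {φ ψ} → φ ≗ ψ → T φ ≗ T ψ
      lin-sum  : ∀ {A : Set} (xs : List A) (q : A → ℚ) (f : A → Functional) →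
                 T (λ ν → ∑ xs (λ x → q x ℚ.* f x ν)) ≗ λ μ → ∑ xs (λ x → q x ℚ.* T (f x) μ)

    lin-scale : ∀ q φ → T (λ ν → q ℚ.* φ ν) ≗ λ μ → q ℚ.* T φ μ
    lin-scale q φ μ = begin
      T (λ ν → q ℚ.* φ ν) μ          ≡⟨ lin-cong (λ ν → sym (ℚP.+-identityʳ _)) μ ⟩
      T (λ ν → q ℚ.* φ ν ℚ.+ 0ℚ) μ   ≡⟨ lin-sum (tt ∷ []) (λ _ → q) (λ _ → φ) μ ⟩
      q ℚ.* T φ μ ℚ.+ 0ℚ             ≡⟨ ℚP.+-identityʳ _ ⟩
      q ℚ.* T φ μ ∎

    lin-zero : ∀ {φ} → φ ≗ (λ _ → 0ℚ) → T φ ≗ λ _ → 0ℚ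
    lin-zero e μ = trans (lin-cong e μ) (lin-sum {⊤} [] (λ _ → 0ℚ) (λ _ _ → 0ℚ) μ)

  open Linear public

  -- The shape φ + qψ + χ is that of the expansion of (1 - w/z)², in which all exchange relations
  -- below are written.
  linear-combination : (L : Functional → ℚ) → (∀ {φ ψ} → φ ≗ ψ → L φ ≡ L ψ) →
    (∀ (xs : List (ℚ × Functional)) → L (λ μ → ∑ xs (λ t → proj₁ t ℚ.* proj₂ t μ)) ≡ ∑ xs (λ t → proj₁ t ℚ.* L (proj₂ t))) →
    ∀ φ ψ χ q → L (λ μ → φ μ ℚ.+ q ℚ.* ψ μ ℚ.+ χ μ) ≡ L φ ℚ.+ q ℚ.* L ψ ℚ.+ L χ
  linear-combination L L-cong L-sum φ ψ χ q = begin
    L (λ μ → φ μ ℚ.+ q ℚ.* ψ μ ℚ.+ χ μ)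
      ≡⟨ L-cong (λ ν → as-sum (φ ν) (ψ ν) (χ ν)) ⟩
    L (λ μ → ∑ terms (λ t → proj₁ t ℚ.* proj₂ t μ))
      ≡⟨ L-sum terms ⟩
    ∑ terms (λ t → proj₁ t ℚ.* L (proj₂ t))
      ≡⟨ as-sum (L φ) (L ψ) (L χ) ⟨
    L φ ℚ.+ q ℚ.* L ψ ℚ.+ L χ ∎
    where
    terms : List (ℚ × Functional)
    terms = (1ℚ , φ) ∷ (q , ψ) ∷ (1ℚ , χ) ∷ []
    as-sum : ∀ x y z → x ℚ.+ q ℚ.* y ℚ.+ z ≡ 1ℚ ℚ.* x ℚ.+ (q ℚ.* y ℚ.+ (1ℚ ℚ.* z ℚ.+ 0ℚ))
    as-sum x y z = solve 4 (λ x q y z → x :+ q :* y :+ z := con 1ℚ :* x :+ (q :* y :+ (con 1ℚ :* z :+ con 0ℚ))) refl x q y z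

  iterF : ℕ → (Functional → Functional) → Functional → Functional
  iterF zero    T φ = φ
  iterF (suc j) T φ = T (iterF j T φ)

  iterF-linear : ∀ j {T} → Linear T → Linear (iterF j T)
  iterF-linear zero    L = record { lin-cong = λ e → e ; lin-sum = λ xs q f μ → refl }
  iterF-linear (suc j) L = record
    { lin-cong = λ e → lin-cong L (lin-cong (iterF-linear j L) e)
    ; lin-sum  = λ xs q f μ → trans (lin-cong L (lin-sum (iterF-linear j L) xs q f) μ) (lin-sum L xs q _ μ)
    }

  iterF-inner : ∀ j T φ → iterF j T (T φ) ≡ T (iterF j T φ)
  iterF-inner zero    T φ = refl
  iterF-inner (suc j) T φ = cong T (iterF-inner j T φ)

  pairing-iter : ∀ {f T} → (∀ φ v → ⟪ φ , f v ⟫ ≡ ⟪ T φ , v ⟫) →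
                 ∀ j φ v → ⟪ φ , iter j f v ⟫ ≡ ⟪ iterF j T φ , v ⟫
  pairing-iter dual zero φ v = refl
  pairing-iter {f} {T} dual (suc j) φ v = begin
    ⟪ φ , f (iter j f v) ⟫     ≡⟨ dual φ (iter j f v) ⟩
    ⟪ T φ , iter j f v ⟫       ≡⟨ pairing-iter dual j (T φ) v ⟩
    ⟪ iterF j T (T φ) , v ⟫    ≡⟨ cong (λ ψ → ⟪ ψ , v ⟫) (iterF-inner j T φ) ⟩
    ⟪ T (iterF j T φ) , v ⟫ ∎

  z-z≡0 : ∀ (z : ℤ) → z ℤ.- + 0 ≡ z
  z-z≡0 z = ℤP.+-identityʳ z

  swap-subtractions : ∀ (z x y : ℤ) → z ℤ.- x ℤ.- y ≡ z ℤ.- y ℤ.- x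
  swap-subtractions = ℤRing.solve-∀

  -- The common form of the transposes of both Heisenberg operators: weight 1 along `incr` for the
  -- creation operators, and weight (n/α) times the multiplicity along `decr` for the annihilation
  -- operators.
  weightedPullback : (ℕ → Mono → ℚ) → (ℕ → Mono → Mono) → ℕ → Functional → Functional
  weightedPullback w σ n φ μ = w n μ ℚ.* φ (σ n μ)

  -- One treatment for both exponentials in X(z); `c n` is the coefficient of the n-th operator in
  -- the exponent. Commutation is asked for only on functionals respecting `≃`, since the relations
  -- between `incr` and `decr` are known up to `≃`.
  module Exponential (c : ℕ → ℚ) (op : ℕ → FVec → FVec) (w : ℕ → Mono → ℚ) (σ : ℕ → Mono → Mono)
    (op-dual : ∀ n φ v → ⟪ φ , op n v ⟫ ≡ ⟪ weightedPullback w σ n φ , v ⟫)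
    (O-resp : ∀ n {φ} → Resp φ → Resp (weightedPullback w σ (suc n) φ))
    (O-comm : ∀ m n {φ} → Resp φ →
      weightedPullback w σ (suc m) (weightedPullback w σ (suc n) φ) ≗ weightedPullback w σ (suc n) (weightedPullback w σ (suc m) φ))
    where

    O : ℕ → Functional → Functional
    O = weightedPullback w σ

    O-linear : ∀ n → Linear (O n)
    O-linear n = record
      { lin-cong = λ e μ → cong (w n μ ℚ.*_) (e (σ n μ))
      ; lin-sum  = λ xs q f μ → trans (sym (∑-* xs (w n μ) _))
          (∑-cong xs (λ x → solve 3 (λ c q f → c :* (q :* f) := q :* (c :* f)) refl (w n μ) (q x) (f x (σ n μ))))
      }

    iterO-linear : ∀ j n → Linear (iterF j (O n))
    iterO-linear j n = iterF-linear j (O-linear n)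

    iterO-resp : ∀ j n {φ} → Resp φ → Resp (iterF j (O (suc n)) φ)
    iterO-resp zero    n r = r
    iterO-resp (suc j) n r = O-resp n (iterO-resp j n r)

    iterO-comm : ∀ j m n {φ} → Resp φ → iterF j (O (suc n)) (O (suc m) φ) ≗ O (suc m) (iterF j (O (suc n)) φ)
    iterO-comm zero    m n r μ = refl
    iterO-comm (suc j) m n {φ} r μ = trans (lin-cong (O-linear (suc n)) (iterO-comm j m n r) μ)
      (O-comm n m (iterO-resp j n r) μ)

    coeff : ℕ → ℕ → ℚ
    coeff n j = powQ (c n) j ℚ.* frac (+ 1) (j !)

    weightProduct : ℕ → Mono → ℚ
    weightProduct i []       = 1ℚ
    weightProduct i (j ∷ js) = coeff i j ℚ.* weightProduct (suc i) js

    apply : ℕ → Mono → Functional → Functional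
    apply i []       φ = φ
    apply i (j ∷ js) φ = apply (suc i) js (iterF j (O i) φ)

    expWeight≡ : ∀ b v i js → expWeight c op b v i js ≡ weightProduct i js
    expWeight≡ b v i []       = refl
    expWeight≡ b v i (j ∷ js) = cong (coeff i j ℚ.*_) (expWeight≡ b v (suc i) js)

    applyFrom-dual : ∀ i js φ v → ⟪ φ , applyFrom op i js v ⟫ ≡ ⟪ apply i js φ , v ⟫
    applyFrom-dual i []       φ v = refl
    applyFrom-dual i (j ∷ js) φ v = trans (pairing-iter (op-dual i) j φ (applyFrom op (suc i) js v))
      (applyFrom-dual (suc i) js (iterF j (O i) φ) v)

    applyMono-dual : ∀ js φ v → ⟪ φ , applyMono op js v ⟫ ≡ ⟪ apply 1 js φ , v ⟫
    applyMono-dual []       φ v = refl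
    applyMono-dual (j ∷ js) φ v = trans (pairing-iter (op-dual 1) j φ (applyFrom op 2 js v))
      (applyFrom-dual 2 js (iterF j (O 1) φ) v)

    weightProduct-∷ʳ : ∀ i js j → weightProduct i (js ++ j ∷ []) ≡ weightProduct i js ℚ.* coeff (i ℕ.+ length js) j
    weightProduct-∷ʳ i []       j = trans (ℚP.*-comm (coeff i j) 1ℚ) (cong (λ n → 1ℚ ℚ.* coeff n j) (sym (ℕP.+-identityʳ i)))
    weightProduct-∷ʳ i (k ∷ js) j = begin
      coeff i k ℚ.* weightProduct (suc i) (js ++ j ∷ [])
        ≡⟨ cong (coeff i k ℚ.*_) (weightProduct-∷ʳ (suc i) js j) ⟩
      coeff i k ℚ.* (weightProduct (suc i) js ℚ.* coeff (suc i ℕ.+ length js) j)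
        ≡⟨ ℚP.*-assoc (coeff i k) _ _ ⟨
      coeff i k ℚ.* weightProduct (suc i) js ℚ.* coeff (suc i ℕ.+ length js) j
        ≡⟨ cong (λ n → coeff i k ℚ.* weightProduct (suc i) js ℚ.* coeff n j) (ℕP.+-suc i (length js)) ⟨
      coeff i k ℚ.* weightProduct (suc i) js ℚ.* coeff (i ℕ.+ suc (length js)) j ∎

    apply-∷ʳ : ∀ i js j φ → apply i (js ++ j ∷ []) φ ≡ iterF j (O (i ℕ.+ length js)) (apply i js φ)
    apply-∷ʳ i []       j φ = cong (λ n → iterF j (O n) φ) (sym (ℕP.+-identityʳ i))
    apply-∷ʳ i (k ∷ js) j φ = trans (apply-∷ʳ (suc i) js j (iterF k (O i) φ))
      (cong (λ n → iterF j (O n) (apply (suc i) js (iterF k (O i) φ))) (sym (ℕP.+-suc i (length js))))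

    apply-resp : ∀ i js {φ} → Resp φ → Resp (apply (suc i) js φ)
    apply-resp i []       r = r
    apply-resp i (j ∷ js) r = apply-resp (suc i) js (iterO-resp j i r)

    apply-linear : ∀ i js → Linear (apply i js)
    apply-linear i []       = record { lin-cong = λ e → e ; lin-sum = λ xs q f μ → refl }
    apply-linear i (j ∷ js) = record
      { lin-cong = λ e → lin-cong (apply-linear (suc i) js) (lin-cong (iterO-linear j i) e)
      ; lin-sum  = λ xs q f μ → trans (lin-cong (apply-linear (suc i) js) (lin-sum (iterO-linear j i) xs q f) μ)
                                      (lin-sum (apply-linear (suc i) js) xs q _ μ)
      }

    partsUpTo-length : ∀ k b → All (λ js → length js ≡ k) (partsUpTo k b)
    partsUpTo-length zero b with b ℕ.≟ 0
    ... | yes _ = refl ∷ []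
    ... | no  _ = []
    partsUpTo-length (suc k) b = AllP.concat⁺ (AllP.map⁺ (All.universal lem (upTo (suc b))))
      where
      lem : ∀ j → All (λ js → length js ≡ suc k)
        (if isYes (j ℕ.* suc k ℕ.≤? b) then map (λ m → m ++ (j ∷ [])) (partsUpTo k (b ∸ j ℕ.* suc k)) else [])
      lem j with j ℕ.* suc k ℕ.≤? b
      ... | no _  = []
      ... | yes _ = AllP.map⁺ (All.map (λ {js} e → trans (LP.length-++ js) (trans (ℕP.+-comm (length js) 1) (cong suc e)))
                      (partsUpTo-length k (b ∸ j ℕ.* suc k)))

    -- The coefficient of x^z in the product of the first k exponential factors.
    F : ℕ → ℤ → Functional → Functional
    F k (+ b)     φ μ = ∑ (partsUpTo k b) (λ js → weightProduct 1 js ℚ.* apply 1 js φ μ)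
    F k -[1+ _ ]  φ μ = 0ℚ

    F-linear : ∀ k z → Linear (F k z)
    F-linear k (+ b) = record
      { lin-cong = λ e μ → ∑-cong (partsUpTo k b) (λ js → cong (weightProduct 1 js ℚ.*_) (lin-cong (apply-linear 1 js) e μ))
      ; lin-sum  = λ xs q f μ → begin
          ∑ (partsUpTo k b) (λ js → weightProduct 1 js ℚ.* apply 1 js (λ ν → ∑ xs (λ x → q x ℚ.* f x ν)) μ)
            ≡⟨ ∑-cong (partsUpTo k b) (λ js → trans (cong (weightProduct 1 js ℚ.*_) (lin-sum (apply-linear 1 js) xs q f μ))
                 (trans (sym (∑-* xs (weightProduct 1 js) _))
                   (∑-cong xs (λ x → solve 3 (λ c q f → c :* (q :* f) := q :* (c :* f)) refl (weightProduct 1 js) (q x) (apply 1 js (f x) μ))))) ⟩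
          ∑ (partsUpTo k b) (λ js → ∑ xs (λ x → q x ℚ.* (weightProduct 1 js ℚ.* apply 1 js (f x) μ)))
            ≡⟨ ∑-swap (partsUpTo k b) xs _ ⟩
          ∑ xs (λ x → ∑ (partsUpTo k b) (λ js → q x ℚ.* (weightProduct 1 js ℚ.* apply 1 js (f x) μ)))
            ≡⟨ ∑-cong xs (λ x → ∑-* (partsUpTo k b) (q x) _) ⟩
          ∑ xs (λ x → q x ℚ.* F k (+ b) (f x) μ) ∎
      }
    F-linear k -[1+ _ ] = record
      { lin-cong = λ e μ → refl
      ; lin-sum = λ xs q f μ → sym (trans (∑-cong xs (λ x → ℚP.*-zeroʳ (q x))) (∑-zero xs)) }

    F-resp : ∀ k z {φ} → Resp φ → Resp (F k z φ)
    F-resp k (+ b)    r e = ∑-cong (partsUpTo k b) (λ js → cong (weightProduct 1 js ℚ.*_) (apply-resp 0 js r e))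
    F-resp k -[1+ _ ] r e = refl

    F-negative : ∀ k {z} φ → z ℤ.< + 0 → F k z φ ≗ λ _ → 0ℚ
    F-negative k {+ _}      φ (ℤ.+<+ ()) μ
    F-negative k { -[1+ _ ]} φ _ μ = refl

    factor : ℕ → ℤ → Functional → Mono → ℕ → ℚ
    factor k z φ μ j = coeff (suc k) j ℚ.* iterF j (O (suc k)) (F k (z ℤ.- + (j ℕ.* suc k)) φ) μ

    factor-negative : ∀ k z φ μ j → z ℤ.< + (j ℕ.* suc k) → factor k z φ μ j ≡ 0ℚ
    factor-negative k z φ μ j lt = trans (cong (coeff (suc k) j ℚ.*_)
        (lin-zero (iterO-linear j (suc k)) (F-negative k φ (subst (z ℤ.- + (j ℕ.* suc k) ℤ.<_) (ℤP.+-inverseʳ (+ (j ℕ.* suc k)))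
          (ℤP.+-monoˡ-< (ℤ.- + (j ℕ.* suc k)) lt))) μ))
      (ℚP.*-zeroʳ (coeff (suc k) j))

    <+⇒<* : ∀ {z J} k j → z ℤ.< + J → J ℕ.≤ j → z ℤ.< + (j ℕ.* suc k)
    <+⇒<* k j lt le = ℤP.<-≤-trans lt (ℤ.+≤+ (ℕP.≤-trans le (ℕP.m≤m*n j (suc k))))

    -- The last entry of a multiplicity list counts the parts k + 1, so the sum factors through the
    -- exponential of the (k + 1)-st term. Any cut-off `J` beyond `z` is allowed, which lets sums
    -- for different indices share one range.
    F-step : ∀ k z J φ μ → z ℤ.< + J → F (suc k) z φ μ ≡ ∑ (upTo J) (factor k z φ μ)
    F-step k -[1+ b ] J φ μ lt = sym (trans (∑-cong (upTo J) (λ j → factor-negative k -[1+ b ] φ μ j ℤ.-<+)) (∑-zero (upTo J)))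
    F-step k (+ b) J φ μ (ℤ.+<+ lt) = begin
      ∑ (concatMap parts (upTo (suc b))) summand     ≡⟨ ∑-concatMap parts (upTo (suc b)) summand ⟩
      ∑ (upTo (suc b)) (λ j → ∑ (parts j) summand)   ≡⟨ ∑-cong (upTo (suc b)) term ⟩
      ∑ (upTo (suc b)) (factor k (+ b) φ μ)          ≡⟨ ∑-upTo-extend {m = suc b} {n = J} _ lt (λ j le → factor-negative k (+ b) φ μ j (<+⇒<* k j (ℤ.+<+ ℕP.≤-refl) le)) ⟨
      ∑ (upTo J) (factor k (+ b) φ μ) ∎
      where
      summand : Mono → ℚ
      summand js = weightProduct 1 js ℚ.* apply 1 js φ μ
      parts : ℕ → List Mono
      parts j = if isYes (j ℕ.* suc k ℕ.≤? b) then map (λ m → m ++ (j ∷ [])) (partsUpTo k (b ∸ j ℕ.* suc k)) else []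
      term : ∀ j → ∑ (parts j) summand ≡ factor k (+ b) φ μ j
      term j with j ℕ.* suc k ℕ.≤? b
      ... | no  gt = sym (factor-negative k (+ b) φ μ j (ℤ.+<+ (ℕP.≰⇒> gt)))
      ... | yes le = begin
        ∑ (map (λ m → m ++ (j ∷ [])) ps) summand
          ≡⟨ ∑-map (λ m → m ++ (j ∷ [])) ps summand ⟩
        ∑ ps (λ m → summand (m ++ (j ∷ [])))
          ≡⟨ ∑-cong-All (All.map (λ {m} → snoc m) (partsUpTo-length k (b ∸ j ℕ.* suc k))) ⟩
        ∑ ps (λ m → γ ℚ.* (weightProduct 1 m ℚ.* iterF j (O (suc k)) (apply 1 m φ) μ))
          ≡⟨ ∑-* ps γ _ ⟩
        γ ℚ.* ∑ ps (λ m → weightProduct 1 m ℚ.* iterF j (O (suc k)) (apply 1 m φ) μ)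
          ≡⟨ cong (γ ℚ.*_) (lin-sum (iterO-linear j (suc k)) ps (weightProduct 1) (λ m → apply 1 m φ) μ) ⟨
        γ ℚ.* iterF j (O (suc k)) (F k (+ (b ∸ j ℕ.* suc k)) φ) μ
          ≡⟨ cong (λ z → γ ℚ.* iterF j (O (suc k)) (F k z φ) μ) (trans (ℤP.m-n≡m⊖n b (j ℕ.* suc k)) (ℤP.⊖-≥ le)) ⟨
        factor k (+ b) φ μ j ∎
        where
        γ = coeff (suc k) j
        ps = partsUpTo k (b ∸ j ℕ.* suc k)
        snoc : ∀ m → length m ≡ k → summand (m ++ (j ∷ [])) ≡ γ ℚ.* (weightProduct 1 m ℚ.* iterF j (O (suc k)) (apply 1 m φ) μ)
        snoc m refl = trans (cong₂ ℚ._*_ (weightProduct-∷ʳ 1 m j) (cong (λ ψ → ψ μ) (apply-∷ʳ 1 m j φ)))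
          (solve 3 (λ a b c → a :* b :* c := b :* (a :* c)) refl (weightProduct 1 m) γ (iterF j (O (suc k)) (apply 1 m φ) μ))

    -- The coefficient of xⁿ in x d/dx of the exponent.
    κ : ℕ → ℚ
    κ n = fromℕ n ℚ.* c n

    -- The differential equation of exp, read off coefficient by coefficient.
    coeff-suc : ∀ n j → fromℕ (suc j) ℚ.* coeff n (suc j) ≡ c n ℚ.* coeff n j
    coeff-suc n j = *-cancelˡ (fact≢0 j) (begin
      fromℕ (j !) ℚ.* (fromℕ (suc j) ℚ.* (c n ℚ.* powQ (c n) j ℚ.* frac (+ 1) (suc j !)))
        ≡⟨ solve 5 (λ f s c p r → f :* (s :* (c :* p :* r)) := c :* p :* (r :* (s :* f))) refl (fromℕ (j !)) (fromℕ (suc j)) (c n) (powQ (c n) j) (frac (+ 1) (suc j !)) ⟩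
      c n ℚ.* powQ (c n) j ℚ.* (frac (+ 1) (suc j !) ℚ.* (fromℕ (suc j) ℚ.* fromℕ (j !)))
        ≡⟨ cong (λ x → c n ℚ.* powQ (c n) j ℚ.* (frac (+ 1) (suc j !) ℚ.* x)) (trans (cong toℚ (ℤP.pos-* (suc j) (j !))) (toℚ-* (+ suc j) (+ (j !)))) ⟨
      c n ℚ.* powQ (c n) j ℚ.* (frac (+ 1) (suc j !) ℚ.* fromℕ (suc j !))
        ≡⟨ cong (c n ℚ.* powQ (c n) j ℚ.*_) (trans (frac-fact (suc j)) (sym (frac-fact j))) ⟩
      c n ℚ.* powQ (c n) j ℚ.* (frac (+ 1) (j !) ℚ.* fromℕ (j !))
        ≡⟨ solve 4 (λ f c p r → c :* p :* (r :* f) := f :* (c :* (p :* r))) refl (fromℕ (j !)) (c n) (powQ (c n) j) (frac (+ 1) (j !)) ⟩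
      fromℕ (j !) ℚ.* (c n ℚ.* coeff n j) ∎)
      where
      frac-fact : ∀ j → frac (+ 1) (j !) ℚ.* fromℕ (j !) ≡ 1ℚ
      frac-fact j with j ! | ℕP._!≢0 j
      ... | suc m | _ = frac-cancel (+ 1) m
      fact≢0 : ∀ j → fromℕ (j !) ≢ 0ℚ
      fact≢0 j with j ! | ℕP._!≢0 j
      ... | suc m | _ = fromℕ-suc≢0 m

    -- Apply x d/dx to the product of exponentials: it multiplies the product by x d/dx of the
    -- exponent. Comparing coefficients of x^z gives the recurrence, and the product rule becomes an
    -- induction on the number of factors.
    F-recurrence : ∀ k z φ μ → Resp φ →
      toℚ z ℚ.* F k z φ μ ≡ ∑ (upTo k) (λ i → κ (suc i) ℚ.* O (suc i) (F k (z ℤ.- + suc i) φ) μ)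
    F-recurrence zero (+ zero)  φ μ r = ℚP.*-zeroˡ (F 0 (+ 0) φ μ)
    F-recurrence zero (+ suc b) φ μ r = ℚP.*-zeroʳ (toℚ (+ suc b))
    F-recurrence zero -[1+ b ]  φ μ r = ℚP.*-zeroʳ (toℚ -[1+ b ])
    F-recurrence (suc k) z φ μ r = begin
      toℚ z ℚ.* F (suc k) z φ μ
        ≡⟨ cong (toℚ z ℚ.*_) (F-step k z (suc B) φ μ z<1+B) ⟩
      toℚ z ℚ.* ∑ (upTo (suc B)) (factor k z φ μ)
        ≡⟨ ∑-* (upTo (suc B)) (toℚ z) _ ⟨
      ∑ (upTo (suc B)) (λ j → toℚ z ℚ.* factor k z φ μ j)
        ≡⟨ ∑-cong (upTo (suc B)) split ⟩
      ∑ (upTo (suc B)) (λ j → partA j ℚ.+ partB j)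
        ≡⟨ ∑-+ (upTo (suc B)) partA partB ⟩
      ∑ (upTo (suc B)) partA ℚ.+ ∑ (upTo (suc B)) partB
        ≡⟨ cong₂ ℚ._+_ sumA sumB ⟩
      ∑ (upTo k) (λ i → κ (suc i) ℚ.* O (suc i) (F (suc k) (z ℤ.- + suc i) φ) μ) ℚ.+ κ (suc k) ℚ.* O (suc k) (F (suc k) (z ℤ.- + suc k) φ) μ
        ≡⟨ ∑-upTo-last k _ ⟨
      ∑ (upTo (suc k)) (λ i → κ (suc i) ℚ.* O (suc i) (F (suc k) (z ℤ.- + suc i) φ) μ) ∎
      where
      -- A cut-off that serves `z` and all `z - (i + 1)` at once.
      B : ℕ
      B = ℤ.∣ z ∣
      z≤B : z ℤ.≤ + B
      z≤B = i≤∣i∣ z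
        where
        i≤∣i∣ : ∀ z → z ℤ.≤ + ℤ.∣ z ∣
        i≤∣i∣ (+ n)    = ℤP.≤-refl
        i≤∣i∣ -[1+ n ] = ℤ.-≤+
      z<1+B : z ℤ.< + suc B
      z<1+B = ℤP.≤-<-trans z≤B (ℤ.+<+ ℕP.≤-refl)
      z-n<B : ∀ n → z ℤ.- + suc n ℤ.< + B
      z-n<B n = ℤP.<-≤-trans (subst (z ℤ.- + suc n ℤ.<_) (z-z≡0 z) (ℤP.+-monoʳ-< z (ℤP.neg-mono-< {+ 0} {+ suc n} (ℤ.+<+ (ℕ.s≤s ℕ.z≤n))))) z≤B
      s : ℕ → ℕ
      s j = j ℕ.* suc k
      I : ℕ → Functional → Functional
      I j = iterF j (O (suc k))
      -- The factor `z` is split into `z - s j` and `s j`. The first calls for the recurrence with k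
      -- factors; the second is the derivative of the last exponential.
      partA partB : ℕ → ℚ
      partA j = ∑ (upTo k) (λ i → κ (suc i) ℚ.* (coeff (suc k) j ℚ.* O (suc i) (I j (F k (z ℤ.- + suc i ℤ.- + s j) φ)) μ))
      partB j = fromℕ (suc k) ℚ.* (fromℕ j ℚ.* coeff (suc k) j) ℚ.* I j (F k (z ℤ.- + s j) φ) μ
      partA≡ : ∀ j → coeff (suc k) j ℚ.* (toℚ (z ℤ.- + s j) ℚ.* I j (F k (z ℤ.- + s j) φ) μ) ≡ partA j
      partA≡ j = begin
        coeff (suc k) j ℚ.* (toℚ (z ℤ.- + s j) ℚ.* I j (F k (z ℤ.- + s j) φ) μ)
          ≡⟨ cong (coeff (suc k) j ℚ.*_) (lin-scale (iterO-linear j (suc k)) (toℚ (z ℤ.- + s j)) (F k (z ℤ.- + s j) φ) μ) ⟨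
        coeff (suc k) j ℚ.* I j (λ ν → toℚ (z ℤ.- + s j) ℚ.* F k (z ℤ.- + s j) φ ν) μ
          ≡⟨ cong (coeff (suc k) j ℚ.*_) (lin-cong (iterO-linear j (suc k)) (λ ν → F-recurrence k (z ℤ.- + s j) φ ν r) μ) ⟩
        coeff (suc k) j ℚ.* I j (λ ν → ∑ (upTo k) (λ i → κ (suc i) ℚ.* O (suc i) (F k (z ℤ.- + s j ℤ.- + suc i) φ) ν)) μ
          ≡⟨ cong (coeff (suc k) j ℚ.*_) (lin-sum (iterO-linear j (suc k)) (upTo k) (λ i → κ (suc i)) (λ i → O (suc i) (F k (z ℤ.- + s j ℤ.- + suc i) φ)) μ) ⟩
        coeff (suc k) j ℚ.* ∑ (upTo k) (λ i → κ (suc i) ℚ.* I j (O (suc i) (F k (z ℤ.- + s j ℤ.- + suc i) φ)) μ)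
          ≡⟨ ∑-* (upTo k) (coeff (suc k) j) _ ⟨
        ∑ (upTo k) (λ i → coeff (suc k) j ℚ.* (κ (suc i) ℚ.* I j (O (suc i) (F k (z ℤ.- + s j ℤ.- + suc i) φ)) μ))
          ≡⟨ ∑-cong (upTo k) (λ i → trans
               (cong (λ x → coeff (suc k) j ℚ.* (κ (suc i) ℚ.* x)) (trans
                 (iterO-comm j i k (F-resp k (z ℤ.- + s j ℤ.- + suc i) r) μ)
                 (cong (λ y → O (suc i) (I j (F k y φ)) μ) (swap-subtractions z (+ s j) (+ suc i)))))
               (solve 3 (λ c q f → c :* (q :* f) := q :* (c :* f)) refl (coeff (suc k) j) (κ (suc i))
                 (O (suc i) (I j (F k (z ℤ.- + suc i ℤ.- + s j) φ)) μ))) ⟩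
        partA j ∎
      split : ∀ j → toℚ z ℚ.* factor k z φ μ j ≡ partA j ℚ.+ partB j
      split j = begin
        toℚ z ℚ.* (coeff (suc k) j ℚ.* G)
          ≡⟨ cong (ℚ._* (coeff (suc k) j ℚ.* G)) (trans (cong toℚ (sym (cancel z (+ s j)))) (toℚ-+ (z ℤ.- + s j) (+ s j))) ⟩
        (toℚ (z ℤ.- + s j) ℚ.+ toℚ (+ s j)) ℚ.* (coeff (suc k) j ℚ.* G)
          ≡⟨ cong (λ x → (toℚ (z ℤ.- + s j) ℚ.+ x) ℚ.* (coeff (suc k) j ℚ.* G)) (trans (cong toℚ (ℤP.pos-* j (suc k))) (toℚ-* (+ j) (+ suc k))) ⟩
        (toℚ (z ℤ.- + s j) ℚ.+ fromℕ j ℚ.* fromℕ (suc k)) ℚ.* (coeff (suc k) j ℚ.* G)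
          ≡⟨ solve 5 (λ y j k c g → (y :+ j :* k) :* (c :* g) := c :* (y :* g) :+ k :* (j :* c) :* g) refl
               (toℚ (z ℤ.- + s j)) (fromℕ j) (fromℕ (suc k)) (coeff (suc k) j) G ⟩
        coeff (suc k) j ℚ.* (toℚ (z ℤ.- + s j) ℚ.* G) ℚ.+ partB j
          ≡⟨ cong (ℚ._+ partB j) (partA≡ j) ⟩
        partA j ℚ.+ partB j ∎
        where
        G = I j (F k (z ℤ.- + s j) φ) μ
        cancel : ∀ (z x : ℤ) → z ℤ.- x ℤ.+ x ≡ z
        cancel = ℤRing.solve-∀
      sumA : ∑ (upTo (suc B)) partA ≡ ∑ (upTo k) (λ i → κ (suc i) ℚ.* O (suc i) (F (suc k) (z ℤ.- + suc i) φ) μ)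
      sumA = trans (∑-swap (upTo (suc B)) (upTo k) _) (∑-cong (upTo k) λ i → begin
        ∑ (upTo (suc B)) (λ j → κ (suc i) ℚ.* (coeff (suc k) j ℚ.* O (suc i) (I j (F k (z ℤ.- + suc i ℤ.- + s j) φ)) μ))
          ≡⟨ ∑-* (upTo (suc B)) (κ (suc i)) _ ⟩
        κ (suc i) ℚ.* ∑ (upTo (suc B)) (λ j → coeff (suc k) j ℚ.* O (suc i) (I j (F k (z ℤ.- + suc i ℤ.- + s j) φ)) μ)
          ≡⟨ cong (κ (suc i) ℚ.*_) (lin-sum (O-linear (suc i)) (upTo (suc B)) (coeff (suc k)) (λ j → I j (F k (z ℤ.- + suc i ℤ.- + s j) φ)) μ) ⟨
        κ (suc i) ℚ.* O (suc i) (λ ν → ∑ (upTo (suc B)) (factor k (z ℤ.- + suc i) φ ν)) μ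
          ≡⟨ cong (κ (suc i) ℚ.*_) (lin-cong (O-linear (suc i)) (λ ν → F-step k (z ℤ.- + suc i) (suc B) φ ν
               (ℤP.<-trans (z-n<B i) (ℤ.+<+ ℕP.≤-refl))) μ) ⟨
        κ (suc i) ℚ.* O (suc i) (F (suc k) (z ℤ.- + suc i) φ) μ ∎)
      partB-suc : ∀ j → partB (suc j) ≡ κ (suc k) ℚ.* (coeff (suc k) j ℚ.* O (suc k) (I j (F k (z ℤ.- + suc k ℤ.- + s j) φ)) μ)
      partB-suc j = begin
        fromℕ (suc k) ℚ.* (fromℕ (suc j) ℚ.* coeff (suc k) (suc j)) ℚ.* G
          ≡⟨ cong (λ x → fromℕ (suc k) ℚ.* x ℚ.* G) (coeff-suc (suc k) j) ⟩
        fromℕ (suc k) ℚ.* (c (suc k) ℚ.* coeff (suc k) j) ℚ.* G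
          ≡⟨ solve 4 (λ n c q g → n :* (c :* q) :* g := n :* c :* (q :* g)) refl (fromℕ (suc k)) (c (suc k)) (coeff (suc k) j) G ⟩
        κ (suc k) ℚ.* (coeff (suc k) j ℚ.* G)
          ≡⟨ cong (λ y → κ (suc k) ℚ.* (coeff (suc k) j ℚ.* I (suc j) (F k y φ) μ)) (trans (cong (λ x → z ℤ.- x) (ℤP.pos-+ (suc k) (s j))) (lem z (+ suc k) (+ s j))) ⟩
        κ (suc k) ℚ.* (coeff (suc k) j ℚ.* O (suc k) (I j (F k (z ℤ.- + suc k ℤ.- + s j) φ)) μ) ∎
        where
        G = I (suc j) (F k (z ℤ.- + s (suc j)) φ) μ
        lem : ∀ (z x y : ℤ) → z ℤ.- (x ℤ.+ y) ≡ z ℤ.- x ℤ.- y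
        lem = ℤRing.solve-∀
      sumB : ∑ (upTo (suc B)) partB ≡ κ (suc k) ℚ.* O (suc k) (F (suc k) (z ℤ.- + suc k) φ) μ
      sumB = begin
        ∑ (upTo (suc B)) partB
          -- The term `j = 0` vanishes, and in the others `j` drops by one; this is why the cut-off
          -- falls from `suc B` to `B`.
          ≡⟨ ∑-upTo-suc B partB ⟩
        partB 0 ℚ.+ ∑ (upTo B) (λ j → partB (suc j))
          ≡⟨ cong₂ ℚ._+_ (solve 3 (λ n q g → n :* (con 0ℚ :* q) :* g := con 0ℚ) refl (fromℕ (suc k)) (coeff (suc k) 0) (I 0 (F k (z ℤ.- + s 0) φ) μ))
               (∑-cong (upTo B) partB-suc) ⟩
        0ℚ ℚ.+ ∑ (upTo B) (λ j → κ (suc k) ℚ.* (coeff (suc k) j ℚ.* O (suc k) (I j (F k (z ℤ.- + suc k ℤ.- + s j) φ)) μ))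
          ≡⟨ trans (ℚP.+-identityˡ _) (∑-* (upTo B) (κ (suc k)) _) ⟩
        κ (suc k) ℚ.* ∑ (upTo B) (λ j → coeff (suc k) j ℚ.* O (suc k) (I j (F k (z ℤ.- + suc k ℤ.- + s j) φ)) μ)
          ≡⟨ cong (κ (suc k) ℚ.*_) (lin-sum (O-linear (suc k)) (upTo B) (coeff (suc k)) (λ j → I j (F k (z ℤ.- + suc k ℤ.- + s j) φ)) μ) ⟨
        κ (suc k) ℚ.* O (suc k) (λ ν → ∑ (upTo B) (factor k (z ℤ.- + suc k) φ ν)) μ
          ≡⟨ cong (κ (suc k) ℚ.*_) (lin-cong (O-linear (suc k)) (λ ν → F-step k (z ℤ.- + suc k) B φ ν (z-n<B k)) μ) ⟨
        κ (suc k) ℚ.* O (suc k) (F (suc k) (z ℤ.- + suc k) φ) μ ∎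

    -- A part k + 1 is too large for a partition of b, so only the term without such parts survives.
    F-stable-suc : ∀ k b φ μ → b ℕ.≤ k → F (suc k) (+ b) φ μ ≡ F k (+ b) φ μ
    F-stable-suc k b φ μ le = begin
      F (suc k) (+ b) φ μ                                   ≡⟨ F-step k (+ b) (suc b) φ μ (ℤ.+<+ ℕP.≤-refl) ⟩
      ∑ (upTo (suc b)) (factor k (+ b) φ μ)                 ≡⟨ ∑-upTo-suc b (factor k (+ b) φ μ) ⟩
      factor k (+ b) φ μ 0 ℚ.+ ∑ (upTo b) (λ j → factor k (+ b) φ μ (suc j))
        ≡⟨ cong₂ ℚ._+_ (trans (solve 1 (λ x → con 1ℚ :* con 1ℚ :* x := x) refl (F k (+ b ℤ.- + 0) φ μ)) (cong (λ z → F k z φ μ) (z-z≡0 (+ b))))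
             (trans (∑-cong (upTo b) (λ j → factor-negative k (+ b) φ μ (suc j) (ℤ.+<+ (ℕP.≤-trans (ℕ.s≤s le) (ℕP.m≤m+n (suc k) _))))) (∑-zero (upTo b))) ⟩
      F k (+ b) φ μ ℚ.+ 0ℚ                                  ≡⟨ ℚP.+-identityʳ _ ⟩
      F k (+ b) φ μ ∎

    -- A coefficient of the full exponential; the factors beyond the z-th no longer matter by
    -- `F-stable-suc`. Integer indices, with value zero below 0, allow shifts without side
    -- conditions.
    E : ℤ → Functional → Functional
    E z = F ℤ.∣ z ∣ z

    F≡E : ∀ k z φ μ → z ℤ.≤ + k → F k z φ μ ≡ E z φ μ
    F≡E k -[1+ b ] φ μ le = refl
    F≡E k (+ b) φ μ (ℤ.+≤+ le) = go (ℕP.≤⇒≤′ le)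
      where
      go : ∀ {k} → b ℕ.≤′ k → F k (+ b) φ μ ≡ F b (+ b) φ μ
      go ℕ.≤′-refl           = refl
      go (ℕ.≤′-step {n} le)  = trans (F-stable-suc n b φ μ (ℕP.≤′⇒≤ le)) (go le)

    E-recurrence : ∀ B z φ μ → Resp φ → z ℤ.≤ + B →
      toℚ z ℚ.* E z φ μ ≡ ∑ (upTo B) (λ i → κ (suc i) ℚ.* O (suc i) (E (z ℤ.- + suc i) φ) μ)
    E-recurrence B z φ μ r le = begin
      toℚ z ℚ.* E z φ μ   ≡⟨ cong (toℚ z ℚ.*_) (F≡E B z φ μ le) ⟨
      toℚ z ℚ.* F B z φ μ ≡⟨ F-recurrence B z φ μ r ⟩
      ∑ (upTo B) (λ i → κ (suc i) ℚ.* O (suc i) (F B (z ℤ.- + suc i) φ) μ)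
        ≡⟨ ∑-cong (upTo B) (λ i → cong (κ (suc i) ℚ.*_) (lin-cong (O-linear (suc i)) (λ ν → F≡E B (z ℤ.- + suc i) φ ν
             (ℤP.≤-trans (ℤP.i≤j⇒i-k≤j (+ suc i) ℤP.≤-refl) le)) μ)) ⟩
      ∑ (upTo B) (λ i → κ (suc i) ℚ.* O (suc i) (E (z ℤ.- + suc i) φ) μ) ∎

    E-linear : ∀ z → Linear (E z)
    E-linear z = F-linear ℤ.∣ z ∣ z

    E-resp : ∀ z {φ} → Resp φ → Resp (E z φ)
    E-resp z = F-resp ℤ.∣ z ∣ z

    E-negative : ∀ {z} φ → z ℤ.< + 0 → E z φ ≗ λ _ → 0ℚ
    E-negative {z} φ = F-negative ℤ.∣ z ∣ {z} φ

    E-zero : ∀ φ → E (+ 0) φ ≗ φ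
    E-zero φ μ = solve 1 (λ x → con 1ℚ :* x :+ con 0ℚ := x) refl (φ μ)

    apply-commutes : ∀ (T : Functional → Functional) → (∀ n {φ} → Resp φ → T (O (suc n) φ) ≗ O (suc n) (T φ)) →
                     ∀ i js {φ} → Resp φ → T (apply (suc i) js φ) ≗ apply (suc i) js (T φ)
    apply-commutes T comm i []       r μ = refl
    apply-commutes T comm i (j ∷ js) {φ} r μ =
      trans (apply-commutes T comm (suc i) js (iterO-resp j i r) μ) (lin-cong (apply-linear (suc (suc i)) js) (iter-commutes j) μ)
      where
      iter-commutes : ∀ j → T (iterF j (O (suc i)) φ) ≗ iterF j (O (suc i)) (T φ)
      iter-commutes zero    ν = refl
      iter-commutes (suc j) ν = trans (comm i (iterO-resp j i r) ν) (lin-cong (O-linear (suc i)) (iter-commutes j) ν)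

    -- `E z` is a polynomial in the operators `O n`, so it is enough to commute with each of these.
    -- It is used first for `T` a single `O n`, then for `T` another coefficient `E y`.
    E-commutes : ∀ {T : Functional → Functional} → Linear T → (∀ n {φ} → Resp φ → T (O (suc n) φ) ≗ O (suc n) (T φ)) →
                 ∀ z {φ} → Resp φ → T (E z φ) ≗ E z (T φ)
    E-commutes {T} L comm -[1+ b ] {φ} r μ = lin-zero L (λ ν → refl) μ
    E-commutes {T} L comm (+ b) {φ} r μ = trans (lin-sum L (partsUpTo b b) (weightProduct 1) (λ js → apply 1 js φ) μ)
      (∑-cong (partsUpTo b b) (λ js → cong (weightProduct 1 js ℚ.*_) (apply-commutes T comm 0 js r μ)))

    E-O-comm : ∀ n z {φ} → Resp φ → O (suc n) (E z φ) ≗ E z (O (suc n) φ)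
    E-O-comm n = E-commutes (O-linear (suc n)) (λ m r → O-comm n m r)

    E-comm : ∀ y z {φ} → Resp φ → E y (E z φ) ≗ E z (E y φ)
    E-comm y = E-commutes (E-linear y) (λ n r μ → sym (E-O-comm n y r μ))

    expCoeff-dual : ∀ b φ v → ⟪ φ , expCoeff c op b v ⟫ ≡ ⟪ E (+ b) φ , v ⟫
    expCoeff-dual b φ v = begin
      ⟪ φ , expCoeff c op b v ⟫
        ≡⟨⟩
      ⟪ φ , concatMap (λ js → scaleV (expWeight c op b v 1 js) (applyMono op js v)) (partitionsOf b) ⟫
        ≡⟨ ∑-concatMap (λ js → scaleV (expWeight c op b v 1 js) (applyMono op js v)) (partitionsOf b) _ ⟩
      ∑ (partitionsOf b) (λ js → ⟪ φ , scaleV (expWeight c op b v 1 js) (applyMono op js v) ⟫)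
        ≡⟨ ∑-cong (partitionsOf b) (λ js → trans (pairing-scaleV φ (expWeight c op b v 1 js) (applyMono op js v))
             (cong₂ ℚ._*_ (expWeight≡ b v 1 js) (applyMono-dual js φ v))) ⟩
      ∑ (partitionsOf b) (λ js → weightProduct 1 js ℚ.* ⟪ apply 1 js φ , v ⟫)
        ≡⟨ pairing-sum (partitionsOf b) (weightProduct 1) (λ js → apply 1 js φ) v ⟨
      ⟪ E (+ b) φ , v ⟫ ∎

  mutual
    termOfX : ℕ → ℕ → ℤ → FVec → ℕ → FVec
    termOfX = _

    Xneg-concatMap : ∀ α k t v → Xneg α k t v ≡ concatMap (termOfX α k t v) (upTo (suc (maxWeight v)))
    Xneg-concatMap α k t v = refl

  termOfX-pos : ∀ α k t v b j → (+ k) ℤ.+ (+ b) ℤ.- (t ℤ.+ (+ 1)) ℤ.* (+ α) ≡ + j →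
                termOfX α k t v b ≡ Eminus α j (Eplus α b v)
  termOfX-pos α k t v b j e with (+ k) ℤ.+ (+ b) ℤ.- (t ℤ.+ (+ 1)) ℤ.* (+ α)
  termOfX-pos α k t v b j refl | .(+ j) = refl

  termOfX-neg : ∀ α k t v b n → (+ k) ℤ.+ (+ b) ℤ.- (t ℤ.+ (+ 1)) ℤ.* (+ α) ≡ -[1+ n ] → termOfX α k t v b ≡ []
  termOfX-neg α k t v b n e with (+ k) ℤ.+ (+ b) ℤ.- (t ℤ.+ (+ 1)) ℤ.* (+ α)
  termOfX-neg α k t v b n refl | .(-[1+ n ]) = refl

  -- Vertex operators

  -- Fitted to the recurrence for `E`: its values below 0 vanish, `E (+ 0)` is the identity, and a
  -- positive index can be cancelled.
  ℤ-induction : (Q : ℤ → Set) → (∀ z → z ℤ.< + 0 → Q z) → Q (+ 0) →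
                (∀ b → (∀ z → z ℤ.< + suc b → Q z) → Q (+ suc b)) → ∀ z → Q z
  ℤ-induction Q neg base step z = below (suc ℤ.∣ z ∣) z (z<1+∣z∣ z)
    where
    z<1+∣z∣ : ∀ z → z ℤ.< + suc ℤ.∣ z ∣
    z<1+∣z∣ (+ n)    = ℤ.+<+ ℕP.≤-refl
    z<1+∣z∣ -[1+ n ] = ℤ.-<+
    below : ∀ b z → z ℤ.< + b → Q z
    below b       -[1+ n ]  lt = neg _ ℤ.-<+
    below b       (+ zero)  lt = base
    below (suc b) (+ suc n) (ℤ.+<+ (ℕ.s≤s lt)) = step n (λ z z<n → below b z (ℤP.<-≤-trans z<n (ℤ.+≤+ lt)))

  z-n<z : ∀ z n → z ℤ.- + suc n ℤ.< z
  z-n<z z n = subst (z ℤ.- + suc n ℤ.<_) (ℤP.+-identityʳ z) (ℤP.+-monoʳ-< z (ℤP.neg-mono-< {+ 0} {+ suc n} (ℤ.+<+ (ℕ.s≤s ℕ.z≤n))))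

  minus-negative : ∀ {z} n → z ℤ.≤ + 0 → z ℤ.- + suc n ℤ.< + 0
  minus-negative {z} n le = ℤP.<-≤-trans (z-n<z z n) le

  VanishesAt : Functional → ℤ → Set
  VanishesAt φ z = ∀ μ → + weight μ ≡ z → φ μ ≡ 0ℚ

  shift-plus : ∀ w j z n → w ℤ.+ j ≡ z → (n ℤ.+ w) ℤ.+ (j ℤ.- n) ≡ z
  shift-plus w j z n e = trans (lem w j n) e
    where
    lem : ∀ (w j n : ℤ) → (n ℤ.+ w) ℤ.+ (j ℤ.- n) ≡ w ℤ.+ j
    lem = ℤRing.solve-∀

  shift-minus : ∀ w j z n → n ℤ.+ w ≡ z ℤ.+ j → w ≡ z ℤ.+ (j ℤ.- n)
  shift-minus w j z n e = trans (lem w n) (trans (cong (ℤ._- n) e) (ℤP.+-assoc z j (ℤ.- n)))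
    where
    lem : ∀ (w n : ℤ) → w ≡ n ℤ.+ w ℤ.- n
    lem = ℤRing.solve-∀

  -- Homogeneity is needed at every positive integer α, so this much is done in general; the
  -- exchange relations follow for α = 1 only.
  module Operators (a : ℕ) where
    α : ℕ
    α = suc a

    ∂weight : ℕ → Mono → ℚ
    ∂weight n μ = frac (+ n) α ℚ.* fromℕ (mult n μ)

    hMinus-dual : ∀ n φ v → ⟪ φ , hMinus n v ⟫ ≡ ⟪ (λ μ → 1ℚ ℚ.* φ (incr n μ)) , v ⟫
    hMinus-dual n φ v = trans (∑-map _ v _) (∑-cong v (λ { (c , μ) → cong (c ℚ.*_) (sym (ℚP.*-identityˡ (φ (incr n μ)))) }))

    hPlus-dual : ∀ n φ v → ⟪ φ , hPlus α n v ⟫ ≡ ⟪ (λ μ → ∂weight n μ ℚ.* φ (decr n μ)) , v ⟫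
    hPlus-dual n φ v = trans (∑-map _ v _) (∑-cong v (λ { (c , μ) →
      solve 3 (λ w c f → w :* c :* f := c :* (w :* f)) refl (∂weight n μ) c (φ (decr n μ)) }))

    ∂-comm : ∀ m n {φ} → Resp φ → ∀ μ →
      ∂weight (suc m) μ ℚ.* (∂weight (suc n) (decr (suc m) μ) ℚ.* φ (decr (suc n) (decr (suc m) μ))) ≡
      ∂weight (suc n) μ ℚ.* (∂weight (suc m) (decr (suc n) μ) ℚ.* φ (decr (suc m) (decr (suc n) μ)))
    ∂-comm m n {φ} r μ = by-cases (m ℕ.≟ n)
      where
      by-cases : Dec (m ≡ n) →
        ∂weight (suc m) μ ℚ.* (∂weight (suc n) (decr (suc m) μ) ℚ.* φ (decr (suc n) (decr (suc m) μ))) ≡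
        ∂weight (suc n) μ ℚ.* (∂weight (suc m) (decr (suc n) μ) ℚ.* φ (decr (suc m) (decr (suc n) μ)))
      by-cases (yes refl) = refl
      by-cases (no m≢n) = begin
        x ℚ.* (∂weight (suc n) (decr (suc m) μ) ℚ.* φ (decr (suc n) (decr (suc m) μ)))
          ≡⟨ cong₂ (λ k z → x ℚ.* (frac (+ suc n) α ℚ.* fromℕ k ℚ.* z)) (mult-decr-other n m μ (m≢n ∘ sym)) (r (decr-comm n m μ)) ⟩
        x ℚ.* (y ℚ.* z)
          ≡⟨ solve 3 (λ x y z → x :* (y :* z) := y :* (x :* z)) refl x y z ⟩
        y ℚ.* (x ℚ.* z)
          ≡⟨ cong (λ k → y ℚ.* (frac (+ suc m) α ℚ.* fromℕ k ℚ.* z)) (mult-decr-other m n μ m≢n) ⟨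
        y ℚ.* (∂weight (suc m) (decr (suc n) μ) ℚ.* z) ∎
        where
        x = ∂weight (suc m) μ
        y = ∂weight (suc n) μ
        z = φ (decr (suc m) (decr (suc n) μ))

    module H = Exponential (λ n → frac (+ α) n) hMinus (λ _ _ → 1ℚ) incr hMinus-dual
      (λ n r e → cong (1ℚ ℚ.*_) (r (incr-cong n e)))
      (λ m n r μ → cong (λ x → 1ℚ ℚ.* (1ℚ ℚ.* x)) (r (incr-comm n m μ)))

    module U = Exponential (λ n → frac (ℤ.- (+ (2 ℕ.* α))) n) (hPlus α) ∂weight decr hPlus-dual
      (λ n r e → cong₂ (λ x y → frac (+ suc n) α ℚ.* fromℕ x ℚ.* y) (mult-≡ e n) (r (decr-cong n e)))
      ∂-comm

    -- The coefficients α/n and -2α/n of the two exponents lose their denominators under x d/dx, so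
    -- both recurrences have constant coefficients.
    κ-frac : ∀ z n → fromℕ (suc n) ℚ.* frac z (suc n) ≡ toℚ z
    κ-frac z n = trans (ℚP.*-comm (fromℕ (suc n)) (frac z (suc n))) (frac-cancel z n)

    H-recurrence : ∀ B z φ μ → Resp φ → z ℤ.≤ + B →
      toℚ z ℚ.* H.E z φ μ ≡ ∑ (upTo B) (λ i → toℚ (+ α) ℚ.* H.E (z ℤ.- + suc i) φ (incr (suc i) μ))
    H-recurrence B z φ μ r le = trans (H.E-recurrence B z φ μ r le)
      (∑-cong (upTo B) (λ i → cong₂ ℚ._*_ (κ-frac (+ α) i) (ℚP.*-identityˡ (H.E (z ℤ.- + suc i) φ (incr (suc i) μ)))))

    -2α : ℚ
    -2α = toℚ (ℤ.- (+ (2 ℕ.* α)))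

    U-recurrence : ∀ B z φ μ → Resp φ → z ℤ.≤ + B →
      toℚ z ℚ.* U.E z φ μ ≡ ∑ (upTo B) (λ i → -2α ℚ.* (∂weight (suc i) μ ℚ.* U.E (z ℤ.- + suc i) φ (decr (suc i) μ)))
    U-recurrence B z φ μ r le = trans (U.E-recurrence B z φ μ r le)
      (∑-cong (upTo B) (λ i → cong (ℚ._* (∂weight (suc i) μ ℚ.* U.E (z ℤ.- + suc i) φ (decr (suc i) μ))) (κ-frac (ℤ.- (+ (2 ℕ.* α))) i)))

    ∂weight-zero : ∀ n {μ} x → mult n μ ≡ 0 → ∂weight n μ ℚ.* x ≡ 0ℚ
    ∂weight-zero n x e rewrite e = solve 2 (λ f x → f :* con 0ℚ :* x := con 0ℚ) refl (frac (+ n) α) x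

    -- `H.E j` transposes an operator raising the weight by `j`. Along the recurrence `incr` adds to
    -- the weight exactly what the index loses.
    H-vanishes : ∀ {φ z} → Resp φ → VanishesAt φ z → ∀ j μ → + weight μ ℤ.+ j ≡ z → H.E j φ μ ≡ 0ℚ
    H-vanishes {φ} {z} r v = ℤ-induction (λ j → ∀ μ → + weight μ ℤ.+ j ≡ z → H.E j φ μ ≡ 0ℚ)
      (λ j j<0 μ _ → H.E-negative φ j<0 μ)
      (λ μ e → trans (H.E-zero φ μ) (v μ (trans (sym (ℤP.+-identityʳ _)) e)))
      (λ b ih μ e → *≡0⇒ (fromℕ-suc≢0 b) (trans (H-recurrence (suc b) (+ suc b) φ μ r ℤP.≤-refl)
        (trans (∑-cong (upTo (suc b)) (λ i → trans (cong (toℚ (+ α) ℚ.*_) (ih (+ suc b ℤ.- + suc i) (z-n<z (+ suc b) i) (incr (suc i) μ)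
            (trans (cong (λ w → + w ℤ.+ (+ suc b ℤ.- + suc i)) (weight-incr i μ)) (shift-plus (+ weight μ) (+ suc b) z (+ suc i) e))))
            (ℚP.*-zeroʳ (toℚ (+ α))))) (∑-zero (upTo (suc b))))))

    U-vanishes : ∀ {φ z} → Resp φ → VanishesAt φ z → ∀ j μ → + weight μ ≡ z ℤ.+ j → U.E j φ μ ≡ 0ℚ
    U-vanishes {φ} {z} r v = ℤ-induction (λ j → ∀ μ → + weight μ ≡ z ℤ.+ j → U.E j φ μ ≡ 0ℚ)
      (λ j j<0 μ _ → U.E-negative φ j<0 μ)
      (λ μ e → trans (U.E-zero φ μ) (v μ (trans e (ℤP.+-identityʳ _))))
      step
      where
      step : ∀ b → (∀ j → j ℤ.< + suc b → ∀ μ → + weight μ ≡ z ℤ.+ j → U.E j φ μ ≡ 0ℚ) →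
             ∀ μ → + weight μ ≡ z ℤ.+ + suc b → U.E (+ suc b) φ μ ≡ 0ℚ
      step b ih μ e = *≡0⇒ (fromℕ-suc≢0 b) (trans (U-recurrence (suc b) (+ suc b) φ μ r ℤP.≤-refl)
        (trans (∑-cong (upTo (suc b)) term) (∑-zero (upTo (suc b)))))
        where
        term : ∀ i → -2α ℚ.* (∂weight (suc i) μ ℚ.* U.E (+ suc b ℤ.- + suc i) φ (decr (suc i) μ)) ≡ 0ℚ
        term i = by-cases (mult (suc i) μ ℕ.≟ 0)
          where
          by-cases : Dec (mult (suc i) μ ≡ 0) → -2α ℚ.* (∂weight (suc i) μ ℚ.* U.E (+ suc b ℤ.- + suc i) φ (decr (suc i) μ)) ≡ 0ℚ
          by-cases (yes m≡0) = trans (cong (-2α ℚ.*_) (∂weight-zero (suc i) {μ} _ m≡0)) (ℚP.*-zeroʳ -2α)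
          by-cases (no  m≢0) = trans (cong (λ x → -2α ℚ.* (∂weight (suc i) μ ℚ.* x)) (ih (+ suc b ℤ.- + suc i) (z-n<z (+ suc b) i) (decr (suc i) μ)
                (shift-minus (+ weight (decr (suc i) μ)) (+ suc b) z (+ suc i) (trans (cong +_ (weight-decr i μ m≢0)) e))))
              (solve 2 (λ x y → x :* (y :* con 0ℚ) := con 0ℚ) refl -2α (∂weight (suc i) μ))

    -- The weight cannot be lowered below 0. In the recurrence a `decr` either removes an actual
    -- part, which preserves the inequality, or carries the factor 0.
    U-above-weight : ∀ {φ} → Resp φ → ∀ j μ → + weight μ ℤ.< j → U.E j φ μ ≡ 0ℚ
    U-above-weight {φ} r = ℤ-induction (λ j → ∀ μ → + weight μ ℤ.< j → U.E j φ μ ≡ 0ℚ)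
      (λ j j<0 μ _ → U.E-negative φ j<0 μ)
      (λ { μ (ℤ.+<+ ()) })
      step
      where
      step : ∀ b → (∀ j → j ℤ.< + suc b → ∀ μ → + weight μ ℤ.< j → U.E j φ μ ≡ 0ℚ) →
             ∀ μ → + weight μ ℤ.< + suc b → U.E (+ suc b) φ μ ≡ 0ℚ
      step b ih μ lt = *≡0⇒ (fromℕ-suc≢0 b) (trans (U-recurrence (suc b) (+ suc b) φ μ r ℤP.≤-refl)
        (trans (∑-cong (upTo (suc b)) term) (∑-zero (upTo (suc b)))))
        where
        term : ∀ i → -2α ℚ.* (∂weight (suc i) μ ℚ.* U.E (+ suc b ℤ.- + suc i) φ (decr (suc i) μ)) ≡ 0ℚ
        term i = by-cases (mult (suc i) μ ℕ.≟ 0)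
          where
          by-cases : Dec (mult (suc i) μ ≡ 0) → -2α ℚ.* (∂weight (suc i) μ ℚ.* U.E (+ suc b ℤ.- + suc i) φ (decr (suc i) μ)) ≡ 0ℚ
          by-cases (yes m≡0) = trans (cong (-2α ℚ.*_) (∂weight-zero (suc i) {μ} _ m≡0)) (ℚP.*-zeroʳ -2α)
          by-cases (no  m≢0) = trans (cong (λ x → -2α ℚ.* (∂weight (suc i) μ ℚ.* x)) (ih (+ suc b ℤ.- + suc i) (z-n<z (+ suc b) i) (decr (suc i) μ) lt′))
              (solve 2 (λ x y → x :* (y :* con 0ℚ) := con 0ℚ) refl -2α (∂weight (suc i) μ))
            where
            lem : ∀ (n w : ℤ) → n ℤ.+ w ℤ.- n ≡ w
            lem = ℤRing.solve-∀
            lt′ : + weight (decr (suc i) μ) ℤ.< + suc b ℤ.- + suc i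
            lt′ = subst (ℤ._< + suc b ℤ.- + suc i) (trans (cong (λ w → + w ℤ.- + suc i) (sym (weight-decr i μ m≢0))) (lem (+ suc i) _))
                  (ℤP.+-monoˡ-< (ℤ.- + suc i) lt)

    exponent : ℕ → ℤ → ℕ → ℤ
    exponent k t b = (+ k) ℤ.+ (+ b) ℤ.- (t ℤ.+ (+ 1)) ℤ.* (+ α)

    termOfX-dual : ∀ k t v b φ → ⟪ φ , termOfX α k t v b ⟫ ≡ ⟪ U.E (+ b) (H.E (exponent k t b) φ) , v ⟫
    termOfX-dual k t v b φ = by-cases (exponent k t b) refl
      where
      by-cases : ∀ z → exponent k t b ≡ z → ⟪ φ , termOfX α k t v b ⟫ ≡ ⟪ U.E (+ b) (H.E (exponent k t b) φ) , v ⟫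
      by-cases (+ j) e = begin
        ⟪ φ , termOfX α k t v b ⟫               ≡⟨ cong (λ u → ⟪ φ , u ⟫) (termOfX-pos α k t v b j e) ⟩
        ⟪ φ , Eminus α j (Eplus α b v) ⟫         ≡⟨ H.expCoeff-dual j φ (Eplus α b v) ⟩
        ⟪ H.E (+ j) φ , Eplus α b v ⟫            ≡⟨ U.expCoeff-dual b (H.E (+ j) φ) v ⟩
        ⟪ U.E (+ b) (H.E (+ j) φ) , v ⟫          ≡⟨ cong (λ z → ⟪ U.E (+ b) (H.E z φ) , v ⟫) e ⟨
        ⟪ U.E (+ b) (H.E (exponent k t b) φ) , v ⟫ ∎
      by-cases -[1+ n ] e = begin
        ⟪ φ , termOfX α k t v b ⟫               ≡⟨ cong (λ u → ⟪ φ , u ⟫) (termOfX-neg α k t v b n e) ⟩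
        0ℚ                                       ≡⟨ trans (∑-cong v (λ { (c , μ) → ℚP.*-zeroʳ c })) (∑-zero v) ⟨
        ⟪ (λ _ → 0ℚ) , v ⟫                       ≡⟨ pairing-cong v (lin-zero (U.E-linear (+ b)) (λ ν → refl)) ⟨
        ⟪ U.E (+ b) (H.E -[1+ n ] φ) , v ⟫       ≡⟨ cong (λ z → ⟪ U.E (+ b) (H.E z φ) , v ⟫) e ⟨
        ⟪ U.E (+ b) (H.E (exponent k t b) φ) , v ⟫ ∎

    pairing-U-large : ∀ {φ} → Resp φ → ∀ b v → maxWeight v ℕ.< b → ⟪ U.E (+ b) φ , v ⟫ ≡ 0ℚ
    pairing-U-large r b []            lt = refl
    pairing-U-large {φ} r b ((c , μ) ∷ v) lt = trans (cong₂ ℚ._+_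
        (trans (cong (c ℚ.*_) (U-above-weight r (+ b) μ (ℤ.+<+ (ℕP.≤-<-trans (ℕP.m≤m⊔n (weight μ) (maxWeight v)) lt)))) (ℚP.*-zeroʳ c))
        (pairing-U-large r b v (ℕP.≤-<-trans (ℕP.m≤n⊔m (weight μ) (maxWeight v)) lt)))
      (ℚP.+-identityʳ 0ℚ)

    -- Any `B` beyond `maxWeight v` may replace the cut-off built into `Xneg`, so that different
    -- vectors can be expanded over one range.
    Xneg-dual : ∀ k t v {φ} → Resp φ → ∀ B → maxWeight v ℕ.< B →
      ⟪ φ , Xneg α k t v ⟫ ≡ ∑ (upTo B) (λ b → ⟪ U.E (+ b) (H.E (exponent k t b) φ) , v ⟫)
    Xneg-dual k t v {φ} r B lt = begin
      ⟪ φ , Xneg α k t v ⟫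
        ≡⟨ ∑-concatMap (termOfX α k t v) (upTo (suc (maxWeight v))) _ ⟩
      ∑ (upTo (suc (maxWeight v))) (λ b → ⟪ φ , termOfX α k t v b ⟫)
        ≡⟨ ∑-cong (upTo (suc (maxWeight v))) (λ b → termOfX-dual k t v b φ) ⟩
      ∑ (upTo (suc (maxWeight v))) (λ b → ⟪ U.E (+ b) (H.E (exponent k t b) φ) , v ⟫)
        ≡⟨ ∑-upTo-extend {m = suc (maxWeight v)} {n = B} _ lt (λ b le → pairing-U-large (H.E-resp (exponent k t b) r) b v le) ⟨
      ∑ (upTo B) (λ b → ⟪ U.E (+ b) (H.E (exponent k t b) φ) , v ⟫) ∎

    -- The degree is tested by functionals because an `FVec` may contain terms that cancel.
    Homogeneous : ℤ → FVec → Set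
    Homogeneous z v = ∀ {φ} → Resp φ → VanishesAt φ z → ⟪ φ , v ⟫ ≡ 0ℚ

    -- The term for `b` lowers the degree by `b` and raises it by `exponent k t b`, which contains
    -- `b` again, so `b` drops out.
    Xneg-homogeneous : ∀ k t v z → Homogeneous z v → Homogeneous (z ℤ.+ + k ℤ.- (t ℤ.+ + 1) ℤ.* + α) (Xneg α k t v)
    Xneg-homogeneous k t v z hom {φ} r vφ = trans (Xneg-dual k t v r (suc (maxWeight v)) ℕP.≤-refl)
      (trans (∑-cong (upTo (suc (maxWeight v))) (λ b → hom (U.E-resp (+ b) (H.E-resp (exponent k t b) r)) (UH-vanishes b)))
        (∑-zero (upTo (suc (maxWeight v)))))
      where
      lem : ∀ (w z k b s : ℤ) → z ≡ w ℤ.+ b → w ℤ.+ (k ℤ.+ b ℤ.- s) ≡ z ℤ.+ k ℤ.- s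
      lem w z k b s refl = lem′ w k b s
        where
        lem′ : ∀ (w k b s : ℤ) → w ℤ.+ (k ℤ.+ b ℤ.- s) ≡ w ℤ.+ b ℤ.+ k ℤ.- s
        lem′ = ℤRing.solve-∀
      UH-vanishes : ∀ b → VanishesAt (U.E (+ b) (H.E (exponent k t b) φ)) z
      UH-vanishes b μ e = U-vanishes (H.E-resp (exponent k t b) r) vH (+ b) μ (trans e (lem₂ z (+ b)))
        where
        lem₂ : ∀ (z b : ℤ) → z ≡ z ℤ.- b ℤ.+ b
        lem₂ = ℤRing.solve-∀
        vH : VanishesAt (H.E (exponent k t b) φ) (z ℤ.- + b)
        vH ν e′ = H-vanishes r vφ (exponent k t b) ν
          (lem (+ weight ν) z (+ k) (+ b) ((t ℤ.+ + 1) ℤ.* + α) (trans (lem₂ z (+ b)) (cong (ℤ._+ + b) (sym e′))))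

    -- The l operators meet the charges t, t + 2, ..., t + 2(l - 1), and the sum of charge + 1 over
    -- these is l(t + l). For t = -l it vanishes.
    Xprod-homogeneous : ∀ ks t → Homogeneous (+ sum ks ℤ.- + length ks ℤ.* (t ℤ.+ + length ks) ℤ.* + α) (Xprod α ks t vacuumVec)
    Xprod-homogeneous [] t {φ} r v = trans (ℚP.+-identityʳ (1ℚ ℚ.* φ [])) (trans (ℚP.*-identityˡ (φ [])) (v [] refl))
    Xprod-homogeneous (k ∷ ks) t = subst (λ z → Homogeneous z (Xprod α (k ∷ ks) t vacuumVec))
      (trans (cong (λ w → + sum ks ℤ.- l ℤ.* (t ℤ.+ l) ℤ.* + α ℤ.+ + k ℤ.- (t ℤ.+ w ℤ.+ + 1) ℤ.* + α) (ℤP.pos-* 2 (length ks)))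
        (lem (+ sum ks) (+ k) l t (+ α)))
      (Xneg-homogeneous k (t ℤ.+ + (2 ℕ.* length ks)) (Xprod α ks t vacuumVec) _ (Xprod-homogeneous ks t))
      where
      l = + length ks
      lem : ∀ (s k l t α : ℤ) → s ℤ.- l ℤ.* (t ℤ.+ l) ℤ.* α ℤ.+ k ℤ.- (t ℤ.+ + 2 ℤ.* l ℤ.+ + 1) ℤ.* α
        ≡ k ℤ.+ s ℤ.- (+ 1 ℤ.+ l) ℤ.* (t ℤ.+ (+ 1 ℤ.+ l)) ℤ.* α
      lem = ℤRing.solve-∀

    Xprod-vacuum-homogeneous : ∀ ks → Homogeneous (+ sum ks) (Xprod α ks (ℤ.- + length ks) vacuumVec)
    Xprod-vacuum-homogeneous ks = subst (λ z → Homogeneous z (Xprod α ks (ℤ.- + length ks) vacuumVec))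
      (lem (+ sum ks) (+ length ks) (+ α)) (Xprod-homogeneous ks (ℤ.- + length ks))
      where
      lem : ∀ (s l α : ℤ) → s ℤ.- l ℤ.* (ℤ.- l ℤ.+ l) ℤ.* α ≡ s
      lem = ℤRing.solve-∀

  -- Exchange relations at α = 1

  open Operators 0 hiding (module H; module U)
  module H = Operators.H 0
  module U = Operators.U 0

  -- At α = 1 the creation exponential is exp(Σ pₙzⁿ/n), so `H j` transposes multiplication by the
  -- complete symmetric function h_j. `U b` transposes the coefficient of z^(-b) in exp(-2 Σ ∂ₙz⁻ⁿ).
  H U : ℤ → Functional → Functional
  H = H.E
  U = U.E

  -- Transpose of multiplication by the power sum p_(n+1).
  P : ℕ → Functional → Functional
  P n φ μ = φ (incr (suc n) μ)

  P-resp : ∀ n {φ} → Resp φ → Resp (P n φ)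
  P-resp n r e = r (incr-cong n e)

  -2ℚ : ℚ
  -2ℚ = -2α

  H-rec : ∀ B z φ μ → Resp φ → z ℤ.≤ + B →
    toℚ z ℚ.* H z φ μ ≡ ∑ (upTo B) (λ i → H (z ℤ.- + suc i) φ (incr (suc i) μ))
  H-rec B z φ μ r le = trans (H-recurrence B z φ μ r le) (∑-cong (upTo B) (λ i → ℚP.*-identityˡ (H (z ℤ.- + suc i) φ (incr (suc i) μ))))

  lin-∑ : ∀ {T A} → Linear T → ∀ (xs : List A) (f : A → Functional) →
          T (λ ν → ∑ xs (λ x → f x ν)) ≗ λ μ → ∑ xs (λ x → T (f x) μ)
  lin-∑ {T} L xs f μ = begin
    T (λ ν → ∑ xs (λ x → f x ν)) μ          ≡⟨ lin-cong L (λ ν → ∑-cong xs (λ x → sym (ℚP.*-identityˡ (f x ν)))) μ ⟩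
    T (λ ν → ∑ xs (λ x → 1ℚ ℚ.* f x ν)) μ   ≡⟨ lin-sum L xs (λ _ → 1ℚ) f μ ⟩
    ∑ xs (λ x → 1ℚ ℚ.* T (f x) μ)           ≡⟨ ∑-cong xs (λ x → ℚP.*-identityˡ (T (f x) μ)) ⟩
    ∑ xs (λ x → T (f x) μ) ∎

  -- The translation p_n ↦ p_n - 2 z^{-n} effected by exp(-2 Σ ∂_n z^{-n}).
  U-P : ∀ n z {φ} → Resp φ → ∀ μ → P n (U z φ) μ ≡ U z (P n φ) μ ℚ.+ -2ℚ ℚ.* U (z ℤ.- + suc n) φ μ
  U-P n y {φ} r = ℤ-induction (λ z → ∀ μ → P n (U z φ) μ ≡ U z (P n φ) μ ℚ.+ -2ℚ ℚ.* U (z ℤ.- + suc n) φ μ) neg base step y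
    where
    neg : ∀ z → z ℤ.< + 0 → ∀ μ → P n (U z φ) μ ≡ U z (P n φ) μ ℚ.+ -2ℚ ℚ.* U (z ℤ.- + suc n) φ μ
    neg z lt μ = trans (U.E-negative φ lt (incr (suc n) μ)) (sym (cong₂ (λ x y → x ℚ.+ -2ℚ ℚ.* y)
      (U.E-negative (P n φ) lt μ) (U.E-negative φ (minus-negative n (ℤP.<⇒≤ lt)) μ)))
    base : ∀ μ → P n (U (+ 0) φ) μ ≡ U (+ 0) (P n φ) μ ℚ.+ -2ℚ ℚ.* U (+ 0 ℤ.- + suc n) φ μ
    base μ = trans (U.E-zero φ (incr (suc n) μ)) (sym (trans (cong₂ (λ x y → x ℚ.+ -2ℚ ℚ.* y)
      (U.E-zero (P n φ) μ) (U.E-negative φ (minus-negative {+ 0} n ℤP.≤-refl) μ)) (ℚP.+-identityʳ (P n φ μ))))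
    step : ∀ b → (∀ z → z ℤ.< + suc b → ∀ μ → P n (U z φ) μ ≡ U z (P n φ) μ ℚ.+ -2ℚ ℚ.* U (z ℤ.- + suc n) φ μ) →
           ∀ μ → P n (U (+ suc b) φ) μ ≡ U (+ suc b) (P n φ) μ ℚ.+ -2ℚ ℚ.* U (+ suc b ℤ.- + suc n) φ μ
    step b ih μ = *-cancelˡ (fromℕ-suc≢0 b) (begin
      toℚ z ℚ.* P n (U z φ) μ
        ≡⟨ U-recurrence B z φ (incr (suc n) μ) r z≤B ⟩
      ∑ (upTo B) (λ i → -2ℚ ℚ.* (∂weight (suc i) (incr (suc n) μ) ℚ.* U (z ℤ.- + suc i) φ (decr (suc i) (incr (suc n) μ))))
        ≡⟨ ∑-cong (upTo B) term ⟩
      ∑ (upTo B) (λ i → main i ℚ.+ (-2ℚ ℚ.* shifted i ℚ.+ δ (i ℕ.≟ n)))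
        ≡⟨ trans (∑-+ (upTo B) main _) (cong (∑ (upTo B) main ℚ.+_) (trans (∑-+ (upTo B) (λ i → -2ℚ ℚ.* shifted i) _)
             (cong₂ ℚ._+_ (∑-* (upTo B) -2ℚ shifted) (trans (∑-single (λ i → δ (i ℕ.≟ n)) (upTo⁺ B) (∈-upTo⁺ n<B) (λ i ne → δ-no (i ℕ.≟ n) ne)) (δ-yes (n ℕ.≟ n)))))) ⟩
      ∑ (upTo B) main ℚ.+ (-2ℚ ℚ.* ∑ (upTo B) shifted ℚ.+ -2ℚ ℚ.* (fromℕ (suc n) ℚ.* X))
        ≡⟨ cong₂ (λ x y → x ℚ.+ (-2ℚ ℚ.* y ℚ.+ -2ℚ ℚ.* (fromℕ (suc n) ℚ.* X)))
             (sym (U-recurrence B z (P n φ) μ (P-resp n r) z≤B))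
             (trans (∑-cong (upTo B) (λ i → cong (λ y → -2ℚ ℚ.* (∂weight (suc i) μ ℚ.* U y φ (decr (suc i) μ))) (swap-subtractions z (+ suc i) (+ suc n))))
               (sym (U-recurrence B (z ℤ.- + suc n) φ μ r (ℤP.≤-trans (ℤP.<⇒≤ (z-n<z z n)) z≤B)))) ⟩
      toℚ z ℚ.* U z (P n φ) μ ℚ.+ (-2ℚ ℚ.* (toℚ (z ℤ.- + suc n) ℚ.* X) ℚ.+ -2ℚ ℚ.* (fromℕ (suc n) ℚ.* X))
        ≡⟨ solve 6 (λ z y d s n x → z :* y :+ (d :* (s :* x) :+ d :* (n :* x)) := z :* y :+ (s :+ n) :* (d :* x)) refl
             (toℚ z) (U z (P n φ) μ) -2ℚ (toℚ (z ℤ.- + suc n)) (fromℕ (suc n)) X ⟩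
      toℚ z ℚ.* U z (P n φ) μ ℚ.+ (toℚ (z ℤ.- + suc n) ℚ.+ toℚ (+ suc n)) ℚ.* (-2ℚ ℚ.* X)
        ≡⟨ cong (λ s → toℚ z ℚ.* U z (P n φ) μ ℚ.+ s ℚ.* (-2ℚ ℚ.* X)) (trans (sym (toℚ-+ (z ℤ.- + suc n) (+ suc n))) (cong toℚ (cancel z (+ suc n)))) ⟩
      toℚ z ℚ.* U z (P n φ) μ ℚ.+ toℚ z ℚ.* (-2ℚ ℚ.* X)
        ≡⟨ ℚP.*-distribˡ-+ (toℚ z) (U z (P n φ) μ) (-2ℚ ℚ.* X) ⟨
      toℚ z ℚ.* (U z (P n φ) μ ℚ.+ -2ℚ ℚ.* X) ∎)
      where
      z : ℤ
      z = + suc b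
      -- Large enough for the recurrences and for the exceptional index `n` to occur in the range.
      B : ℕ
      B = suc (b ℕ.+ n)
      z≤B : z ℤ.≤ + B
      z≤B = ℤ.+≤+ (ℕ.s≤s (ℕP.m≤m+n b n))
      n<B : n ℕ.< B
      n<B = ℕ.s≤s (ℕP.m≤n+m n b)
      cancel : ∀ (z x : ℤ) → z ℤ.- x ℤ.+ x ≡ z
      cancel = ℤRing.solve-∀
      X = U (z ℤ.- + suc n) φ μ
      main shifted : ℕ → ℚ
      main i    = -2ℚ ℚ.* (∂weight (suc i) μ ℚ.* U (z ℤ.- + suc i) (P n φ) (decr (suc i) μ))
      shifted i = -2ℚ ℚ.* (∂weight (suc i) μ ℚ.* U (z ℤ.- + suc i ℤ.- + suc n) φ (decr (suc i) μ))
      -- The extra term of the product rule: the derivative with respect to p_(n+1) hits the new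
      -- factor itself.
      δ : ∀ {i} → Dec (i ≡ n) → ℚ
      δ (yes _) = -2ℚ ℚ.* (fromℕ (suc n) ℚ.* X)
      δ (no _)  = 0ℚ
      δ-yes : (D : Dec (n ≡ n)) → δ D ≡ -2ℚ ℚ.* (fromℕ (suc n) ℚ.* X)
      δ-yes (yes _) = refl
      δ-yes (no ne) = ⊥-elim (ne refl)
      δ-no : ∀ {i} (D : Dec (i ≡ n)) → i ≢ n → δ D ≡ 0ℚ
      δ-no (yes e) ne = ⊥-elim (ne e)
      δ-no (no _)  ne = refl
      combine : ∀ i → -2ℚ ℚ.* (∂weight (suc i) μ ℚ.* (U (z ℤ.- + suc i) (P n φ) (decr (suc i) μ) ℚ.+ -2ℚ ℚ.* U (z ℤ.- + suc i ℤ.- + suc n) φ (decr (suc i) μ)))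
                ≡ main i ℚ.+ -2ℚ ℚ.* shifted i
      combine i = solve 4 (λ d w y s → d :* (w :* (y :+ d :* s)) := d :* (w :* y) :+ d :* (d :* (w :* s))) refl
        -2ℚ (∂weight (suc i) μ) (U (z ℤ.- + suc i) (P n φ) (decr (suc i) μ)) (U (z ℤ.- + suc i ℤ.- + suc n) φ (decr (suc i) μ))
      -- The induction hypothesis applies to arguments of the form `incr (suc n) ν`. If `μ` has no
      -- part n + 1 it is not of this form, but then the weight in front is zero.
      diagonal : Dec (mult (suc n) μ ≡ 0) → ∂weight (suc n) μ ℚ.* X ≡
        ∂weight (suc n) μ ℚ.* (U (z ℤ.- + suc n) (P n φ) (decr (suc n) μ) ℚ.+ -2ℚ ℚ.* U (z ℤ.- + suc n ℤ.- + suc n) φ (decr (suc n) μ))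
      diagonal (yes m≡0) = trans (∂weight-zero (suc n) {μ} _ m≡0) (sym (∂weight-zero (suc n) {μ} _ m≡0))
      diagonal (no m≢0)  = cong (∂weight (suc n) μ ℚ.*_) (trans (U.E-resp (z ℤ.- + suc n) r (≃-sym (incr-decr-same n μ m≢0)))
        (ih (z ℤ.- + suc n) (z-n<z z n) (decr (suc n) μ)))
      by-cases : ∀ i (D : Dec (i ≡ n)) → -2ℚ ℚ.* (∂weight (suc i) (incr (suc n) μ) ℚ.* U (z ℤ.- + suc i) φ (decr (suc i) (incr (suc n) μ)))
                 ≡ main i ℚ.+ (-2ℚ ℚ.* shifted i ℚ.+ δ D)
      by-cases i (yes refl) = begin
        -2ℚ ℚ.* (∂weight (suc i) (incr (suc i) μ) ℚ.* U (z ℤ.- + suc i) φ (decr (suc i) (incr (suc i) μ)))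
          ≡⟨ cong₂ (λ m x → -2ℚ ℚ.* (fromℕ (suc i) ℚ.* m ℚ.* x)) (trans (cong fromℕ (mult-incr-same i μ)) (fromℕ-suc (mult (suc i) μ)))
               (U.E-resp (z ℤ.- + suc i) r (decr-incr-same i μ)) ⟩
        -2ℚ ℚ.* (fromℕ (suc i) ℚ.* (1ℚ ℚ.+ fromℕ (mult (suc i) μ)) ℚ.* X)
          ≡⟨ solve 4 (λ d s m x → d :* (s :* (con 1ℚ :+ m) :* x) := d :* (s :* m :* x) :+ d :* (s :* x)) refl -2ℚ (fromℕ (suc i)) (fromℕ (mult (suc i) μ)) X ⟩
        -2ℚ ℚ.* (∂weight (suc i) μ ℚ.* X) ℚ.+ -2ℚ ℚ.* (fromℕ (suc i) ℚ.* X)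
          ≡⟨ cong (λ y → -2ℚ ℚ.* y ℚ.+ -2ℚ ℚ.* (fromℕ (suc i) ℚ.* X)) (diagonal (mult (suc i) μ ℕ.≟ 0)) ⟩
        -2ℚ ℚ.* (∂weight (suc i) μ ℚ.* (U (z ℤ.- + suc i) (P n φ) (decr (suc i) μ) ℚ.+ -2ℚ ℚ.* U (z ℤ.- + suc i ℤ.- + suc n) φ (decr (suc i) μ))) ℚ.+ -2ℚ ℚ.* (fromℕ (suc i) ℚ.* X)
          ≡⟨ cong (ℚ._+ -2ℚ ℚ.* (fromℕ (suc i) ℚ.* X)) (combine i) ⟩
        main i ℚ.+ -2ℚ ℚ.* shifted i ℚ.+ -2ℚ ℚ.* (fromℕ (suc i) ℚ.* X)
          ≡⟨ ℚP.+-assoc (main i) (-2ℚ ℚ.* shifted i) _ ⟩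
        main i ℚ.+ (-2ℚ ℚ.* shifted i ℚ.+ -2ℚ ℚ.* (fromℕ (suc i) ℚ.* X)) ∎
      by-cases i (no i≢n) = begin
        -2ℚ ℚ.* (∂weight (suc i) (incr (suc n) μ) ℚ.* U (z ℤ.- + suc i) φ (decr (suc i) (incr (suc n) μ)))
          ≡⟨ cong₂ (λ m x → -2ℚ ℚ.* (fromℕ (suc i) ℚ.* m ℚ.* x)) (cong fromℕ (mult-incr-other i n μ i≢n))
               (trans (U.E-resp (z ℤ.- + suc i) r (decr-incr-other i n μ i≢n)) (ih (z ℤ.- + suc i) (z-n<z z i) (decr (suc i) μ))) ⟩
        -2ℚ ℚ.* (∂weight (suc i) μ ℚ.* (U (z ℤ.- + suc i) (P n φ) (decr (suc i) μ) ℚ.+ -2ℚ ℚ.* U (z ℤ.- + suc i ℤ.- + suc n) φ (decr (suc i) μ)))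
          ≡⟨ combine i ⟩
        main i ℚ.+ -2ℚ ℚ.* shifted i
          ≡⟨ cong (main i ℚ.+_) (ℚP.+-identityʳ (-2ℚ ℚ.* shifted i)) ⟨
        main i ℚ.+ (-2ℚ ℚ.* shifted i ℚ.+ 0ℚ) ∎
      term : ∀ i → -2ℚ ℚ.* (∂weight (suc i) (incr (suc n) μ) ℚ.* U (z ℤ.- + suc i) φ (decr (suc i) (incr (suc n) μ)))
             ≡ main i ℚ.+ (-2ℚ ℚ.* shifted i ℚ.+ δ (i ℕ.≟ n))
      term i = by-cases i (i ℕ.≟ n)

  -- In `H-U` the corrections coming from `U-P` add up to second differences of one sequence `f`,
  -- which leave only boundary terms.
  telescope : ∀ B (f : ℕ → ℚ) →
    ∑ (upTo B) (λ i → f (1 ℕ.+ i) ℚ.+ -2ℚ ℚ.* f (2 ℕ.+ i) ℚ.+ f (3 ℕ.+ i)) ≡ f 1 ℚ.- f 2 ℚ.- f (1 ℕ.+ B) ℚ.+ f (2 ℕ.+ B)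
  telescope zero    f = solve 2 (λ x y → con 0ℚ := x :- y :- x :+ y) refl (f 1) (f 2)
  telescope (suc B) f = trans (∑-upTo-last B _) (trans (cong (ℚ._+ (f (1 ℕ.+ B) ℚ.+ -2ℚ ℚ.* f (2 ℕ.+ B) ℚ.+ f (3 ℕ.+ B))) (telescope B f))
    (solve 5 (λ x y u v w → x :- y :- u :+ v :+ (u :+ con -2ℚ :* v :+ w) := x :- y :- v :+ w) refl (f 1) (f 2) (f (1 ℕ.+ B)) (f (2 ℕ.+ B)) (f (3 ℕ.+ B))))

  -- exp(-2 Σ ∂_n z^{-n}) multiplies the generating function of the h_j, evaluated at w, by (1 - w/z)².
  H-U : ∀ j b {φ} → Resp φ → ∀ μ →
    H j (U b φ) μ ≡ U b (H j φ) μ ℚ.+ -2ℚ ℚ.* U (b ℤ.- + 1) (H (j ℤ.- + 1) φ) μ ℚ.+ U (b ℤ.- + 2) (H (j ℤ.- + 2) φ) μ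
  H-U y b {φ} r = ℤ-induction Q neg base step y
    where
    Q : ℤ → Set
    Q j = ∀ μ → H j (U b φ) μ ≡ U b (H j φ) μ ℚ.+ -2ℚ ℚ.* U (b ℤ.- + 1) (H (j ℤ.- + 1) φ) μ ℚ.+ U (b ℤ.- + 2) (H (j ℤ.- + 2) φ) μ
    UH-negative : ∀ b {j} → j ℤ.< + 0 → ∀ μ → U b (H j φ) μ ≡ 0ℚ
    UH-negative b lt μ = lin-zero (U.E-linear b) (H.E-negative φ lt) μ
    sum≡ : ∀ {x y z x′ y′ z′ : ℚ} → x ≡ x′ → y ≡ y′ → z ≡ z′ → x ℚ.+ -2ℚ ℚ.* y ℚ.+ z ≡ x′ ℚ.+ -2ℚ ℚ.* y′ ℚ.+ z′
    sum≡ refl refl refl = refl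
    neg : ∀ j → j ℤ.< + 0 → Q j
    neg j lt μ = trans (H.E-negative {j} (U b φ) lt μ) (sym (sum≡ (UH-negative b lt μ)
      (UH-negative (b ℤ.- + 1) {j ℤ.- + 1} (minus-negative 0 (ℤP.<⇒≤ lt)) μ)
      (UH-negative (b ℤ.- + 2) {j ℤ.- + 2} (minus-negative 1 (ℤP.<⇒≤ lt)) μ)))
    base : Q (+ 0)
    base μ = trans (H.E-zero (U b φ) μ) (sym (trans (sum≡ (lin-cong (U.E-linear b) (H.E-zero φ) μ)
      (UH-negative (b ℤ.- + 1) {+ 0 ℤ.- + 1} ℤ.-<+ μ)
      (UH-negative (b ℤ.- + 2) {+ 0 ℤ.- + 2} ℤ.-<+ μ))
      (solve 2 (λ x d → x :+ d :* con 0ℚ :+ con 0ℚ := x) refl (U b φ μ) -2ℚ)))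
    step : ∀ k → (∀ j → j ℤ.< + suc k → Q j) → Q (+ suc k)
    step k ih μ = *-cancelˡ (fromℕ-suc≢0 k) (begin
      toℚ j ℚ.* H j (U b φ) μ
        ≡⟨ H-rec B j (U b φ) μ (U.E-resp b r) ℤP.≤-refl ⟩
      ∑ (upTo B) (λ i → H (j ℤ.- + suc i) (U b φ) (incr (suc i) μ))
        ≡⟨ ∑-cong (upTo B) term ⟩
      ∑ (upTo B) (λ i → G 0 i ℚ.+ (-2ℚ ℚ.* G 1 i ℚ.+ (G 2 i ℚ.+ -2ℚ ℚ.* (f (1 ℕ.+ i) ℚ.+ -2ℚ ℚ.* f (2 ℕ.+ i) ℚ.+ f (3 ℕ.+ i)))))
        ≡⟨ trans (∑-+ (upTo B) (G 0) _) (cong (∑ (upTo B) (G 0) ℚ.+_) (trans (∑-+ (upTo B) (λ i → -2ℚ ℚ.* G 1 i) _)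
             (cong₂ ℚ._+_ (∑-* (upTo B) -2ℚ (G 1)) (trans (∑-+ (upTo B) (G 2) _)
               (cong (∑ (upTo B) (G 2) ℚ.+_) (trans (∑-* (upTo B) -2ℚ (λ i → f (1 ℕ.+ i) ℚ.+ -2ℚ ℚ.* f (2 ℕ.+ i) ℚ.+ f (3 ℕ.+ i))) (cong (-2ℚ ℚ.*_) (telescope B f)))))))) ⟩
      ∑ (upTo B) (G 0) ℚ.+ (-2ℚ ℚ.* ∑ (upTo B) (G 1) ℚ.+ (∑ (upTo B) (G 2) ℚ.+ -2ℚ ℚ.* (f 1 ℚ.- f 2 ℚ.- f (1 ℕ.+ B) ℚ.+ f (2 ℕ.+ B))))
        ≡⟨ cong₂ (λ x y → x ℚ.+ (-2ℚ ℚ.* ∑ (upTo B) (G 1) ℚ.+ y)) (ΣG 0)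
             (cong₂ ℚ._+_ (ΣG 2) (cong₂ (λ x y → -2ℚ ℚ.* (f 1 ℚ.- f 2 ℚ.- x ℚ.+ y)) f-top₁ f-top₂)) ⟩
      toℚ (j ℤ.- + 0) ℚ.* f 0 ℚ.+ (-2ℚ ℚ.* ∑ (upTo B) (G 1) ℚ.+ (toℚ (j ℤ.- + 2) ℚ.* f 2 ℚ.+ -2ℚ ℚ.* (f 1 ℚ.- f 2 ℚ.- 0ℚ ℚ.+ 0ℚ)))
        ≡⟨ cong (λ x → toℚ (j ℤ.- + 0) ℚ.* f 0 ℚ.+ (-2ℚ ℚ.* x ℚ.+ (toℚ (j ℤ.- + 2) ℚ.* f 2 ℚ.+ -2ℚ ℚ.* (f 1 ℚ.- f 2 ℚ.- 0ℚ ℚ.+ 0ℚ)))) (ΣG 1) ⟩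
      toℚ (j ℤ.- + 0) ℚ.* f 0 ℚ.+ (-2ℚ ℚ.* (toℚ (j ℤ.- + 1) ℚ.* f 1) ℚ.+ (toℚ (j ℤ.- + 2) ℚ.* f 2 ℚ.+ -2ℚ ℚ.* (f 1 ℚ.- f 2 ℚ.- 0ℚ ℚ.+ 0ℚ)))
        ≡⟨ cong₂ (λ x y → toℚ (j ℤ.- + 0) ℚ.* f 0 ℚ.+ (-2ℚ ℚ.* (x ℚ.* f 1) ℚ.+ (y ℚ.* f 2 ℚ.+ -2ℚ ℚ.* (f 1 ℚ.- f 2 ℚ.- 0ℚ ℚ.+ 0ℚ))))
             (toℚ-+ j (ℤ.- + 1)) (toℚ-+ j (ℤ.- + 2)) ⟩
      toℚ (j ℤ.- + 0) ℚ.* f 0 ℚ.+ (-2ℚ ℚ.* ((toℚ j ℚ.+ toℚ (ℤ.- + 1)) ℚ.* f 1) ℚ.+ ((toℚ j ℚ.+ toℚ (ℤ.- + 2)) ℚ.* f 2 ℚ.+ -2ℚ ℚ.* (f 1 ℚ.- f 2 ℚ.- 0ℚ ℚ.+ 0ℚ)))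
        ≡⟨ cong (λ x → toℚ x ℚ.* f 0 ℚ.+ (-2ℚ ℚ.* ((toℚ j ℚ.+ toℚ (ℤ.- + 1)) ℚ.* f 1) ℚ.+ ((toℚ j ℚ.+ toℚ (ℤ.- + 2)) ℚ.* f 2 ℚ.+ -2ℚ ℚ.* (f 1 ℚ.- f 2 ℚ.- 0ℚ ℚ.+ 0ℚ)))) (z-z≡0 j) ⟩
      toℚ j ℚ.* f 0 ℚ.+ (-2ℚ ℚ.* ((toℚ j ℚ.+ toℚ (ℤ.- + 1)) ℚ.* f 1) ℚ.+ ((toℚ j ℚ.+ toℚ (ℤ.- + 2)) ℚ.* f 2 ℚ.+ -2ℚ ℚ.* (f 1 ℚ.- f 2 ℚ.- 0ℚ ℚ.+ 0ℚ)))
        -- The boundary term -2(f 1 - f 2) corrects the factors j - 1 and j - 2, which come from the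
        -- recurrences at the shifted indices, to j.
        ≡⟨ solve 4 (λ j x y z → j :* x :+ (con -2ℚ :* ((j :+ con (toℚ (ℤ.- + 1))) :* y) :+ ((j :+ con (toℚ (ℤ.- + 2))) :* z :+ con -2ℚ :* (y :- z :- con 0ℚ :+ con 0ℚ)))
             := j :* (x :+ con -2ℚ :* y :+ z)) refl (toℚ j) (f 0) (f 1) (f 2) ⟩
      toℚ j ℚ.* (f 0 ℚ.+ -2ℚ ℚ.* f 1 ℚ.+ f 2)
        ≡⟨ cong₂ (λ x y → toℚ j ℚ.* (U x (H y φ) μ ℚ.+ -2ℚ ℚ.* f 1 ℚ.+ f 2)) (z-z≡0 b) (z-z≡0 j) ⟩
      toℚ j ℚ.* (U b (H j φ) μ ℚ.+ -2ℚ ℚ.* f 1 ℚ.+ f 2) ∎)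
      where
      B : ℕ
      B = suc k
      j : ℤ
      j = + suc k
      f : ℕ → ℚ
      f s = U (b ℤ.- + s) (H (j ℤ.- + s) φ) μ
      G : ℕ → ℕ → ℚ
      G s i = U (b ℤ.- + s) (P i (H (j ℤ.- + s ℤ.- + suc i) φ)) μ
      ΣG : ∀ s → ∑ (upTo B) (G s) ≡ toℚ (j ℤ.- + s) ℚ.* f s
      ΣG s = begin
        ∑ (upTo B) (G s)
          ≡⟨ lin-∑ (U.E-linear (b ℤ.- + s)) (upTo B) (λ i → P i (H (j ℤ.- + s ℤ.- + suc i) φ)) μ ⟨
        U (b ℤ.- + s) (λ ν → ∑ (upTo B) (λ i → H (j ℤ.- + s ℤ.- + suc i) φ (incr (suc i) ν))) μ
          ≡⟨ lin-cong (U.E-linear (b ℤ.- + s)) (λ ν → H-rec B (j ℤ.- + s) φ ν r (ℤP.i≤j⇒i-k≤j (+ s) ℤP.≤-refl)) μ ⟨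
        U (b ℤ.- + s) (λ ν → toℚ (j ℤ.- + s) ℚ.* H (j ℤ.- + s) φ ν) μ
          ≡⟨ lin-scale (U.E-linear (b ℤ.- + s)) (toℚ (j ℤ.- + s)) (H (j ℤ.- + s) φ) μ ⟩
        toℚ (j ℤ.- + s) ℚ.* f s ∎
      below-zero : ∀ m → j ℤ.- + (suc m ℕ.+ B) ℤ.< + 0
      below-zero m = subst (ℤ._< + 0) (trans (lem j (+ suc m)) (cong (λ x → j ℤ.- x) (sym (ℤP.pos-+ (suc m) B)))) ℤ.-<+
        where
        lem : ∀ (j m : ℤ) → ℤ.- m ≡ j ℤ.- (m ℤ.+ j)
        lem = ℤRing.solve-∀
      f-top₁ : f (1 ℕ.+ B) ≡ 0ℚ
      f-top₁ = UH-negative (b ℤ.- + (1 ℕ.+ B)) (below-zero 0) μ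
      f-top₂ : f (2 ℕ.+ B) ≡ 0ℚ
      f-top₂ = UH-negative (b ℤ.- + (2 ℕ.+ B)) (below-zero 1) μ
      expand : ∀ s i → U (b ℤ.- + s) (H (j ℤ.- + suc i ℤ.- + s) φ) (incr (suc i) μ) ≡ G s i ℚ.+ -2ℚ ℚ.* f (suc s ℕ.+ i)
      expand s i = begin
        P i (U (b ℤ.- + s) (H (j ℤ.- + suc i ℤ.- + s) φ)) μ
          ≡⟨ cong (λ y → P i (U (b ℤ.- + s) (H y φ)) μ) (swap-subtractions j (+ suc i) (+ s)) ⟩
        P i (U (b ℤ.- + s) (H (j ℤ.- + s ℤ.- + suc i) φ)) μ
          ≡⟨ U-P i (b ℤ.- + s) (H.E-resp (j ℤ.- + s ℤ.- + suc i) r) μ ⟩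
        G s i ℚ.+ -2ℚ ℚ.* U (b ℤ.- + s ℤ.- + suc i) (H (j ℤ.- + s ℤ.- + suc i) φ) μ
          ≡⟨ cong₂ (λ x y → G s i ℚ.+ -2ℚ ℚ.* U x (H y φ) μ) (merge b) (merge j) ⟩
        G s i ℚ.+ -2ℚ ℚ.* f (suc s ℕ.+ i) ∎
        where
        lem : ∀ (z x y : ℤ) → z ℤ.- x ℤ.- (+ 1 ℤ.+ y) ≡ z ℤ.- (+ 1 ℤ.+ x ℤ.+ y)
        lem = ℤRing.solve-∀
        merge : ∀ z → z ℤ.- + s ℤ.- + suc i ≡ z ℤ.- + (suc s ℕ.+ i)
        merge z = trans (lem z (+ s) (+ i)) (cong (λ x → z ℤ.- x) (sym (ℤP.pos-+ (suc s) i)))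
      term : ∀ i → H (j ℤ.- + suc i) (U b φ) (incr (suc i) μ) ≡
        G 0 i ℚ.+ (-2ℚ ℚ.* G 1 i ℚ.+ (G 2 i ℚ.+ -2ℚ ℚ.* (f (1 ℕ.+ i) ℚ.+ -2ℚ ℚ.* f (2 ℕ.+ i) ℚ.+ f (3 ℕ.+ i))))
      term i = begin
        H (j ℤ.- + suc i) (U b φ) (incr (suc i) μ)
          ≡⟨ ih (j ℤ.- + suc i) (z-n<z j i) (incr (suc i) μ) ⟩
        U b (H (j ℤ.- + suc i) φ) ν ℚ.+ -2ℚ ℚ.* U (b ℤ.- + 1) (H (j ℤ.- + suc i ℤ.- + 1) φ) ν ℚ.+ U (b ℤ.- + 2) (H (j ℤ.- + suc i ℤ.- + 2) φ) ν
          ≡⟨ cong₂ (λ x y → U x (H y φ) ν ℚ.+ -2ℚ ℚ.* U (b ℤ.- + 1) (H (j ℤ.- + suc i ℤ.- + 1) φ) ν ℚ.+ U (b ℤ.- + 2) (H (j ℤ.- + suc i ℤ.- + 2) φ) ν)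
               (z-z≡0 b) (z-z≡0 (j ℤ.- + suc i)) ⟨
        U (b ℤ.- + 0) (H (j ℤ.- + suc i ℤ.- + 0) φ) ν ℚ.+ -2ℚ ℚ.* U (b ℤ.- + 1) (H (j ℤ.- + suc i ℤ.- + 1) φ) ν ℚ.+ U (b ℤ.- + 2) (H (j ℤ.- + suc i ℤ.- + 2) φ) ν
          ≡⟨ cong₂ ℚ._+_ (cong₂ (λ x y → x ℚ.+ -2ℚ ℚ.* y) (expand 0 i) (expand 1 i)) (expand 2 i) ⟩
        (G 0 i ℚ.+ -2ℚ ℚ.* f (1 ℕ.+ i)) ℚ.+ -2ℚ ℚ.* (G 1 i ℚ.+ -2ℚ ℚ.* f (2 ℕ.+ i)) ℚ.+ (G 2 i ℚ.+ -2ℚ ℚ.* f (3 ℕ.+ i))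
          ≡⟨ solve 7 (λ d x y z u v w → (x :+ d :* u) :+ d :* (y :+ d :* v) :+ (z :+ d :* w) := x :+ (d :* y :+ (z :+ d :* (u :+ d :* v :+ w)))) refl
               -2ℚ (G 0 i) (G 1 i) (G 2 i) (f (1 ℕ.+ i)) (f (2 ℕ.+ i)) (f (3 ℕ.+ i)) ⟩
        G 0 i ℚ.+ (-2ℚ ℚ.* G 1 i ℚ.+ (G 2 i ℚ.+ -2ℚ ℚ.* (f (1 ℕ.+ i) ℚ.+ -2ℚ ℚ.* f (2 ℕ.+ i) ℚ.+ f (3 ℕ.+ i)))) ∎
        where
        ν = incr (suc i) μ

  -- The Dyson product

  infixl 6 _⊞_
  _⊞_ : ∀ {l} → Vec ℤ l → Vec ℤ l → Vec ℤ l
  _⊞_ = zipWith ℤ._+_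

  ⊞-assoc : ∀ {l} (u v w : Vec ℤ l) → (u ⊞ v) ⊞ w ≡ u ⊞ (v ⊞ w)
  ⊞-assoc = VecP.zipWith-assoc ℤP.+-assoc

  ⊞-comm : ∀ {l} (u v : Vec ℤ l) → u ⊞ v ≡ v ⊞ u
  ⊞-comm = VecP.zipWith-comm ℤP.+-comm

  𝟎 : ∀ {l} → Vec ℤ l
  𝟎 {l} = replicate l (+ 0)

  ⊞-identityʳ : ∀ {l} (u : Vec ℤ l) → u ⊞ 𝟎 ≡ u
  ⊞-identityʳ = VecP.zipWith-identityʳ ℤP.+-identityʳ

  ⊟_ : ∀ {l} → Vec ℤ l → Vec ℤ l
  ⊟_ = Vec.map (ℤ.-_)

  ⊟-𝟎 : ∀ l → ⊟ 𝟎 {l} ≡ 𝟎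
  ⊟-𝟎 zero    = refl
  ⊟-𝟎 (suc l) = cong (+ 0 ∷_) (⊟-𝟎 l)

  ⊞-inverseˡ : ∀ {l} (u : Vec ℤ l) → (⊟ u) ⊞ u ≡ 𝟎
  ⊞-inverseˡ []      = refl
  ⊞-inverseˡ (x ∷ u) = cong₂ _∷_ (ℤP.+-inverseˡ x) (⊞-inverseˡ u)

  ⊞-swap : ∀ {l} (u v w : Vec ℤ l) → (u ⊞ v) ⊞ w ≡ (u ⊞ w) ⊞ v
  ⊞-swap u v w = trans (⊞-assoc u v w) (trans (cong (u ⊞_) (⊞-comm v w)) (sym (⊞-assoc u w v)))

  Fun : ℕ → Set
  Fun l = Vec ℤ l → ℚ

  -- z^τ - 2 + z^{-τ} = -(1 - z^τ)(1 - z^{-τ}), acting on functions of exponents.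
  difference : ∀ {l} → Vec ℤ l → Fun l → Fun l
  difference τ F κ = F (κ ⊞ τ) ℚ.+ -2ℚ ℚ.* F κ ℚ.+ F (κ ⊞ ⊟ τ)

  differences : ∀ {l} → List (Vec ℤ l) → Fun l → Fun l
  differences []       F = F
  differences (τ ∷ ts) F = differences ts (difference τ F)

  differences-cong : ∀ {l} (ts : List (Vec ℤ l)) {F G : Fun l} → (∀ κ → F κ ≡ G κ) → ∀ κ → differences ts F κ ≡ differences ts G κ
  differences-cong []       e κ = e κ
  differences-cong (τ ∷ ts) e κ = differences-cong ts (λ κ → cong₂ ℚ._+_ (cong₂ (λ x y → x ℚ.+ -2ℚ ℚ.* y) (e (κ ⊞ τ)) (e κ)) (e (κ ⊞ ⊟ τ))) κ

  differences-++ : ∀ {l} (ts us : List (Vec ℤ l)) F κ → differences (ts ++ us) F κ ≡ differences us (differences ts F) κ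
  differences-++ []       us F κ = refl
  differences-++ (τ ∷ ts) us F κ = differences-++ ts us (difference τ F) κ

  differences-zero : ∀ {l} (ts : List (Vec ℤ l)) κ → differences ts (λ _ → 0ℚ) κ ≡ 0ℚ
  differences-zero []       κ = refl
  differences-zero (τ ∷ ts) κ = differences-zero ts κ

  differences-combination : ∀ {l} (ts : List (Vec ℤ l)) q (F G : Fun l) κ →
    differences ts (λ κ → F κ ℚ.+ q ℚ.* G κ) κ ≡ differences ts F κ ℚ.+ q ℚ.* differences ts G κ
  differences-combination []       q F G κ = refl
  differences-combination (τ ∷ ts) q F G κ = trans
    (differences-cong ts (λ κ → solve 8 (λ a b c d e f q n → (a :+ q :* b) :+ n :* (c :+ q :* d) :+ (e :+ q :* f) := a :+ n :* c :+ e :+ q :* (b :+ n :* d :+ f)) refl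
      (F (κ ⊞ τ)) (G (κ ⊞ τ)) (F κ) (G κ) (F (κ ⊞ ⊟ τ)) (G (κ ⊞ ⊟ τ)) q -2ℚ) κ)
    (differences-combination ts q (difference τ F) (difference τ G) κ)

  differences-∑ : ∀ {l} {A : Set} (ts : List (Vec ℤ l)) (xs : List A) (F : A → Fun l) κ →
    differences ts (λ κ → ∑ xs (λ x → F x κ)) κ ≡ ∑ xs (λ x → differences ts (F x) κ)
  differences-∑ ts []       F κ = differences-zero ts κ
  differences-∑ ts (x ∷ xs) F κ = begin
    differences ts (λ κ → F x κ ℚ.+ ∑ xs (λ x → F x κ)) κ
      ≡⟨ differences-cong ts (λ κ → cong (F x κ ℚ.+_) (sym (ℚP.*-identityˡ _))) κ ⟩
    differences ts (λ κ → F x κ ℚ.+ 1ℚ ℚ.* ∑ xs (λ x → F x κ)) κ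
      ≡⟨ differences-combination ts 1ℚ (F x) (λ κ → ∑ xs (λ x → F x κ)) κ ⟩
    differences ts (F x) κ ℚ.+ 1ℚ ℚ.* differences ts (λ κ → ∑ xs (λ x → F x κ)) κ
      ≡⟨ cong (differences ts (F x) κ ℚ.+_) (trans (ℚP.*-identityˡ _) (differences-∑ ts xs F κ)) ⟩
    differences ts (F x) κ ℚ.+ ∑ xs (λ x → differences ts (F x) κ) ∎

  differences-translate : ∀ {l} (ts : List (Vec ℤ l)) ρ (F : Fun l) κ →
    differences ts (λ κ → F (κ ⊞ ρ)) κ ≡ differences ts F (κ ⊞ ρ)
  differences-translate []       ρ F κ = refl
  differences-translate (τ ∷ ts) ρ F κ = trans
    (differences-cong ts (λ κ → cong₂ (λ x y → F x ℚ.+ -2ℚ ℚ.* F (κ ⊞ ρ) ℚ.+ F y) (⊞-swap κ τ ρ) (⊞-swap κ (⊟ τ) ρ)) κ)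
    (differences-translate ts ρ (difference τ F) κ)

  insert₁ : ∀ {l} → ℤ → Vec ℤ (suc l) → Vec ℤ (suc (suc l))
  insert₁ κ (x ∷ v) = x ∷ κ ∷ v

  differences-0∷ : ∀ {l} (ts : List (Vec ℤ l)) F k κs → differences (map (+ 0 ∷_) ts) F (k ∷ κs) ≡ differences ts (λ κs → F (k ∷ κs)) κs
  differences-0∷ []       F k κs = refl
  differences-0∷ (τ ∷ ts) F k κs = trans (differences-0∷ ts (difference (+ 0 ∷ τ) F) k κs)
    (differences-cong ts (λ κs → cong₂ (λ x y → F (x ∷ (κs ⊞ τ)) ℚ.+ -2ℚ ℚ.* F (k ∷ κs) ℚ.+ F (y ∷ (κs ⊞ ⊟ τ))) (ℤP.+-identityʳ k) (ℤP.+-identityʳ k)) κs)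

  differences-insert₁ : ∀ {l} (ts : List (Vec ℤ (suc l))) F k v →
    differences (map (insert₁ (+ 0)) ts) F (insert₁ k v) ≡ differences ts (λ v → F (insert₁ k v)) v
  differences-insert₁ []       F k v = refl
  differences-insert₁ (τ ∷ ts) F k v = trans (differences-insert₁ ts (difference (insert₁ (+ 0) τ) F) k v)
    (differences-cong ts (λ v → cong₂ (λ x y → F x ℚ.+ -2ℚ ℚ.* F (insert₁ k v) ℚ.+ F y) (shift v τ (+ 0) (ℤP.+-identityʳ k)) (shift⁻ v τ)) v)
    where
    shift : ∀ {l} (v τ : Vec ℤ (suc l)) z → k ℤ.+ z ≡ k → insert₁ k v ⊞ insert₁ z τ ≡ insert₁ k (v ⊞ τ)
    shift (x ∷ v) (t ∷ τ) z e = cong (λ y → (x ℤ.+ t) ∷ y ∷ (v ⊞ τ)) e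
    shift⁻ : ∀ {l} (v τ : Vec ℤ (suc l)) → insert₁ k v ⊞ ⊟ insert₁ (+ 0) τ ≡ insert₁ k (v ⊞ ⊟ τ)
    shift⁻ (x ∷ v) (t ∷ τ) = cong (λ y → (x ℤ.+ ℤ.- t) ∷ y ∷ (v ⊞ ⊟ τ)) (ℤP.+-identityʳ k)

  -- The roots ε₀ - ε_j.
  firstRoots : ∀ l → List (Vec ℤ (suc l))
  firstRoots zero    = []
  firstRoots (suc l) = (+ 1 ∷ -[1+ 0 ] ∷ 𝟎) ∷ map (insert₁ (+ 0)) (firstRoots l)

  positiveRoots : ∀ l → List (Vec ℤ l)
  positiveRoots zero    = []
  positiveRoots (suc l) = firstRoots l ++ map (+ 0 ∷_) (positiveRoots l)

  -- φ ↦ φ(h_{κ₁} ⋯ h_{κ_l}).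
  e : ∀ {l} → Functional → Fun l
  e φ []       = φ []
  e φ (κ ∷ κs) = e (H κ φ) κs

  e-cong : ∀ {l} {φ ψ} → φ ≗ ψ → ∀ (κs : Vec ℤ l) → e φ κs ≡ e ψ κs
  e-cong eq []       = eq []
  e-cong eq (κ ∷ κs) = e-cong (lin-cong (H.E-linear κ) eq) κs

  e-linear-sum : ∀ {l} {A : Set} (xs : List A) (q : A → ℚ) (f : A → Functional) (κs : Vec ℤ l) →
    e (λ ν → ∑ xs (λ x → q x ℚ.* f x ν)) κs ≡ ∑ xs (λ x → q x ℚ.* e (f x) κs)
  e-linear-sum xs q f []       = refl
  e-linear-sum xs q f (κ ∷ κs) = trans (e-cong (lin-sum (H.E-linear κ) xs q f) κs) (e-linear-sum xs q (λ x → H κ (f x)) κs)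

  e-zero : ∀ {l} {φ} → φ ≗ (λ _ → 0ℚ) → ∀ (κs : Vec ℤ l) → e φ κs ≡ 0ℚ
  e-zero z κs = trans (e-cong z κs) (e-linear-sum {A = ℕ} [] (λ _ → 0ℚ) (λ _ _ → 0ℚ) κs)

  e-combination : ∀ {l} (φ ψ χ : Functional) q (κs : Vec ℤ l) →
    e (λ ν → φ ν ℚ.+ q ℚ.* ψ ν ℚ.+ χ ν) κs ≡ e φ κs ℚ.+ q ℚ.* e ψ κs ℚ.+ e χ κs
  e-combination φ ψ χ q κs =
    linear-combination (λ φ → e φ κs) (λ eq → e-cong eq κs) (λ xs → e-linear-sum xs proj₁ proj₂ κs) φ ψ χ q

  suc-minus-suc : ∀ b s → + suc b ℤ.- + suc s ≡ + b ℤ.- + s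
  suc-minus-suc b s = lem (+ b) (+ s)
    where
    lem : ∀ (b s : ℤ) → (+ 1 ℤ.+ b) ℤ.- (+ 1 ℤ.+ s) ≡ b ℤ.- s
    lem = ℤRing.solve-∀

  ∑-shift : ∀ (g : ℤ → ℚ) B s → g -[1+ s ] ≡ 0ℚ →
    ∑ (upTo (suc B)) (λ b → g (+ b ℤ.- + suc s)) ≡ ∑ (upTo B) (λ b → g (+ b ℤ.- + s))
  ∑-shift g B s z = begin
    ∑ (upTo (suc B)) (λ b → g (+ b ℤ.- + suc s))
      ≡⟨ ∑-upTo-suc B (λ b → g (+ b ℤ.- + suc s)) ⟩
    g -[1+ s ] ℚ.+ ∑ (upTo B) (λ b → g (+ suc b ℤ.- + suc s))
      ≡⟨ cong₂ ℚ._+_ z (∑-cong (upTo B) (λ b → cong g (suc-minus-suc b s))) ⟩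
    0ℚ ℚ.+ ∑ (upTo B) (λ b → g (+ b ℤ.- + s))
      ≡⟨ ℚP.+-identityˡ _ ⟩
    ∑ (upTo B) (λ b → g (+ b ℤ.- + s)) ∎

  ∑-shift₀ : ∀ (g : ℤ → ℚ) B → ∑ (upTo B) (λ b → g (+ b ℤ.- + 0)) ≡ ∑ (upTo B) (λ b → g (+ b))
  ∑-shift₀ g B = ∑-cong (upTo B) (λ b → cong g (z-z≡0 (+ b)))

  ∑-shift₁ : ∀ (g : ℤ → ℚ) B → g -[1+ 0 ] ≡ 0ℚ → ∑ (upTo (suc B)) (λ b → g (+ b ℤ.- + 1)) ≡ ∑ (upTo B) (λ b → g (+ b))
  ∑-shift₁ g B z = trans (∑-shift g B 0 z) (∑-shift₀ g B)

  ∑-shift₂ : ∀ (g : ℤ → ℚ) B → g -[1+ 0 ] ≡ 0ℚ → g -[1+ 1 ] ≡ 0ℚ →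
    ∑ (upTo (suc (suc B))) (λ b → g (+ b ℤ.- + 2)) ≡ ∑ (upTo B) (λ b → g (+ b))
  ∑-shift₂ g B z₁ z₂ = trans (∑-shift g (suc B) 1 z₂) (∑-shift₁ g B z₁)

  𝟏 : ∀ {l} → Vec ℤ l
  𝟏 {l} = replicate l (+ 1)

  -- By `H-U`, moving the annihilation part past h(z_j) costs (1 - z_j/z₀)². The shifts by l in the
  -- index and by 𝟏 in `κs` turn this into z₀/z_j - 2 + z_j/z₀, the difference for the root ε₀ -
  -- ε_j. Against the vacuum only `U (+ 0)` survives, and each of the l exchanges lowers the index
  -- by at most 2, whence the bound 2l.
  vertex-step : ∀ {l} (κs : Vec ℤ l) x {φ} → Resp φ → ∀ B → 2 ℕ.* l ℕ.< B →
    ∑ (upTo B) (λ b → e (U (+ b) (H (x ℤ.- + l ℤ.+ + b) φ)) (κs ⊞ 𝟏)) ≡ differences (firstRoots l) (e φ) (x ∷ κs)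
  vertex-step [] x {φ} r (suc B) lt = begin
    ∑ (upTo (suc B)) (λ b → U (+ b) (H (x ℤ.- + 0 ℤ.+ + b) φ) [])
      ≡⟨ ∑-upTo-suc B (λ b → U (+ b) (H (x ℤ.- + 0 ℤ.+ + b) φ) []) ⟩
    U (+ 0) (H (x ℤ.- + 0 ℤ.+ + 0) φ) [] ℚ.+ ∑ (upTo B) (λ b → U (+ suc b) (H (x ℤ.- + 0 ℤ.+ + suc b) φ) [])
      ≡⟨ cong₂ ℚ._+_ (trans (U.E-zero (H (x ℤ.- + 0 ℤ.+ + 0) φ) []) (cong (λ z → H z φ []) (trans (ℤP.+-identityʳ (x ℤ.- + 0)) (ℤP.+-identityʳ x))))
           (trans (∑-cong (upTo B) (λ b → U-above-weight (H.E-resp (x ℤ.- + 0 ℤ.+ + suc b) r) (+ suc b) [] (ℤ.+<+ (ℕ.s≤s ℕ.z≤n)))) (∑-zero (upTo B))) ⟩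
    H x φ [] ℚ.+ 0ℚ
      ≡⟨ ℚP.+-identityʳ (H x φ []) ⟩
    H x φ [] ∎
  vertex-step {suc l} (κ ∷ κs) x {φ} r B lt = go B lt
    where
    lt-pred : ∀ {B} → 2 ℕ.* suc l ℕ.< suc (suc B) → 2 ℕ.* l ℕ.< B
    lt-pred {B} lt = ℕP.≤-pred (ℕP.≤-pred (subst (λ n → suc n ℕ.≤ suc (suc B)) (ℕP.*-suc 2 l) lt))
    w : Vec ℤ l
    w = κs ⊞ 𝟏
    -- the s-th term of H-U, after reindexing by c = b - s
    g : ℕ → ℤ → ℚ
    g s c = e (U c (H ((x ℤ.+ (+ s ℤ.- + 1)) ℤ.- + l ℤ.+ c) (H (κ ℤ.+ + 1 ℤ.- + s) φ))) w
    g-negative : ∀ s n → g s -[1+ n ] ≡ 0ℚ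
    g-negative s n = e-zero (λ ν → refl) w
    ψ : ℕ → Functional
    ψ b = H (x ℤ.- + suc l ℤ.+ + b) φ
    reindex : ∀ s b → e (U (+ b ℤ.- + s) (H (κ ℤ.+ + 1 ℤ.- + s) (ψ b))) w ≡ g s (+ b ℤ.- + s)
    reindex s b = e-cong (lin-cong (U.E-linear (+ b ℤ.- + s)) (λ ν → trans
        (H.E-comm (κ ℤ.+ + 1 ℤ.- + s) (x ℤ.- + suc l ℤ.+ + b) r ν)
        (cong (λ z → H z (H (κ ℤ.+ + 1 ℤ.- + s) φ) ν) (lem x (+ l) (+ b) (+ s))))) w
      where
      lem : ∀ (x l b s : ℤ) → x ℤ.- (+ 1 ℤ.+ l) ℤ.+ b ≡ (x ℤ.+ (s ℤ.- + 1)) ℤ.- l ℤ.+ (b ℤ.- s)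
      lem = ℤRing.solve-∀
    term : ∀ b → e (U (+ b) (ψ b)) ((κ ∷ κs) ⊞ 𝟏) ≡ g 0 (+ b ℤ.- + 0) ℚ.+ -2ℚ ℚ.* g 1 (+ b ℤ.- + 1) ℚ.+ g 2 (+ b ℤ.- + 2)
    term b = begin
      e (H (κ ℤ.+ + 1) (U (+ b) (ψ b))) w
        ≡⟨ e-cong (H-U (κ ℤ.+ + 1) (+ b) (H.E-resp (x ℤ.- + suc l ℤ.+ + b) r)) w ⟩
      e (λ ν → U (+ b) (H (κ ℤ.+ + 1) (ψ b)) ν ℚ.+ -2ℚ ℚ.* U (+ b ℤ.- + 1) (H (κ ℤ.+ + 1 ℤ.- + 1) (ψ b)) ν
               ℚ.+ U (+ b ℤ.- + 2) (H (κ ℤ.+ + 1 ℤ.- + 2) (ψ b)) ν) w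
        ≡⟨ e-combination (U (+ b) (H (κ ℤ.+ + 1) (ψ b))) (U (+ b ℤ.- + 1) (H (κ ℤ.+ + 1 ℤ.- + 1) (ψ b))) (U (+ b ℤ.- + 2) (H (κ ℤ.+ + 1 ℤ.- + 2) (ψ b))) -2ℚ w ⟩
      e (U (+ b) (H (κ ℤ.+ + 1) (ψ b))) w ℚ.+ -2ℚ ℚ.* e (U (+ b ℤ.- + 1) (H (κ ℤ.+ + 1 ℤ.- + 1) (ψ b))) w
        ℚ.+ e (U (+ b ℤ.- + 2) (H (κ ℤ.+ + 1 ℤ.- + 2) (ψ b))) w
        ≡⟨ cong₂ ℚ._+_ (cong₂ (λ x y → x ℚ.+ -2ℚ ℚ.* y)
             (trans (cong₂ (λ x y → e (U x (H y (ψ b))) w) (sym (z-z≡0 (+ b))) (sym (z-z≡0 (κ ℤ.+ + 1)))) (reindex 0 b))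
             (reindex 1 b)) (reindex 2 b) ⟩
      g 0 (+ b ℤ.- + 0) ℚ.+ -2ℚ ℚ.* g 1 (+ b ℤ.- + 1) ℚ.+ g 2 (+ b ℤ.- + 2) ∎
    shifted : ∀ s y → differences (firstRoots l) (e (H y φ)) ((x ℤ.+ s) ∷ κs) ≡
              differences (firstRoots l) (λ v → e φ (insert₁ y (v ⊞ (s ∷ 𝟎)))) (x ∷ κs)
    shifted s y = begin
      differences (firstRoots l) (e (H y φ)) ((x ℤ.+ s) ∷ κs)
        ≡⟨ cong (λ v → differences (firstRoots l) (e (H y φ)) ((x ℤ.+ s) ∷ v)) (⊞-identityʳ κs) ⟨
      differences (firstRoots l) (e (H y φ)) ((x ∷ κs) ⊞ (s ∷ 𝟎))
        ≡⟨ differences-translate (firstRoots l) (s ∷ 𝟎) (e (H y φ)) (x ∷ κs) ⟨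
      differences (firstRoots l) (λ v → e (H y φ) (v ⊞ (s ∷ 𝟎))) (x ∷ κs)
        ≡⟨ differences-cong (firstRoots l) (λ v → swap-head (v ⊞ (s ∷ 𝟎))) (x ∷ κs) ⟩
      differences (firstRoots l) (λ v → e φ (insert₁ y (v ⊞ (s ∷ 𝟎)))) (x ∷ κs) ∎
      where
      swap-head : ∀ v → e (H y φ) v ≡ e φ (insert₁ y v)
      swap-head (z ∷ v) = e-cong (H.E-comm z y r) v
    go : ∀ B → 2 ℕ.* suc l ℕ.< B → ∑ (upTo B) (λ b → e (U (+ b) (ψ b)) ((κ ∷ κs) ⊞ 𝟏)) ≡
         differences (firstRoots (suc l)) (e φ) (x ∷ κ ∷ κs)
    go (suc zero) (ℕ.s≤s ())
    go (suc (suc B)) lt = begin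
      ∑ (upTo (2 ℕ.+ B)) (λ b → e (U (+ b) (ψ b)) ((κ ∷ κs) ⊞ 𝟏))
        ≡⟨ ∑-cong (upTo (2 ℕ.+ B)) term ⟩
      ∑ (upTo (2 ℕ.+ B)) (λ b → g 0 (+ b ℤ.- + 0) ℚ.+ -2ℚ ℚ.* g 1 (+ b ℤ.- + 1) ℚ.+ g 2 (+ b ℤ.- + 2))
        ≡⟨ trans (∑-+ (upTo (2 ℕ.+ B)) (λ b → g 0 (+ b ℤ.- + 0) ℚ.+ -2ℚ ℚ.* g 1 (+ b ℤ.- + 1)) (λ b → g 2 (+ b ℤ.- + 2)))
             (cong₂ ℚ._+_ (trans (∑-+ (upTo (2 ℕ.+ B)) (λ b → g 0 (+ b ℤ.- + 0)) (λ b → -2ℚ ℚ.* g 1 (+ b ℤ.- + 1)))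
               (cong₂ ℚ._+_ (∑-shift₀ (g 0) (2 ℕ.+ B))
                 (trans (∑-* (upTo (2 ℕ.+ B)) -2ℚ (λ b → g 1 (+ b ℤ.- + 1))) (cong (-2ℚ ℚ.*_) (∑-shift₁ (g 1) (suc B) (g-negative 1 0))))))
               (∑-shift₂ (g 2) B (g-negative 2 0) (g-negative 2 1))) ⟩
      ∑ (upTo (2 ℕ.+ B)) (λ b → g 0 (+ b)) ℚ.+ -2ℚ ℚ.* ∑ (upTo (1 ℕ.+ B)) (λ b → g 1 (+ b)) ℚ.+ ∑ (upTo B) (λ b → g 2 (+ b))
        ≡⟨ cong₂ ℚ._+_ (cong₂ (λ x y → x ℚ.+ -2ℚ ℚ.* y) (ih 0 (2 ℕ.+ B) (ℕP.≤-trans (lt-pred lt) (ℕP.m≤n+m B 2))) (ih 1 (1 ℕ.+ B) (ℕP.≤-trans (lt-pred lt) (ℕP.m≤n+m B 1))))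
             (ih 2 B (lt-pred lt)) ⟩
      D′ 0 ℚ.+ -2ℚ ℚ.* D′ 1 ℚ.+ D′ 2
        ≡⟨ solve 4 (λ x y z d → x :+ d :* y :+ z := z :+ d :* y :+ con 1ℚ :* x) refl (D′ 0) (D′ 1) (D′ 2) -2ℚ ⟩
      D′ 2 ℚ.+ -2ℚ ℚ.* D′ 1 ℚ.+ 1ℚ ℚ.* D′ 0
        ≡⟨ trans (differences-combination (firstRoots l) 1ℚ (λ v → G 2 v ℚ.+ -2ℚ ℚ.* G 1 v) (G 0) (x ∷ κs))
             (cong (ℚ._+ 1ℚ ℚ.* D′ 0) (differences-combination (firstRoots l) -2ℚ (G 2) (G 1) (x ∷ κs))) ⟨
      differences (firstRoots l) (λ v → G 2 v ℚ.+ -2ℚ ℚ.* G 1 v ℚ.+ 1ℚ ℚ.* G 0 v) (x ∷ κs)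
        ≡⟨ differences-cong (firstRoots l) collect (x ∷ κs) ⟩
      differences (firstRoots l) (λ v → difference (+ 1 ∷ -[1+ 0 ] ∷ 𝟎) (e φ) (insert₁ κ v)) (x ∷ κs)
        ≡⟨ differences-insert₁ (firstRoots l) (difference (+ 1 ∷ -[1+ 0 ] ∷ 𝟎) (e φ)) κ (x ∷ κs) ⟨
      differences (firstRoots (suc l)) (e φ) (x ∷ κ ∷ κs) ∎
      where
      -- Here `s = 2` raises the exponent of the first variable and lowers that of the second, and
      -- `s = 0` does the reverse. These are the translations by the root and its negative, so the
      -- sum is first reordered.
      G : ℕ → Fun (suc l)
      G s v = e φ (insert₁ (κ ℤ.+ + 1 ℤ.- + s) (v ⊞ ((+ s ℤ.- + 1) ∷ 𝟎)))
      D′ : ℕ → ℚ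
      D′ s = differences (firstRoots l) (G s) (x ∷ κs)
      ih : ∀ s B → 2 ℕ.* l ℕ.< B → ∑ (upTo B) (λ b → g s (+ b)) ≡ D′ s
      ih s B lt = trans (vertex-step κs (x ℤ.+ (+ s ℤ.- + 1)) (H.E-resp (κ ℤ.+ + 1 ℤ.- + s) r) B lt) (shifted (+ s ℤ.- + 1) (κ ℤ.+ + 1 ℤ.- + s))
      collect : ∀ v → G 2 v ℚ.+ -2ℚ ℚ.* G 1 v ℚ.+ 1ℚ ℚ.* G 0 v ≡ difference (+ 1 ∷ -[1+ 0 ] ∷ 𝟎) (e φ) (insert₁ κ v)
      collect (z ∷ v) = cong₂ ℚ._+_ (cong₂ (λ x y → x ℚ.+ -2ℚ ℚ.* y)
          (cong (λ y → e φ ((z ℤ.+ + 1) ∷ y ∷ (v ⊞ 𝟎))) (lem₂ κ))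
          (cong₂ (λ x y → e φ (x ∷ y)) (ℤP.+-identityʳ z) (cong₂ _∷_ (lem₁ κ) (⊞-identityʳ v))))
        (trans (ℚP.*-identityˡ _) (cong₂ (λ y u → e φ ((z ℤ.+ -[1+ 0 ]) ∷ y ∷ (v ⊞ u))) (lem₀ κ) (sym (⊟-𝟎 l))))
        where
        lem₂ : ∀ (κ : ℤ) → κ ℤ.+ + 1 ℤ.- + 2 ≡ κ ℤ.+ -[1+ 0 ]
        lem₂ κ = ℤP.+-assoc κ (+ 1) (ℤ.- + 2)
        lem₁ : ∀ (κ : ℤ) → κ ℤ.+ + 1 ℤ.- + 1 ≡ κ
        lem₁ κ = trans (ℤP.+-assoc κ (+ 1) (ℤ.- + 1)) (ℤP.+-identityʳ κ)
        lem₀ : ∀ (κ : ℤ) → κ ℤ.+ + 1 ℤ.- + 0 ≡ κ ℤ.+ + 1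
        lem₀ κ = z-z≡0 (κ ℤ.+ + 1)

  exponents : ∀ (s : ℕ) (ks : List ℕ) → Vec ℤ (length ks)
  exponents s []       = []
  exponents s (k ∷ ks) = (+ k ℤ.+ + s) ∷ exponents s ks

  exponents-suc : ∀ s ks → exponents (suc s) ks ≡ exponents s ks ⊞ 𝟏
  exponents-suc s []       = refl
  exponents-suc s (k ∷ ks) = cong₂ _∷_ (trans (cong (λ z → + k ℤ.+ z) (ℤP.+-comm (+ 1) (+ s))) (sym (ℤP.+-assoc (+ k) (+ s) (+ 1)))) (exponents-suc s ks)

  -- `Xprod` fixes the charge `t` at the right end. Removing the leftmost operator shortens `ks` by
  -- one, so `s` must grow by one to keep t = -length - s. This is the shift of all exponents by 𝟏
  -- that `vertex-step` leaves behind; at s = 0 nothing is shifted.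
  Xprod-differences : ∀ ks s t → t ≡ ℤ.- + length ks ℤ.- + s → ∀ {φ} → Resp φ →
    ⟪ φ , Xprod 1 ks t vacuumVec ⟫ ≡ differences (positiveRoots (length ks)) (e φ) (exponents s ks)
  Xprod-differences []       s t eq {φ} r = solve 1 (λ x → con 1ℚ :* x :+ con 0ℚ := x) refl (φ [])
  Xprod-differences (k ∷ ks) s t eq {φ} r = begin
    ⟪ φ , Xneg 1 k t′ v ⟫
      ≡⟨ Xneg-dual k t′ v r B (ℕ.s≤s (ℕP.m≤m+n (maxWeight v) (2 ℕ.* l))) ⟩
    ∑ (upTo B) (λ b → ⟪ U (+ b) (H (exponent k t′ b) φ) , v ⟫)
      ≡⟨ ∑-cong (upTo B) (λ b → cong (λ z → ⟪ U (+ b) (H z φ) , v ⟫) (exponent≡ b)) ⟩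
    ∑ (upTo B) (λ b → ⟪ ψ b , v ⟫)
      ≡⟨ ∑-cong (upTo B) (λ b → Xprod-differences ks (suc s) t (trans eq (lem₁ (+ l) (+ s))) (U.E-resp (+ b) (H.E-resp (x ℤ.- + l ℤ.+ + b) r))) ⟩
    ∑ (upTo B) (λ b → differences (positiveRoots l) (e (ψ b)) (exponents (suc s) ks))
      ≡⟨ differences-∑ (positiveRoots l) (upTo B) (λ b → e (ψ b)) (exponents (suc s) ks) ⟨
    differences (positiveRoots l) (λ κs → ∑ (upTo B) (λ b → e (ψ b) κs)) (exponents (suc s) ks)
      ≡⟨ cong (differences (positiveRoots l) (λ κs → ∑ (upTo B) (λ b → e (ψ b) κs))) (exponents-suc s ks) ⟩
    differences (positiveRoots l) (λ κs → ∑ (upTo B) (λ b → e (ψ b) κs)) (exponents s ks ⊞ 𝟏)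
      ≡⟨ differences-translate (positiveRoots l) 𝟏 (λ κs → ∑ (upTo B) (λ b → e (ψ b) κs)) (exponents s ks) ⟨
    differences (positiveRoots l) (λ κs → ∑ (upTo B) (λ b → e (ψ b) (κs ⊞ 𝟏))) (exponents s ks)
      ≡⟨ differences-cong (positiveRoots l) (λ κs → vertex-step κs x r B (ℕ.s≤s (ℕP.m≤n+m (2 ℕ.* l) (maxWeight v)))) (exponents s ks) ⟩
    differences (positiveRoots l) (λ κs → differences (firstRoots l) (e φ) (x ∷ κs)) (exponents s ks)
      ≡⟨ differences-0∷ (positiveRoots l) (differences (firstRoots l) (e φ)) x (exponents s ks) ⟨
    differences (map (+ 0 ∷_) (positiveRoots l)) (differences (firstRoots l) (e φ)) (x ∷ exponents s ks)
      ≡⟨ differences-++ (firstRoots l) (map (+ 0 ∷_) (positiveRoots l)) (e φ) (x ∷ exponents s ks) ⟨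
    differences (positiveRoots (suc l)) (e φ) (x ∷ exponents s ks) ∎
    where
    l : ℕ
    l = length ks
    t′ : ℤ
    t′ = t ℤ.+ + (2 ℕ.* l)
    v : FVec
    v = Xprod 1 ks t vacuumVec
    B : ℕ
    B = suc (maxWeight v ℕ.+ 2 ℕ.* l)
    x : ℤ
    x = + k ℤ.+ + s
    ψ : ℕ → Functional
    ψ b = U (+ b) (H (x ℤ.- + l ℤ.+ + b) φ)
    lem₁ : ∀ (l s : ℤ) → ℤ.- (+ 1 ℤ.+ l) ℤ.- s ≡ ℤ.- l ℤ.- (+ 1 ℤ.+ s)
    lem₁ = ℤRing.solve-∀
    exponent≡ : ∀ b → exponent k t′ b ≡ x ℤ.- + l ℤ.+ + b
    exponent≡ b = trans (cong₂ (λ t m → + k ℤ.+ + b ℤ.- (t ℤ.+ m ℤ.+ + 1) ℤ.* + 1) eq (ℤP.pos-* 2 l)) (lem (+ k) (+ b) (+ l) (+ s))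
      where
      lem : ∀ (k b l s : ℤ) → k ℤ.+ b ℤ.- (ℤ.- (+ 1 ℤ.+ l) ℤ.- s ℤ.+ + 2 ℤ.* l ℤ.+ + 1) ℤ.* + 1 ≡ k ℤ.+ s ℤ.- l ℤ.+ b
      lem = ℤRing.solve-∀

  -- Commutation of vertex operators

  infix 4 _≋_
  _≋_ : FVec → FVec → Set
  v ≋ w = ∀ {φ} → Resp φ → ⟪ φ , v ⟫ ≡ ⟪ φ , w ⟫

  Xneg-cong : ∀ k t {v w} → v ≋ w → Xneg 1 k t v ≋ Xneg 1 k t w
  Xneg-cong k t {v} {w} v≋w {φ} r = begin
    ⟪ φ , Xneg 1 k t v ⟫
      ≡⟨ Xneg-dual k t v r B (ℕ.s≤s (ℕP.m≤m+n _ _)) ⟩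
    ∑ (upTo B) (λ b → ⟪ U (+ b) (H (exponent k t b) φ) , v ⟫)
      ≡⟨ ∑-cong (upTo B) (λ b → v≋w (U.E-resp (+ b) (H.E-resp (exponent k t b) r))) ⟩
    ∑ (upTo B) (λ b → ⟪ U (+ b) (H (exponent k t b) φ) , w ⟫)
      ≡⟨ Xneg-dual k t w r B (ℕ.s≤s (ℕP.m≤n+m _ _)) ⟨
    ⟪ φ , Xneg 1 k t w ⟫ ∎
    where B = suc (maxWeight v ℕ.+ maxWeight w)

  pairing-combination : ∀ (φ ψ χ : Functional) q v →
    ⟪ (λ μ → φ μ ℚ.+ q ℚ.* ψ μ ℚ.+ χ μ) , v ⟫ ≡ ⟪ φ , v ⟫ ℚ.+ q ℚ.* ⟪ ψ , v ⟫ ℚ.+ ⟪ χ , v ⟫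
  pairing-combination φ ψ χ q v =
    linear-combination ⟪_, v ⟫ (pairing-cong v) (λ xs → pairing-sum xs proj₁ proj₂ v) φ ψ χ q

  module _ (t : ℤ) (v : FVec) {φ : Functional} (r : Resp φ) where
    private
      C : ℕ
      C = suc (maxWeight v)

    -- A normally ordered term: on vectors, both annihilation coefficients act before both
    -- multiplications by complete symmetric functions, so the members of each pair can be
    -- exchanged.
    ordered : ℤ → ℤ → ℤ → ℤ → ℚ
    ordered c d y z = ⟪ U d (U c (H y (H z φ))) , v ⟫

    ordered-sym : ∀ c d y z → ordered c d y z ≡ ordered d c z y
    ordered-sym c d y z = pairing-cong v (λ ν → trans (U.E-comm d c (H.E-resp y (H.E-resp z r)) ν)
      (lin-cong (U.E-linear c) (lin-cong (U.E-linear d) (H.E-comm y z r)) ν))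

    ordered-large : ∀ c d y z → C ℕ.≤ c → ordered (+ c) d y z ≡ 0ℚ
    ordered-large c d y z le = trans (pairing-cong v (U.E-comm d (+ c) (H.E-resp y (H.E-resp z r))))
      (pairing-U-large (U.E-resp d (H.E-resp y (H.E-resp z r))) c v le)

    ordered-negative : ∀ c d y z → ordered -[1+ c ] d y z ≡ 0ℚ
    ordered-negative c d y z = trans (pairing-cong v (lin-zero (U.E-linear d) (λ ν → refl)))
      (trans (∑-cong v (λ { (c , μ) → ℚP.*-zeroʳ c })) (∑-zero v))

    -- The right operator acts at charge t, the left one at charge t + 2, which gives the constants
    -- 1 and 3. The term `s` of `H-U` lowers the inner index by s, and writing b = c + s raises the
    -- outer one.
    inner-index outer-index : ℕ → ℕ → ℤ → ℤ
    inner-index y s b = + y ℤ.+ b ℤ.- t ℤ.- + 1 ℤ.- + s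
    outer-index x s c = + x ℤ.+ c ℤ.- t ℤ.- + 3 ℤ.+ + s

    -- the contribution of the s-th term of H-U to X_{-x} X_{-y} v
    summand : ℕ → ℕ → ℕ → ℕ → ℤ → ℚ
    summand x y s b′ c = ordered c (+ b′) (inner-index y s (+ b′)) (outer-index x s c)

    normal-ordered : ℕ → ℕ → ℚ
    normal-ordered x y = ∑ (upTo C) (λ b′ → ∑ (upTo C) (λ c → summand x y 0 b′ (+ c))
      ℚ.+ -2ℚ ℚ.* ∑ (upTo C) (λ c → summand x y 1 b′ (+ c)) ℚ.+ ∑ (upTo C) (λ c → summand x y 2 b′ (+ c)))

    -- The factor in front of the normally ordered product is (z - w)² up to a symmetric monomial.
    -- Exchanging z and w exchanges the terms s and 2 - s, whose coefficients agree.
    normal-ordered-sym : ∀ x y → normal-ordered x y ≡ normal-ordered y x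
    normal-ordered-sym x y = begin
      normal-ordered x y
        ≡⟨ expand x y ⟩
      Σs x y 0 ℚ.+ -2ℚ ℚ.* Σs x y 1 ℚ.+ Σs x y 2
        ≡⟨ cong₂ ℚ._+_ (cong₂ (λ a b → a ℚ.+ -2ℚ ℚ.* b) (flip 0 2 refl refl) (flip 1 1 refl refl)) (flip 2 0 refl refl) ⟩
      Σs y x 2 ℚ.+ -2ℚ ℚ.* Σs y x 1 ℚ.+ Σs y x 0
        ≡⟨ solve 4 (λ a b c d → a :+ d :* b :+ c := c :+ d :* b :+ a) refl (Σs y x 2) (Σs y x 1) (Σs y x 0) -2ℚ ⟩
      Σs y x 0 ℚ.+ -2ℚ ℚ.* Σs y x 1 ℚ.+ Σs y x 2
        ≡⟨ expand y x ⟨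
      normal-ordered y x ∎
      where
      Σs : ℕ → ℕ → ℕ → ℚ
      Σs x y s = ∑ (upTo C) (λ b′ → ∑ (upTo C) (λ c → summand x y s b′ (+ c)))
      expand : ∀ x y → normal-ordered x y ≡ Σs x y 0 ℚ.+ -2ℚ ℚ.* Σs x y 1 ℚ.+ Σs x y 2
      expand x y = trans (∑-+ (upTo C) (λ b′ → S 0 b′ ℚ.+ -2ℚ ℚ.* S 1 b′) (S 2))
        (cong (ℚ._+ Σs x y 2) (trans (∑-+ (upTo C) (S 0) (λ b′ → -2ℚ ℚ.* S 1 b′)) (cong (Σs x y 0 ℚ.+_) (∑-* (upTo C) -2ℚ (S 1)))))
        where
        S : ℕ → ℕ → ℚ
        S s b′ = ∑ (upTo C) (λ c → summand x y s b′ (+ c))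
      flip : ∀ s s′ → + s ≡ + 2 ℤ.- + s′ → + s′ ≡ + 2 ℤ.- + s → Σs x y s ≡ Σs y x s′
      flip s s′ e₁ e₂ = trans (∑-cong (upTo C) (λ b′ → ∑-cong (upTo C) (λ c → trans (ordered-sym (+ c) (+ b′) (inner-index y s (+ b′)) (outer-index x s (+ c)))
          (cong₂ (ordered (+ b′) (+ c)) (trans (cong (λ z → + x ℤ.+ + c ℤ.- t ℤ.- + 3 ℤ.+ z) e₁) (lem₁ (+ x) (+ c) t (+ s′)))
            (trans (cong (λ z → + y ℤ.+ + b′ ℤ.- t ℤ.- + 1 ℤ.- z) e₁) (lem₂ (+ y) (+ b′) t (+ s′)))))))
        (∑-swap (upTo C) (upTo C) (λ b′ c → summand y x s′ c (+ b′)))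
        where
        lem₁ : ∀ (x c t s : ℤ) → x ℤ.+ c ℤ.- t ℤ.- + 3 ℤ.+ (+ 2 ℤ.- s) ≡ x ℤ.+ c ℤ.- t ℤ.- + 1 ℤ.- s
        lem₁ = ℤRing.solve-∀
        lem₂ : ∀ (y b t s : ℤ) → y ℤ.+ b ℤ.- t ℤ.- + 1 ℤ.- (+ 2 ℤ.- s) ≡ y ℤ.+ b ℤ.- t ℤ.- + 3 ℤ.+ s
        lem₂ = ℤRing.solve-∀

    Xneg-Xneg : ∀ x y → ⟪ φ , Xneg 1 x (t ℤ.+ + 2) (Xneg 1 y t v) ⟫ ≡ normal-ordered x y
    Xneg-Xneg x y = begin
      ⟪ φ , Xneg 1 x (t ℤ.+ + 2) u ⟫
        ≡⟨ Xneg-dual x (t ℤ.+ + 2) u r (2 ℕ.+ B) (ℕP.≤-trans (ℕ.s≤s (ℕP.m≤n+m (maxWeight u) C)) (ℕP.n≤1+n _)) ⟩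
      ∑ (upTo (2 ℕ.+ B)) (λ b → ⟪ U (+ b) (ψ b) , u ⟫)
        ≡⟨ ∑-cong (upTo (2 ℕ.+ B)) (λ b → Xneg-dual y t v (U.E-resp (+ b) (ψ-resp b)) C ℕP.≤-refl) ⟩
      ∑ (upTo (2 ℕ.+ B)) (λ b → ∑ (upTo C) (λ b′ → ⟪ U (+ b′) (H (exponent y t b′) (U (+ b) (ψ b))) , v ⟫))
        ≡⟨ ∑-swap (upTo (2 ℕ.+ B)) (upTo C) (λ b b′ → ⟪ U (+ b′) (H (exponent y t b′) (U (+ b) (ψ b))) , v ⟫) ⟩
      ∑ (upTo C) (λ b′ → ∑ (upTo (2 ℕ.+ B)) (λ b → ⟪ U (+ b′) (H (exponent y t b′) (U (+ b) (ψ b))) , v ⟫))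
        ≡⟨ ∑-cong (upTo C) inner ⟩
      normal-ordered x y ∎
      where
      u : FVec
      u = Xneg 1 y t v
      -- The range has to exceed `maxWeight u`, and after a loss of up to two terms through the
      -- shifts by s it must still reach `C`.
      B : ℕ
      B = C ℕ.+ maxWeight u
      ψ : ℕ → Functional
      ψ b = H (exponent x (t ℤ.+ + 2) b) φ
      ψ-resp : ∀ b → Resp (ψ b)
      ψ-resp b = H.E-resp (exponent x (t ℤ.+ + 2) b) r
      lem₁ : ∀ (y b t s : ℤ) → y ℤ.+ b ℤ.- (t ℤ.+ + 1) ℤ.* + 1 ℤ.- s ≡ y ℤ.+ b ℤ.- t ℤ.- + 1 ℤ.- s
      lem₁ = ℤRing.solve-∀
      lem₂ : ∀ (x b t s : ℤ) → x ℤ.+ b ℤ.- (t ℤ.+ + 2 ℤ.+ + 1) ℤ.* + 1 ≡ x ℤ.+ (b ℤ.- s) ℤ.- t ℤ.- + 3 ℤ.+ s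
      lem₂ = ℤRing.solve-∀
      reindex : ∀ b b′ s → ⟪ U (+ b′) (U (+ b ℤ.- + s) (H (exponent y t b′ ℤ.- + s) (ψ b))) , v ⟫ ≡ summand x y s b′ (+ b ℤ.- + s)
      reindex b b′ s = cong₂ (λ p q → ordered (+ b ℤ.- + s) (+ b′) p q) (lem₁ (+ y) (+ b′) t (+ s)) (lem₂ (+ x) (+ b) t (+ s))
      term : ∀ b b′ → ⟪ U (+ b′) (H (exponent y t b′) (U (+ b) (ψ b))) , v ⟫ ≡
        summand x y 0 b′ (+ b ℤ.- + 0) ℚ.+ -2ℚ ℚ.* summand x y 1 b′ (+ b ℤ.- + 1) ℚ.+ summand x y 2 b′ (+ b ℤ.- + 2)
      term b b′ = begin
        ⟪ U (+ b′) (H p (U (+ b) (ψ b))) , v ⟫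
          ≡⟨ pairing-cong v (lin-cong (U.E-linear (+ b′)) (H-U p (+ b) (ψ-resp b))) ⟩
        ⟪ U (+ b′) (λ ν → U (+ b) (H p (ψ b)) ν ℚ.+ -2ℚ ℚ.* T 1 ν ℚ.+ T 2 ν) , v ⟫
          ≡⟨ pairing-cong v (lin-cong (U.E-linear (+ b′)) (λ ν → cong₂ (λ i j → U i (H j (ψ b)) ν ℚ.+ -2ℚ ℚ.* T 1 ν ℚ.+ T 2 ν) (sym (z-z≡0 (+ b))) (sym (z-z≡0 p)))) ⟩
        ⟪ U (+ b′) (λ ν → T 0 ν ℚ.+ -2ℚ ℚ.* T 1 ν ℚ.+ T 2 ν) , v ⟫
          ≡⟨ pairing-cong v (lin-combination (U.E-linear (+ b′)) (T 0) (T 1) (T 2)) ⟩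
        ⟪ (λ ν → U (+ b′) (T 0) ν ℚ.+ -2ℚ ℚ.* U (+ b′) (T 1) ν ℚ.+ U (+ b′) (T 2) ν) , v ⟫
          ≡⟨ pairing-combination (U (+ b′) (T 0)) (U (+ b′) (T 1)) (U (+ b′) (T 2)) -2ℚ v ⟩
        ⟪ U (+ b′) (T 0) , v ⟫ ℚ.+ -2ℚ ℚ.* ⟪ U (+ b′) (T 1) , v ⟫ ℚ.+ ⟪ U (+ b′) (T 2) , v ⟫
          ≡⟨ cong₂ ℚ._+_ (cong₂ (λ i j → i ℚ.+ -2ℚ ℚ.* j) (reindex b b′ 0) (reindex b b′ 1)) (reindex b b′ 2) ⟩
        summand x y 0 b′ (+ b ℤ.- + 0) ℚ.+ -2ℚ ℚ.* summand x y 1 b′ (+ b ℤ.- + 1) ℚ.+ summand x y 2 b′ (+ b ℤ.- + 2) ∎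
        where
        p : ℤ
        p = exponent y t b′
        T : ℕ → Functional
        T s = U (+ b ℤ.- + s) (H (p ℤ.- + s) (ψ b))
        lin-combination : ∀ {T : Functional → Functional} → Linear T → ∀ (φ ψ χ : Functional) →
          T (λ ν → φ ν ℚ.+ -2ℚ ℚ.* ψ ν ℚ.+ χ ν) ≗ λ ν → T φ ν ℚ.+ -2ℚ ℚ.* T ψ ν ℚ.+ T χ ν
        lin-combination {T} L φ ψ χ μ =
          linear-combination (λ φ → T φ μ) (λ eq → lin-cong L eq μ) (λ xs → lin-sum L xs proj₁ proj₂ μ) φ ψ χ -2ℚ
      truncate : ∀ s b′ B′ → C ℕ.≤ B′ → ∑ (upTo B′) (λ c → summand x y s b′ (+ c)) ≡ ∑ (upTo C) (λ c → summand x y s b′ (+ c))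
      truncate s b′ B′ le = ∑-upTo-extend (λ c → summand x y s b′ (+ c)) le (λ c le′ → ordered-large c (+ b′) (inner-index y s (+ b′)) (outer-index x s (+ c)) le′)
      C≤B : C ℕ.≤ B
      C≤B = ℕP.m≤m+n C (maxWeight u)
      inner : ∀ b′ → ∑ (upTo (2 ℕ.+ B)) (λ b → ⟪ U (+ b′) (H (exponent y t b′) (U (+ b) (ψ b))) , v ⟫) ≡
        ∑ (upTo C) (λ c → summand x y 0 b′ (+ c)) ℚ.+ -2ℚ ℚ.* ∑ (upTo C) (λ c → summand x y 1 b′ (+ c)) ℚ.+ ∑ (upTo C) (λ c → summand x y 2 b′ (+ c))
      inner b′ = begin
        ∑ (upTo (2 ℕ.+ B)) (λ b → ⟪ U (+ b′) (H (exponent y t b′) (U (+ b) (ψ b))) , v ⟫)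
          ≡⟨ ∑-cong (upTo (2 ℕ.+ B)) (λ b → term b b′) ⟩
        ∑ (upTo (2 ℕ.+ B)) (λ b → g 0 (+ b ℤ.- + 0) ℚ.+ -2ℚ ℚ.* g 1 (+ b ℤ.- + 1) ℚ.+ g 2 (+ b ℤ.- + 2))
          ≡⟨ trans (∑-+ (upTo (2 ℕ.+ B)) (λ b → g 0 (+ b ℤ.- + 0) ℚ.+ -2ℚ ℚ.* g 1 (+ b ℤ.- + 1)) (λ b → g 2 (+ b ℤ.- + 2)))
               (cong₂ ℚ._+_ (trans (∑-+ (upTo (2 ℕ.+ B)) (λ b → g 0 (+ b ℤ.- + 0)) (λ b → -2ℚ ℚ.* g 1 (+ b ℤ.- + 1)))
                 (cong₂ ℚ._+_ (trans (∑-shift₀ (g 0) (2 ℕ.+ B)) (truncate 0 b′ (2 ℕ.+ B) (ℕP.≤-trans C≤B (ℕP.m≤n+m B 2))))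
                   (trans (∑-* (upTo (2 ℕ.+ B)) -2ℚ (λ b → g 1 (+ b ℤ.- + 1))) (cong (-2ℚ ℚ.*_)
                     (trans (∑-shift₁ (g 1) (suc B) (g-negative 1 0)) (truncate 1 b′ (suc B) (ℕP.≤-trans C≤B (ℕP.n≤1+n B))))))))
                 (trans (∑-shift₂ (g 2) B (g-negative 2 0) (g-negative 2 1)) (truncate 2 b′ B C≤B))) ⟩
        ∑ (upTo C) (λ c → g 0 (+ c)) ℚ.+ -2ℚ ℚ.* ∑ (upTo C) (λ c → g 1 (+ c)) ℚ.+ ∑ (upTo C) (λ c → g 2 (+ c)) ∎
        where
        g : ℕ → ℤ → ℚ
        g s = summand x y s b′
        g-negative : ∀ s n → g s -[1+ n ] ≡ 0ℚ
        g-negative s n = ordered-negative n (+ b′) (inner-index y s (+ b′)) (outer-index x s -[1+ n ])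

  Xneg-comm : ∀ x y t v → Xneg 1 x (t ℤ.+ + 2) (Xneg 1 y t v) ≋ Xneg 1 y (t ℤ.+ + 2) (Xneg 1 x t v)
  Xneg-comm x y t v r = trans (Xneg-Xneg t v r x y) (trans (normal-ordered-sym t v r x y) (sym (Xneg-Xneg t v r y x)))

  Xprod-∷ : ∀ t k {ks ks′} → length ks ≡ length ks′ → Xprod 1 ks t vacuumVec ≋ Xprod 1 ks′ t vacuumVec →
            Xprod 1 (k ∷ ks) t vacuumVec ≋ Xprod 1 (k ∷ ks′) t vacuumVec
  Xprod-∷ t k {ks} {ks′} eq ≋ks {φ} r = trans
    (Xneg-cong k (t ℤ.+ + (2 ℕ.* length ks)) {Xprod 1 ks t vacuumVec} {Xprod 1 ks′ t vacuumVec} ≋ks r)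
    (cong (λ l → ⟪ φ , Xneg 1 k (t ℤ.+ + (2 ℕ.* l)) (Xprod 1 ks′ t vacuumVec) ⟫) eq)

  Xprod-↭ : ∀ t {ks ks′} → ks ↭ ks′ → Xprod 1 ks t vacuumVec ≋ Xprod 1 ks′ t vacuumVec
  Xprod-↭ t Perm.refl r = refl
  Xprod-↭ t (Perm.prep {ks} {ks′} k p) = Xprod-∷ t k {ks} {ks′} (PermP.↭-length p) (Xprod-↭ t p)
  Xprod-↭ t (Perm.swap {ks} {ks′} x y p) {φ} r = begin
    ⟪ φ , Xneg 1 x (charge (suc (length ks))) (Xneg 1 y (charge (length ks)) (Xprod 1 ks t vacuumVec)) ⟫
      ≡⟨ cong (λ c → ⟪ φ , Xneg 1 x c (Xneg 1 y (charge (length ks)) (Xprod 1 ks t vacuumVec)) ⟫) (charge-suc (length ks)) ⟩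
    ⟪ φ , Xneg 1 x (charge (length ks) ℤ.+ + 2) (Xneg 1 y (charge (length ks)) (Xprod 1 ks t vacuumVec)) ⟫
      ≡⟨ Xneg-comm x y (charge (length ks)) (Xprod 1 ks t vacuumVec) r ⟩
    ⟪ φ , Xneg 1 y (charge (length ks) ℤ.+ + 2) (Xneg 1 x (charge (length ks)) (Xprod 1 ks t vacuumVec)) ⟫
      ≡⟨ cong (λ c → ⟪ φ , Xneg 1 y c (Xneg 1 x (charge (length ks)) (Xprod 1 ks t vacuumVec)) ⟫) (charge-suc (length ks)) ⟨
    ⟪ φ , Xprod 1 (y ∷ x ∷ ks) t vacuumVec ⟫
      ≡⟨ Xprod-∷ t y {x ∷ ks} {x ∷ ks′} (cong suc (PermP.↭-length p)) (Xprod-∷ t x {ks} {ks′} (PermP.↭-length p) (Xprod-↭ t p)) r ⟩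
    ⟪ φ , Xprod 1 (y ∷ x ∷ ks′) t vacuumVec ⟫ ∎
    where
    charge : ℕ → ℤ
    charge l = t ℤ.+ + (2 ℕ.* l)
    charge-suc : ∀ l → charge (suc l) ≡ charge l ℤ.+ + 2
    charge-suc l = trans (cong (λ n → t ℤ.+ + n) (trans (ℕP.*-suc 2 l) (ℕP.+-comm 2 (2 ℕ.* l)))) (trans (cong (λ z → t ℤ.+ z) (ℤP.pos-+ (2 ℕ.* l) 2))
      (sym (ℤP.+-assoc t (+ (2 ℕ.* l)) (+ 2))))
  Xprod-↭ t (Perm.trans p q) r = trans (Xprod-↭ t p r) (Xprod-↭ t q r)

  -- Positivity

  Laurent : ℕ → Set
  Laurent l = List (ℚ × Vec ℤ l)

  _≟ᵛ_ : ∀ {l} (u v : Vec ℤ l) → Dec (u ≡ v)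
  _≟ᵛ_ = VecP.≡-dec ℤ._≟_

  indicator : ∀ {A : Set} → Dec A → ℚ
  indicator (yes _) = 1ℚ
  indicator (no _)  = 0ℚ

  indicator-yes : ∀ {A : Set} (D : Dec A) → A → indicator D ≡ 1ℚ
  indicator-yes (yes _) x = refl
  indicator-yes (no ¬x) x = ⊥-elim (¬x x)

  indicator-no : ∀ {A : Set} (D : Dec A) → ¬ A → indicator D ≡ 0ℚ
  indicator-no (yes x) ¬x = ⊥-elim (¬x x)
  indicator-no (no _)  ¬x = refl

  indicator-⇔ : ∀ {A B : Set} (D : Dec A) (E : Dec B) → (A → B) → (B → A) → indicator D ≡ indicator E
  indicator-⇔ (yes a) E f g = sym (indicator-yes E (f a))
  indicator-⇔ (no ¬a) E f g = sym (indicator-no E (¬a ∘ g))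

  -- The constant term of f(z⁻¹)F(z), where F is given by its coefficients and may have infinite
  -- support.
  pair : ∀ {l} → Laurent l → Fun l → ℚ
  pair f F = ∑ f (λ { (c , ν) → c ℚ.* F ν })

  ⌊_⌋ : ∀ {l} → Laurent l → Fun l
  ⌊ f ⌋ κ = pair f (λ ν → indicator (ν ≟ᵛ κ))

  pair-cong : ∀ {l} (f : Laurent l) {F G} → (∀ κ → F κ ≡ G κ) → pair f F ≡ pair f G
  pair-cong f e = ∑-cong f (λ { (c , ν) → cong (c ℚ.*_) (e ν) })

  erase : ∀ {l} → Vec ℤ l → Laurent l → Laurent l
  erase κ = filter (λ { (_ , ν) → ¬? (ν ≟ᵛ κ) })

  pair-erase : ∀ {l} κ (f : Laurent l) F → pair f F ≡ ⌊ f ⌋ κ ℚ.* F κ ℚ.+ pair (erase κ f) F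
  pair-erase κ []            F = solve 1 (λ x → con 0ℚ := con 0ℚ :* x :+ con 0ℚ) refl (F κ)
  pair-erase κ ((c , ν) ∷ f) F with ν ≟ᵛ κ
  ... | yes refl = trans (cong (c ℚ.* F ν ℚ.+_) (pair-erase ν f F))
          (solve 4 (λ c x s p → c :* x :+ (s :* x :+ p) := (c :* con 1ℚ :+ s) :* x :+ p) refl c (F ν) (⌊ f ⌋ ν) (pair (erase ν f) F))
  ... | no _     = trans (cong (c ℚ.* F ν ℚ.+_) (pair-erase κ f F))
          (solve 5 (λ c y x s p → c :* y :+ (s :* x :+ p) := (c :* con 0ℚ :+ s) :* x :+ (c :* y :+ p)) refl c (F ν) (F κ) (⌊ f ⌋ κ) (pair (erase κ f) F))

  ⌊⌋-erase-other : ∀ {l} κ (f : Laurent l) {ρ} → ρ ≢ κ → ⌊ f ⌋ ρ ≡ ⌊ erase κ f ⌋ ρ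
  ⌊⌋-erase-other κ f {ρ} ne = trans (pair-erase κ f (λ ν → indicator (ν ≟ᵛ ρ)))
    (trans (cong (λ x → ⌊ f ⌋ κ ℚ.* x ℚ.+ ⌊ erase κ f ⌋ ρ) (indicator-no (κ ≟ᵛ ρ) (ne ∘ sym)))
      (solve 2 (λ x y → x :* con 0ℚ :+ y := y) refl (⌊ f ⌋ κ) (⌊ erase κ f ⌋ ρ)))

  square-decomposition : ∀ {l} κ (f : Laurent l) → pair f ⌊ f ⌋ ≡ ⌊ f ⌋ κ ℚ.* ⌊ f ⌋ κ ℚ.+ pair (erase κ f) ⌊ erase κ f ⌋
  square-decomposition κ f = trans (pair-erase κ f ⌊ f ⌋) (cong (⌊ f ⌋ κ ℚ.* ⌊ f ⌋ κ ℚ.+_)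
    (∑-cong-All (All.map (λ { {c , ν} ne → cong (c ℚ.*_) (⌊⌋-erase-other κ f ne) }) (AllP.all-filter (λ { (_ , ν) → ¬? (ν ≟ᵛ κ) }) f))))

  erase-head-length : ∀ {l} c κ (f : Laurent l) → length (erase κ ((c , κ) ∷ f)) ℕ.≤ length f
  erase-head-length c κ f with κ ≟ᵛ κ
  ... | yes _ = LP.length-filter (λ { (_ , ν) → ¬? (ν ≟ᵛ κ) }) f
  ... | no ne = ⊥-elim (ne refl)

  -- Exponents may repeat in `f`, so the pairing is not a sum of squares term by term. Erasing all
  -- terms at the head exponent isolates one square of a true coefficient; `n` bounds the length
  -- because `erase` is not structurally smaller.
  pair-self : ∀ {l} n (f : Laurent l) → length f ℕ.≤ n → 0ℚ ℚ.≤ pair f ⌊ f ⌋ × (pair f ⌊ f ⌋ ≡ 0ℚ → ∀ κ → ⌊ f ⌋ κ ≡ 0ℚ)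
  pair-self n [] le = ℚP.≤-refl , λ _ κ → refl
  pair-self (suc n) f@((c , κ) ∷ f′) (ℕ.s≤s le) = nonNeg , definite
    where
    ih = pair-self n (erase κ f) (ℕP.≤-trans (erase-head-length c κ f′) le)
    nonNeg : 0ℚ ℚ.≤ pair f ⌊ f ⌋
    nonNeg = subst (0ℚ ℚ.≤_) (sym (square-decomposition κ f)) (ℚP.+-mono-≤ (square-nonNeg (⌊ f ⌋ κ)) (proj₁ ih))
    definite : pair f ⌊ f ⌋ ≡ 0ℚ → ∀ ρ → ⌊ f ⌋ ρ ≡ 0ℚ
    definite e ρ = by-cases (ρ ≟ᵛ κ)
      where
      zeros : ⌊ f ⌋ κ ≡ 0ℚ × pair (erase κ f) ⌊ erase κ f ⌋ ≡ 0ℚ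
      zeros = square+nonNeg≡0 (proj₁ ih) (trans (sym (square-decomposition κ f)) e)
      by-cases : Dec (ρ ≡ κ) → ⌊ f ⌋ ρ ≡ 0ℚ
      by-cases (yes refl) = proj₁ zeros
      by-cases (no ne)    = trans (⌊⌋-erase-other κ f ne) (proj₂ ih (proj₂ zeros) ρ)

  -- multiplication by 1 - z^τ
  subtract-translate : ∀ {l} → Vec ℤ l → Laurent l → Laurent l
  subtract-translate τ f = f ++ map (λ { (c , ν) → (ℚ.- c , ν ⊞ τ) }) f

  pair-subtract-translate : ∀ {l} τ (f : Laurent l) F → pair (subtract-translate τ f) F ≡ pair f (λ κ → F κ ℚ.- F (κ ⊞ τ))
  pair-subtract-translate τ f F = begin
    pair (subtract-translate τ f) F
      ≡⟨ ∑-++ f _ _ ⟩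
    pair f F ℚ.+ ∑ (map (λ { (c , ν) → (ℚ.- c , ν ⊞ τ) }) f) (λ { (c , ν) → c ℚ.* F ν })
      ≡⟨ cong (pair f F ℚ.+_) (∑-map _ f _) ⟩
    pair f F ℚ.+ ∑ f (λ { (c , ν) → (ℚ.- c) ℚ.* F (ν ⊞ τ) })
      ≡⟨ ∑-+ f _ _ ⟨
    ∑ f (λ x → proj₁ x ℚ.* F (proj₂ x) ℚ.+ (ℚ.- proj₁ x) ℚ.* F (proj₂ x ⊞ τ))
      ≡⟨ ∑-cong f (λ { (c , ν) → solve 3 (λ c x y → c :* x :+ (:- c) :* y := c :* (x :- y)) refl c (F ν) (F (ν ⊞ τ)) }) ⟩
    pair f (λ κ → F κ ℚ.- F (κ ⊞ τ)) ∎

  ⊞-⊟-cancel : ∀ {l} (κ τ : Vec ℤ l) → (κ ⊞ τ) ⊞ ⊟ τ ≡ κ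
  ⊞-⊟-cancel κ τ = trans (⊞-swap κ τ (⊟ τ)) (⊟-⊞-cancel κ τ)
    where
    ⊟-⊞-cancel : ∀ {l} (κ τ : Vec ℤ l) → (κ ⊞ ⊟ τ) ⊞ τ ≡ κ
    ⊟-⊞-cancel κ τ = trans (⊞-assoc κ (⊟ τ) τ) (trans (cong (κ ⊞_) (⊞-inverseˡ τ)) (⊞-identityʳ κ))

  ⊟-⊞-cancel : ∀ {l} (κ τ : Vec ℤ l) → (κ ⊞ ⊟ τ) ⊞ τ ≡ κ
  ⊟-⊞-cancel κ τ = trans (⊞-swap κ (⊟ τ) τ) (⊞-⊟-cancel κ τ)

  ⌊⌋-subtract-translate : ∀ {l} τ (f : Laurent l) κ → ⌊ subtract-translate τ f ⌋ κ ≡ ⌊ f ⌋ κ ℚ.- ⌊ f ⌋ (κ ⊞ ⊟ τ)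
  ⌊⌋-subtract-translate τ f κ = begin
    ⌊ subtract-translate τ f ⌋ κ
      ≡⟨ pair-subtract-translate τ f (λ ν → indicator (ν ≟ᵛ κ)) ⟩
    pair f (λ ν → indicator (ν ≟ᵛ κ) ℚ.- indicator ((ν ⊞ τ) ≟ᵛ κ))
      ≡⟨ pair-cong f (λ ν → cong (λ x → indicator (ν ≟ᵛ κ) ℚ.- x) (indicator-⇔ ((ν ⊞ τ) ≟ᵛ κ) (ν ≟ᵛ (κ ⊞ ⊟ τ))
           (λ e → trans (sym (⊞-⊟-cancel ν τ)) (cong (_⊞ ⊟ τ) e)) (λ e → trans (cong (_⊞ τ) e) (⊟-⊞-cancel κ τ)))) ⟩
    pair f (λ ν → indicator (ν ≟ᵛ κ) ℚ.- indicator (ν ≟ᵛ (κ ⊞ ⊟ τ)))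
      ≡⟨ ∑-cong f (λ { (c , ν) → solve 3 (λ c x y → c :* (x :- y) := c :* x :+ con (ℚ.- 1ℚ) :* (c :* y)) refl c (indicator (ν ≟ᵛ κ)) (indicator (ν ≟ᵛ (κ ⊞ ⊟ τ))) }) ⟩
    ∑ f (λ x → proj₁ x ℚ.* indicator (proj₂ x ≟ᵛ κ) ℚ.+ (ℚ.- 1ℚ) ℚ.* (proj₁ x ℚ.* indicator (proj₂ x ≟ᵛ (κ ⊞ ⊟ τ))))
      ≡⟨ trans (∑-+ f _ _) (cong (⌊ f ⌋ κ ℚ.+_) (∑-* f (ℚ.- 1ℚ) _)) ⟩
    ⌊ f ⌋ κ ℚ.+ (ℚ.- 1ℚ) ℚ.* ⌊ f ⌋ (κ ⊞ ⊟ τ)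
      ≡⟨ solve 2 (λ x y → x :+ con (ℚ.- 1ℚ) :* y := x :- y) refl (⌊ f ⌋ κ) (⌊ f ⌋ (κ ⊞ ⊟ τ)) ⟩
    ⌊ f ⌋ κ ℚ.- ⌊ f ⌋ (κ ⊞ ⊟ τ) ∎

  NonZeroVec : ∀ {l} → Vec ℤ l → Set
  NonZeroVec τ = ∃ λ i → Vec.lookup τ i ≢ + 0

  times : ∀ {l} → ℕ → Vec ℤ l → Vec ℤ l → Vec ℤ l
  times zero    τ κ = κ
  times (suc m) τ κ = times m τ (κ ⊞ ⊟ τ)

  lookup-times : ∀ {l} m (τ κ : Vec ℤ l) i → Vec.lookup (times m τ κ) i ≡ Vec.lookup κ i ℤ.- + m ℤ.* Vec.lookup τ i
  lookup-times zero    τ κ i = sym (trans (cong (λ z → Vec.lookup κ i ℤ.- z) (ℤP.*-zeroˡ (Vec.lookup τ i))) (ℤP.+-identityʳ _))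
  lookup-times (suc m) τ κ i = begin
    Vec.lookup (times m τ (κ ⊞ ⊟ τ)) i
      ≡⟨ lookup-times m τ (κ ⊞ ⊟ τ) i ⟩
    Vec.lookup (κ ⊞ ⊟ τ) i ℤ.- + m ℤ.* Vec.lookup τ i
      ≡⟨ cong (ℤ._- + m ℤ.* Vec.lookup τ i) (trans (VecP.lookup-zipWith ℤ._+_ i κ (⊟ τ)) (cong (λ z → Vec.lookup κ i ℤ.+ z) (VecP.lookup-map i ℤ.-_ τ))) ⟩
    Vec.lookup κ i ℤ.- Vec.lookup τ i ℤ.- + m ℤ.* Vec.lookup τ i
      ≡⟨ lem (Vec.lookup κ i) (Vec.lookup τ i) (+ m) ⟩
    Vec.lookup κ i ℤ.- (+ suc m) ℤ.* Vec.lookup τ i ∎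
    where
    lem : ∀ (k t m : ℤ) → k ℤ.- t ℤ.- m ℤ.* t ≡ k ℤ.- (+ 1 ℤ.+ m) ℤ.* t
    lem = ℤRing.solve-∀

  -- Repeated translation moves κ out of the support.
  invariant⇒zero : ∀ {l} (τ : Vec ℤ l) → NonZeroVec τ → (f : Laurent l) → (∀ κ → ⌊ f ⌋ κ ≡ ⌊ f ⌋ (κ ⊞ ⊟ τ)) → ∀ κ → ⌊ f ⌋ κ ≡ 0ℚ
  invariant⇒zero τ (i , τᵢ≢0) f inv κ = trans (iterate m κ) (∑-zero-All (All.map (λ { {c , ν} ne →
      trans (cong (c ℚ.*_) (indicator-no (ν ≟ᵛ times m τ κ) ne)) (ℚP.*-zeroʳ c) }) (outside f ℕP.≤-refl)))
    where
    -- This exceeds the sum of the absolute values of the i-th coordinates of `κ` and of any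
    -- exponent in `f`, while `m` translations move that coordinate by at least `m`.
    size : Laurent _ → ℕ
    size []            = suc ℤ.∣ Vec.lookup κ i ∣
    size ((c , ν) ∷ f) = ℤ.∣ Vec.lookup ν i ∣ ℕ.+ size f
    m : ℕ
    m = size f
    iterate : ∀ m κ → ⌊ f ⌋ κ ≡ ⌊ f ⌋ (times m τ κ)
    iterate zero    κ = refl
    iterate (suc m) κ = trans (inv κ) (iterate m (κ ⊞ ⊟ τ))
    base≤size : ∀ f → suc ℤ.∣ Vec.lookup κ i ∣ ℕ.≤ size f
    base≤size []            = ℕP.≤-refl
    base≤size ((c , ν) ∷ f) = ℕP.≤-trans (base≤size f) (ℕP.m≤n+m (size f) ℤ.∣ Vec.lookup ν i ∣)
    far : ∀ ν n → ℤ.∣ Vec.lookup ν i ∣ ℕ.+ suc ℤ.∣ Vec.lookup κ i ∣ ℕ.≤ n → ν ≢ times n τ κ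
    far ν n le refl = contradictory le n≤ (ℤP.∣i-j∣≤∣i∣+∣j∣ (Vec.lookup κ i) (Vec.lookup ν′ i))
      where
      contradictory : ∀ {a b n d} → a ℕ.+ suc b ℕ.≤ n → n ℕ.≤ d → d ℕ.≤ b ℕ.+ a → ⊥
      contradictory {a} {b} {n} p q r = ℕP.<-irrefl refl (ℕP.≤-trans (subst (ℕ._≤ n) (ℕP.+-suc a b) p)
        (ℕP.≤-trans q (ℕP.≤-trans r (ℕP.≤-reflexive (ℕP.+-comm b a)))))
      ν′ = times n τ κ
      n≤ : n ℕ.≤ ℤ.∣ Vec.lookup κ i ℤ.- Vec.lookup ν′ i ∣
      n≤ = ℕP.≤-trans (ℕP.m≤m*n n ℤ.∣ Vec.lookup τ i ∣ {{ℕ.≢-nonZero (λ e → τᵢ≢0 (ℤP.∣i∣≡0⇒i≡0 e))}})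
        (ℕP.≤-reflexive (trans (sym (ℤP.abs-* (+ n) (Vec.lookup τ i))) (cong ℤ.∣_∣ (sym (trans (cong (λ z → Vec.lookup κ i ℤ.- z) (lookup-times n τ κ i))
          (lem (Vec.lookup κ i) (+ n ℤ.* Vec.lookup τ i)))))))
        where
        lem : ∀ (k t : ℤ) → k ℤ.- (k ℤ.- t) ≡ t
        lem = ℤRing.solve-∀
    outside : ∀ g → size g ℕ.≤ m → All (λ x → proj₂ x ≢ times m τ κ) g
    outside []            le = []
    outside ((c , ν) ∷ g) le = far ν m (ℕP.≤-trans (ℕP.+-monoʳ-≤ ℤ.∣ Vec.lookup ν i ∣ (base≤size g)) le)
      ∷ outside g (ℕP.≤-trans (ℕP.m≤n+m (size g) ℤ.∣ Vec.lookup ν i ∣) le)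

  -- Each difference is -A A* with A = 1 - z^τ, so the pairing is ± a sum of squares of coefficients of ∏ A* f.
  differences-definite : ∀ {l} (ts : List (Vec ℤ l)) → All NonZeroVec ts → ∀ f → pair f (differences ts ⌊ f ⌋) ≡ 0ℚ → ∀ κ → ⌊ f ⌋ κ ≡ 0ℚ
  differences-definite []       []         f e = proj₂ (pair-self (length f) f ℕP.≤-refl) e
  differences-definite (τ ∷ ts) (nz ∷ nzs) f e = invariant⇒zero τ nz f (λ κ →
      x-y≡0⇒x≡y (trans (sym (⌊⌋-subtract-translate τ f κ)) (differences-definite ts nzs g pair-g κ)))
    where
    open import Algebra.Properties.Ring ℚP.+-*-ring using () renaming (x∙y⁻¹≈ε⇒x≈y to cancel)
    x-y≡0⇒x≡y : ∀ {x y} → x ℚ.- y ≡ 0ℚ → x ≡ y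
    x-y≡0⇒x≡y {x} {y} = cancel x y
    g = subtract-translate τ f
    DG : Fun _
    DG = differences ts ⌊ g ⌋
    -- One factor 1 - z^τ sits in `⌊ g ⌋`. The other is moved from the left argument to the right
    -- one, where the two combine to minus `difference τ`.
    pair-g : pair g DG ≡ 0ℚ
    pair-g = begin
      pair g DG
        ≡⟨ pair-subtract-translate τ f DG ⟩
      pair f (λ κ → DG κ ℚ.- DG (κ ⊞ τ))
        ≡⟨ ∑-cong f (λ { (c , ν) → sign c (DG ν) (DG (ν ⊞ τ)) }) ⟩
      ∑ f (λ x → (ℚ.- 1ℚ) ℚ.* (proj₁ x ℚ.* (DG (proj₂ x ⊞ τ) ℚ.+ (ℚ.- 1ℚ) ℚ.* DG (proj₂ x))))
        ≡⟨ ∑-* f (ℚ.- 1ℚ) _ ⟩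
      (ℚ.- 1ℚ) ℚ.* ∑ f (λ x → proj₁ x ℚ.* (DG (proj₂ x ⊞ τ) ℚ.+ (ℚ.- 1ℚ) ℚ.* DG (proj₂ x)))
        ≡⟨ cong ((ℚ.- 1ℚ) ℚ.*_) (trans (∑-cong f (λ { (c , ν) → cong (c ℚ.*_) (factorise ν) })) e) ⟩
      (ℚ.- 1ℚ) ℚ.* 0ℚ
        ≡⟨⟩
      0ℚ ∎
      where
      sign : ∀ c x y → c ℚ.* (x ℚ.- y) ≡ (ℚ.- 1ℚ) ℚ.* (c ℚ.* (y ℚ.+ (ℚ.- 1ℚ) ℚ.* x))
      sign = solve 3 (λ c x y → c :* (x :- y) := con (ℚ.- 1ℚ) :* (c :* (y :+ con (ℚ.- 1ℚ) :* x))) refl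
      factorise : ∀ κ → DG (κ ⊞ τ) ℚ.+ (ℚ.- 1ℚ) ℚ.* DG κ ≡ differences ts (difference τ ⌊ f ⌋) κ
      factorise κ = begin
        DG (κ ⊞ τ) ℚ.+ (ℚ.- 1ℚ) ℚ.* DG κ
          ≡⟨ cong (ℚ._+ (ℚ.- 1ℚ) ℚ.* DG κ) (differences-translate ts τ ⌊ g ⌋ κ) ⟨
        differences ts (λ κ → ⌊ g ⌋ (κ ⊞ τ)) κ ℚ.+ (ℚ.- 1ℚ) ℚ.* DG κ
          ≡⟨ differences-combination ts (ℚ.- 1ℚ) (λ κ → ⌊ g ⌋ (κ ⊞ τ)) ⌊ g ⌋ κ ⟨
        differences ts (λ κ → ⌊ g ⌋ (κ ⊞ τ) ℚ.+ (ℚ.- 1ℚ) ℚ.* ⌊ g ⌋ κ) κ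
          ≡⟨ differences-cong ts (λ κ → begin
               ⌊ g ⌋ (κ ⊞ τ) ℚ.+ (ℚ.- 1ℚ) ℚ.* ⌊ g ⌋ κ
                 ≡⟨ cong₂ (λ x y → x ℚ.+ (ℚ.- 1ℚ) ℚ.* y) (⌊⌋-subtract-translate τ f (κ ⊞ τ)) (⌊⌋-subtract-translate τ f κ) ⟩
               (⌊ f ⌋ (κ ⊞ τ) ℚ.- ⌊ f ⌋ ((κ ⊞ τ) ⊞ ⊟ τ)) ℚ.+ (ℚ.- 1ℚ) ℚ.* (⌊ f ⌋ κ ℚ.- ⌊ f ⌋ (κ ⊞ ⊟ τ))
                 ≡⟨ cong (λ ρ → (⌊ f ⌋ (κ ⊞ τ) ℚ.- ⌊ f ⌋ ρ) ℚ.+ (ℚ.- 1ℚ) ℚ.* (⌊ f ⌋ κ ℚ.- ⌊ f ⌋ (κ ⊞ ⊟ τ))) (⊞-⊟-cancel κ τ) ⟩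
               (⌊ f ⌋ (κ ⊞ τ) ℚ.- ⌊ f ⌋ κ) ℚ.+ (ℚ.- 1ℚ) ℚ.* (⌊ f ⌋ κ ℚ.- ⌊ f ⌋ (κ ⊞ ⊟ τ))
                 ≡⟨ solve 3 (λ x y z → (x :- y) :+ con (ℚ.- 1ℚ) :* (y :- z) := x :+ con -2ℚ :* y :+ z) refl (⌊ f ⌋ (κ ⊞ τ)) (⌊ f ⌋ κ) (⌊ f ⌋ (κ ⊞ ⊟ τ)) ⟩
               difference τ ⌊ f ⌋ κ ∎) κ ⟩
        differences ts (difference τ ⌊ f ⌋) κ ∎

  firstRoots-nonZero : ∀ l → All NonZeroVec (firstRoots l)
  firstRoots-nonZero zero    = []
  firstRoots-nonZero (suc l) = (zero , λ ()) ∷ AllP.map⁺ (All.map (λ {τ} → lem {τ = τ}) (firstRoots-nonZero l))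
    where
    lem : ∀ {l} {τ : Vec ℤ (suc l)} → NonZeroVec τ → NonZeroVec (insert₁ (+ 0) τ)
    lem {τ = x ∷ τ} (zero  , ne) = zero , ne
    lem {τ = x ∷ τ} (suc i , ne) = suc (suc i) , ne

  positiveRoots-nonZero : ∀ l → All NonZeroVec (positiveRoots l)
  positiveRoots-nonZero zero    = []
  positiveRoots-nonZero (suc l) = AllP.++⁺ (firstRoots-nonZero l)
    (AllP.map⁺ (All.map (λ { (i , ne) → suc i , ne }) (positiveRoots-nonZero l)))

  -- Functionals killing all X_{-λ}

  VanishesAbove : Functional → ℤ → Set
  VanishesAbove φ z = ∀ μ → z ℤ.< + weight μ → φ μ ≡ 0ℚ

  vectorSum : ∀ {l} → Vec ℤ l → ℤ
  vectorSum []       = + 0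
  vectorSum (x ∷ xs) = x ℤ.+ vectorSum xs

  H-vanishesAbove : ∀ {φ z} → Resp φ → VanishesAbove φ z → ∀ j → VanishesAbove (H j φ) (z ℤ.- j)
  H-vanishesAbove {φ} {z} r v j μ lt = H-vanishes r (λ ν eq → v ν (subst (z ℤ.<_) (sym eq) lt′)) j μ refl
    where
    lem : ∀ (z j : ℤ) → z ℤ.- j ℤ.+ j ≡ z
    lem = ℤRing.solve-∀
    lt′ : z ℤ.< + weight μ ℤ.+ j
    lt′ = subst (ℤ._< + weight μ ℤ.+ j) (lem z j) (ℤP.+-monoˡ-< j lt)

  e-vanishesAbove : ∀ {l φ z} → Resp φ → VanishesAbove φ z → ∀ (κs : Vec ℤ l) → z ℤ.< vectorSum κs → e φ κs ≡ 0ℚ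
  e-vanishesAbove r v []       lt = v [] lt
  e-vanishesAbove {z = z} r v (κ ∷ κs) lt = e-vanishesAbove (H.E-resp κ r) (H-vanishesAbove r v κ) κs
    (subst (z ℤ.- κ ℤ.<_) (lem κ (vectorSum κs)) (ℤP.+-monoˡ-< (ℤ.- κ) lt))
    where
    lem : ∀ (k s : ℤ) → k ℤ.+ s ℤ.- k ≡ s
    lem = ℤRing.solve-∀

  -- h₀ = 1 removes its variable and leaves the case of one variable fewer, while a negative index
  -- gives zero.
  e-nonpositive : ∀ {l φ} → Resp φ → (∀ (κs : Vec ℤ l) → e φ κs ≡ 0ℚ) → ∀ (κs : Vec ℤ (suc l)) → VecAny.Any (ℤ._≤ + 0) κs → e φ κs ≡ 0ℚ
  e-nonpositive {φ = φ} r v (+ zero   ∷ κs) (here le) = trans (e-cong (H.E-zero φ) κs) (v κs)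
  e-nonpositive {φ = φ} r v (+ suc k  ∷ κs) (here (ℤ.+≤+ ()))
  e-nonpositive {φ = φ} r v (-[1+ k ] ∷ κs) (here le) = e-zero (λ ν → refl) κs
  e-nonpositive {suc l} r v (κ ∷ κs) (there i) = e-nonpositive (H.E-resp κ r) (λ κs → v (κ ∷ κs)) κs i

  Bounded : ℕ → ℤ → Set
  Bounded N x = + 1 ℤ.≤ x × x ℤ.≤ + N

  -- In the first two cases `e φ` vanishes, by `e-nonpositive` or because the weight exceeds the
  -- bound. What remains is finite.
  classify : ∀ {l} N (κs : Vec ℤ l) → VecAny.Any (ℤ._≤ + 0) κs ⊎ (+ N ℤ.< vectorSum κs) ⊎ VecAll.All (Bounded N) κs
  classify N κs with positive? κs
    where
    positive? : ∀ {l} (κs : Vec ℤ l) → VecAny.Any (ℤ._≤ + 0) κs ⊎ VecAll.All (+ 1 ℤ.≤_) κs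
    positive? []              = inj₂ []
    positive? (+ zero ∷ κs)   = inj₁ (here ℤP.≤-refl)
    positive? (-[1+ _ ] ∷ κs) = inj₁ (here ℤ.-≤+)
    positive? (+ suc k ∷ κs) with positive? κs
    ... | inj₁ i  = inj₁ (there i)
    ... | inj₂ ps = inj₂ (ℤ.+≤+ (s≤s z≤n) ∷ ps)
  ... | inj₁ i = inj₁ i
  ... | inj₂ ps with + N ℤ.<? vectorSum κs
  ...   | yes lt = inj₂ (inj₁ lt)
  ...   | no ≮   = inj₂ (inj₂ (bounds κs ps (ℤP.≮⇒≥ ≮)))
    where
    0≤sum : ∀ {l} {κs : Vec ℤ l} → VecAll.All (+ 1 ℤ.≤_) κs → + 0 ℤ.≤ vectorSum κs
    0≤sum []       = ℤP.≤-refl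
    0≤sum (p ∷ ps) = ℤP.+-mono-≤ (ℤP.≤-trans (ℤ.+≤+ z≤n) p) (0≤sum ps)
    bounds : ∀ {l} (κs : Vec ℤ l) → VecAll.All (+ 1 ℤ.≤_) κs → vectorSum κs ℤ.≤ + N → VecAll.All (Bounded N) κs
    bounds []       []       le = []
    bounds (κ ∷ κs) (p ∷ ps) le =
      (p , ℤP.≤-trans (subst (ℤ._≤ κ ℤ.+ vectorSum κs) (ℤP.+-identityʳ κ) (ℤP.+-monoʳ-≤ κ (0≤sum ps))) le) ∷
      bounds κs ps (ℤP.≤-trans (subst (ℤ._≤ κ ℤ.+ vectorSum κs) (ℤP.+-identityˡ (vectorSum κs))
        (ℤP.+-monoˡ-≤ (vectorSum κs) (ℤP.≤-trans (ℤ.+≤+ z≤n) p))) le)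

  cube : ℕ → ∀ l → List (Vec ℤ l)
  cube N zero    = [] ∷ []
  cube N (suc l) = concatMap (λ k → map (+ suc k ∷_) (cube N l)) (upTo N)

  ∈-cube : ∀ N {l} (κs : Vec ℤ l) → VecAll.All (Bounded N) κs → κs ∈ cube N l
  ∈-cube N []               []       = here refl
  ∈-cube N (+ suc k  ∷ κs) ((_ , ℤ.+≤+ le) ∷ bs) = ∈-concatMap⁺ (λ k → map (+ suc k ∷_) (cube N _))
    (Any.map (λ { refl → ∈-map⁺ (+ suc k ∷_) (∈-cube N κs bs) }) (∈-upTo⁺ le))
  ∈-cube N (+ zero   ∷ κs) ((ℤ.+≤+ () , _) ∷ bs)
  ∈-cube N (-[1+ k ] ∷ κs) ((() , _) ∷ bs)

  cube-positive : ∀ N l {κs} → κs ∈ cube N l → VecAll.All (+ 1 ℤ.≤_) κs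
  cube-positive N zero    (here refl) = []
  cube-positive N (suc l) i with Any.satisfied (∈-concatMap⁻ (λ k → map (+ suc k ∷_) (cube N l)) {xs = upTo N} i)
  ... | k , j with ∈-map⁻ (+ suc k ∷_) j
  ...   | κs , j′ , refl = ℤ.+≤+ (s≤s z≤n) ∷ cube-positive N l j′

  composition : ∀ {l} (κs : Vec ℤ l) → VecAll.All (+ 1 ℤ.≤_) κs →
    ∃ λ ks → All (1 ℕ.≤_) ks × Σ (length ks ≡ l) λ eq → subst (Vec ℤ) eq (exponents 0 ks) ≡ κs
  composition []              []       = [] , [] , refl , refl
  composition (+ k ∷ κs) (ℤ.+≤+ p ∷ ps) with composition κs ps
  ... | ks , pos , refl , refl = k ∷ ks , p ∷ pos , refl , cong (_∷ exponents 0 ks) (cong +_ (ℕP.+-identityʳ k))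

  AnnihilatesX : Functional → Set
  AnnihilatesX φ = ∀ (λ′ : Partition) → ⟪ φ , Xprod 1 (proj₁ λ′) (ℤ.- + length (proj₁ λ′)) vacuumVec ⟫ ≡ 0ℚ

  -- The exponents may come in any order; `Xprod-↭` replaces them by the partition with the same
  -- parts.
  differences-vanish : ∀ {φ} → Resp φ → AnnihilatesX φ → ∀ {l} (κs : Vec ℤ l) → VecAll.All (+ 1 ℤ.≤_) κs →
    differences (positiveRoots l) (e φ) κs ≡ 0ℚ
  differences-vanish {φ} r ann κs ps with composition κs ps
  ... | ks , pos , refl , refl with rearrange ks pos
  ...   | λ′ , p = begin
    differences (positiveRoots (length ks)) (e φ) (exponents 0 ks)
      ≡⟨ Xprod-differences ks 0 (ℤ.- + length ks) (sym (z-z≡0 (ℤ.- + length ks))) r ⟨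
    ⟪ φ , Xprod 1 ks (ℤ.- + length ks) vacuumVec ⟫
      ≡⟨ Xprod-↭ (ℤ.- + length ks) p r ⟨
    ⟪ φ , Xprod 1 (proj₁ λ′) (ℤ.- + length ks) vacuumVec ⟫
      ≡⟨ cong (λ l → ⟪ φ , Xprod 1 (proj₁ λ′) (ℤ.- + l) vacuumVec ⟫) (PermP.↭-length p) ⟨
    ⟪ φ , Xprod 1 (proj₁ λ′) (ℤ.- + length (proj₁ λ′)) vacuumVec ⟫
      ≡⟨ ann λ′ ⟩
    0ℚ ∎

  e-vanishes : ∀ {φ N} → Resp φ → VanishesAbove φ (+ N) → AnnihilatesX φ → ∀ l (κs : Vec ℤ l) → e φ κs ≡ 0ℚ
  e-vanishes {φ} {N} r v ann l κs = trans (sym (⌊f⌋≡e κs))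
    (differences-definite (positiveRoots l) (positiveRoots-nonZero l) f pair≡0 κs)
    where
    points : List (Vec ℤ l)
    points = deduplicate _≟ᵛ_ (cube N l)
    -- A finite stand-in for `e φ`: by `outside`, the listed points include all exponents at which
    -- it can be nonzero.
    f : Laurent l
    f = map (λ κs → e φ κs , κs) points
    outside : ∀ κs → ¬ (κs ∈ points) → e φ κs ≡ 0ℚ
    outside κs ∉ with classify N κs
    -- The induction on the number of variables enters here.
    ... | inj₁ i         = nonpositive l κs i
      where
      nonpositive : ∀ l (κs : Vec ℤ l) → VecAny.Any (ℤ._≤ + 0) κs → e φ κs ≡ 0ℚ
      nonpositive (suc l) κs i = e-nonpositive r (e-vanishes r v ann l) κs i
    ... | inj₂ (inj₁ lt) = e-vanishesAbove r v κs lt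
    ... | inj₂ (inj₂ bs) = ⊥-elim (∉ (∈-deduplicate⁺ _≟ᵛ_ (∈-cube N κs bs)))
    open import Data.List.Membership.DecPropositional (_≟ᵛ_ {l}) using (_∈?_)
    pair-f : ∀ F → pair f F ≡ ∑ points (λ κs → e φ κs ℚ.* F κs)
    pair-f F = ∑-map (λ κs → e φ κs , κs) points _
    ⌊f⌋≡e : ∀ κs → ⌊ f ⌋ κs ≡ e φ κs
    ⌊f⌋≡e κs with κs ∈? points
    ... | yes i = begin
      ⌊ f ⌋ κs
        ≡⟨ pair-f (λ ν → indicator (ν ≟ᵛ κs)) ⟩
      ∑ points (λ ν → e φ ν ℚ.* indicator (ν ≟ᵛ κs))
        ≡⟨ ∑-single (λ ν → e φ ν ℚ.* indicator (ν ≟ᵛ κs)) (UniqueDec.deduplicate-! _≟ᵛ_ (cube N l)) i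
             (λ ν ne → trans (cong (e φ ν ℚ.*_) (indicator-no (ν ≟ᵛ κs) ne)) (ℚP.*-zeroʳ (e φ ν))) ⟩
      e φ κs ℚ.* indicator (κs ≟ᵛ κs)
        ≡⟨ trans (cong (e φ κs ℚ.*_) (indicator-yes (κs ≟ᵛ κs) refl)) (ℚP.*-identityʳ (e φ κs)) ⟩
      e φ κs ∎
    ... | no ∉ = trans (pair-f (λ ν → indicator (ν ≟ᵛ κs))) (trans
        (∑-zero-All (All.tabulate (λ {ν} i → trans (cong (e φ ν ℚ.*_) (indicator-no (ν ≟ᵛ κs) (λ { refl → ∉ i }))) (ℚP.*-zeroʳ (e φ ν)))))
        (sym (outside κs ∉)))
    pair≡0 : pair f (differences (positiveRoots l) ⌊ f ⌋) ≡ 0ℚ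
    pair≡0 = begin
      pair f (differences (positiveRoots l) ⌊ f ⌋)
        ≡⟨ pair-cong f (differences-cong (positiveRoots l) ⌊f⌋≡e) ⟩
      pair f (differences (positiveRoots l) (e φ))
        ≡⟨ pair-f (differences (positiveRoots l) (e φ)) ⟩
      ∑ points (λ κs → e φ κs ℚ.* differences (positiveRoots l) (e φ) κs)
        ≡⟨ ∑-zero-All (All.tabulate (λ {κs} i → trans (cong (e φ κs ℚ.*_)
             (differences-vanish r ann κs (cube-positive N l (∈-deduplicate⁻ _≟ᵛ_ (cube N l) i)))) (ℚP.*-zeroʳ (e φ κs)))) ⟩
      0ℚ ∎

  Annihilatesh : Functional → Set
  Annihilatesh φ = ∀ {l} (κs : Vec ℤ l) → e φ κs ≡ 0ℚ

  -- Newton's identity expresses p_{n+1} through the h_j and the p_{i+1} with i < n.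
  P-annihilatesh : ∀ n {φ} → Resp φ → Annihilatesh φ → Annihilatesh (P n φ)
  P-annihilatesh = <-rec (λ n → ∀ {φ} → Resp φ → Annihilatesh φ → Annihilatesh (P n φ)) step
    where
    step : ∀ n → (∀ {i} → i ℕ.< n → ∀ {φ} → Resp φ → Annihilatesh φ → Annihilatesh (P i φ)) →
           ∀ {φ} → Resp φ → Annihilatesh φ → Annihilatesh (P n φ)
    step n ih {φ} r ann κs = begin
      e (P n φ) κs
        -- The term i = n of the recurrence for h_(n+1) carries h₀ = 1, so it is `P n φ`. For i < n
        -- the induction hypothesis applies to `H (z - (i + 1)) φ`, which kills the complete
        -- symmetric functions as well.
        ≡⟨ e-cong (λ ν → trans (cong (λ z → H z φ (incr (suc n) ν)) (ℤP.+-inverseʳ z)) (H.E-zero φ (incr (suc n) ν))) κs ⟨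
      e (term n) κs
        ≡⟨ ℚP.+-identityˡ _ ⟨
      0ℚ ℚ.+ e (term n) κs
        ≡⟨ cong (ℚ._+ e (term n) κs) (∑-zero-All (All.map (λ {i} i<n → ih i<n (H.E-resp (z ℤ.- + suc i) r) (λ κs → ann ((z ℤ.- + suc i) ∷ κs)) κs) (upTo-< n))) ⟨
      ∑ (upTo n) (λ i → e (term i) κs) ℚ.+ e (term n) κs
        ≡⟨ ∑-upTo-last n (λ i → e (term i) κs) ⟨
      ∑ (upTo (suc n)) (λ i → e (term i) κs)
        ≡⟨ ∑-cong (upTo (suc n)) (λ i → ℚP.*-identityˡ (e (term i) κs)) ⟨
      ∑ (upTo (suc n)) (λ i → 1ℚ ℚ.* e (term i) κs)
        ≡⟨ e-linear-sum (upTo (suc n)) (λ _ → 1ℚ) term κs ⟨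
      e (λ ν → ∑ (upTo (suc n)) (λ i → 1ℚ ℚ.* term i ν)) κs
        ≡⟨ e-cong (λ ν → trans (∑-cong (upTo (suc n)) (λ i → ℚP.*-identityˡ (term i ν))) (sym (H-rec (suc n) z φ ν r ℤP.≤-refl))) κs ⟩
      e (λ ν → toℚ z ℚ.* H z φ ν) κs
        ≡⟨ e-cong (λ ν → sym (ℚP.+-identityʳ (toℚ z ℚ.* H z φ ν))) κs ⟩
      e (λ ν → ∑ (z ∷ []) (λ z → toℚ z ℚ.* H z φ ν)) κs
        ≡⟨ e-linear-sum (z ∷ []) toℚ (λ z → H z φ) κs ⟩
      toℚ z ℚ.* e φ (z ∷ κs) ℚ.+ 0ℚ
        ≡⟨ cong (λ x → toℚ z ℚ.* x ℚ.+ 0ℚ) (ann (z ∷ κs)) ⟩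
      toℚ z ℚ.* 0ℚ ℚ.+ 0ℚ
        ≡⟨ trans (ℚP.+-identityʳ _) (ℚP.*-zeroʳ (toℚ z)) ⟩
      0ℚ ∎
      where
      z : ℤ
      z = + suc n
      term : ℕ → Functional
      term i = P i (H (z ℤ.- + suc i) φ)
      upTo-< : ∀ n → All (ℕ._< n) (upTo n)
      upTo-< n = All.tabulate ∈-upTo⁻

  -- One power sum is peeled off at a time: the value of `φ` at p_(n+1) p_μ is that of `P n φ` at
  -- p_μ, and `P n φ` inherits the hypothesis. At the empty monomial the product of no h's decides.
  annihilatesh⇒zero : ∀ μ {φ} → Resp φ → Annihilatesh φ → φ μ ≡ 0ℚ
  annihilatesh⇒zero = mono-induction (λ μ → ∀ {φ} → Resp φ → Annihilatesh φ → φ μ ≡ 0ℚ)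
    (λ eq z r ann → trans (r (≃-sym eq)) (z r ann))
    (λ r ann → ann [])
    (λ n μ z {φ} r ann → z (P-resp n r) (P-annihilatesh n r ann))

  nondegenerate : ∀ {φ N} → Resp φ → (∀ μ → N ℕ.< weight μ → φ μ ≡ 0ℚ) → AnnihilatesX φ → ∀ μ → φ μ ≡ 0ℚ
  nondegenerate {φ} r v ann μ = annihilatesh⇒zero μ r (λ {l} → e-vanishes r (λ { μ (ℤ.+<+ lt) → v μ lt }) ann l)

open VertexOperators

-- The basis

module Kᴿ = CommutativeRing K-commutativeRing
module KS = ListSum K-commutativeRing
module KΣ = SemiringSum Kᴿ.semiring
import Relation.Binary.Reasoning.Setoid Kᴿ.setoid as ≈-Reasoning

∑-tabulate : ∀ {n} {A : Set} (g : Fin n → A) (h : A → ℚ) → ∑ (tabulate g) h ≡ ℚΣ.sum (h ∘ g)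
∑-tabulate {zero}  g h = refl
∑-tabulate {suc n} g h = cong (h (g Fin.zero) ℚ.+_) (∑-tabulate (g ∘ Fin.suc) h)

∑ᴷ-tabulate : ∀ {n} {A : Set} (g : Fin n → A) (h : A → K) → KS.∑ (tabulate g) h ≡ KΣ.sum (h ∘ g)
∑ᴷ-tabulate {zero}  g h = refl
∑ᴷ-tabulate {suc n} g h = cong (h (g Fin.zero) +ᴷ_) (∑ᴷ-tabulate (g ∘ Fin.suc) h)

_≟ˢ_ : (ν μ : Mono) → Dec (strip ν ≡ strip μ)
ν ≟ˢ μ = LP.≡-dec ℕ._≟_ (strip ν) (strip μ)

coefficient : Mono → Functional
coefficient μ ν = indicator (ν ≟ˢ μ)

coefficient-resp : ∀ μ → Resp (coefficient μ)
coefficient-resp μ {ν} {ν′} e = indicator-⇔ (ν ≟ˢ μ) (ν′ ≟ˢ μ) (trans (sym (≃⇒strip≡ e))) (trans (≃⇒strip≡ e))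

coefficient-vanishesAt : ∀ μ n → weight μ ≢ n → VanishesAt (coefficient μ) (+ n)
coefficient-vanishesAt μ n ne ν e = indicator-no (ν ≟ˢ μ) (λ s → ne (trans (sym (weight-cong (strip≡⇒≃ {ν} {μ} s))) (ℤP.+-injective e)))

coeffℚ≡pairing : ∀ v μ → coeffℚ v μ ≡ ⟪ coefficient μ , v ⟫
coeffℚ≡pairing []            μ = refl
coeffℚ≡pairing ((c , ν) ∷ v) μ = trans (step (ν ≟ˢ μ) (coeffℚ v μ)) (cong (c ℚ.* coefficient μ ν ℚ.+_) (coeffℚ≡pairing v μ))
  where
  step : ∀ {A : Set} (D : Dec A) x → (if isYes D then c ℚ.+ x else x) ≡ c ℚ.* indicator D ℚ.+ x
  step (yes _) x = cong (ℚ._+ x) (sym (ℚP.*-identityʳ c))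
  step (no _)  x = trans (sym (ℚP.+-identityˡ x)) (cong (ℚ._+ x) (sym (ℚP.*-zeroʳ c)))

coeffℚ-target : ∀ a (λ′ : Partition) μ →
  coeffℚ (target a λ′) μ ≡ cCoefInv (length (proj₁ λ′)) a ℚ.* ⟪ coefficient μ , Xprod a (proj₁ λ′) (ℤ.- + length (proj₁ λ′)) vacuumVec ⟫
coeffℚ-target a λ′ μ = trans (coeffℚ≡pairing (target a λ′) μ) (pairing-scaleV (coefficient μ) (cCoefInv (length (proj₁ λ′)) a) (Xprod a (proj₁ λ′) (ℤ.- + length (proj₁ λ′)) vacuumVec))

target-homogeneous : ∀ a (λ′ : Partition) μ → weight μ ≢ sum (proj₁ λ′) → coeffℚ (target (suc a) λ′) μ ≡ 0ℚ
target-homogeneous a λ′@(ks , _) μ ne = trans (coeffℚ-target (suc a) λ′ μ)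
  (trans (cong (cCoefInv (length ks) (suc a) ℚ.*_)
     (Operators.Xprod-vacuum-homogeneous a ks (coefficient-resp μ) (coefficient-vanishesAt μ (sum ks) ne)))
    (ℚP.*-zeroʳ (cCoefInv (length ks) (suc a))))

cCoefInv≢0 : ∀ s → cCoefInv s 1 ≢ 0ℚ
cCoefInv≢0 s = frac≢0 ((s ℕ.* 1) !) (ℕP._!≢0 (s ℕ.* 1))
    (λ e → sign≢0 ((s ℕ.* (s ℕ.∸ 1) ℕ./ 2) ℕ.* 1) (ℤP.*-cancelʳ-≡ _ (+ 0) (+ ((1 !) ℕ.^ s)) {{one}} (trans e (sym (ℤP.*-zeroˡ (+ ((1 !) ℕ.^ s)))))))
  where
  one : ℤ.NonZero (+ ((1 !) ℕ.^ s))
  one = subst (λ n → ℤ.NonZero (+ n)) (sym (ℕP.^-zeroˡ s)) _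
  sign≢0 : ∀ n → (ℤ.- + 1) ℤ.^ n ≢ + 0
  sign≢0 zero    ()
  sign≢0 (suc n) e = sign≢0 n (ℤP.*-cancelˡ-≡ (ℤ.- + 1) ((ℤ.- + 1) ℤ.^ n) (+ 0) e)
  frac≢0 : ∀ d → ℕ.NonZero d → ∀ {z} → z ≢ + 0 → frac z d ≢ 0ℚ
  frac≢0 (suc d) _ {z} z≢0 e = toℚ≢0 z≢0 (trans (sym (frac-cancel z d)) (trans (cong (ℚ._* fromℕ (suc d)) e) (ℚP.*-zeroˡ (fromℕ (suc d)))))

valid-0 : ValidR 0ᵣ
valid-0 = proj₂ 0ᴷ

coeff-valid : ∀ f → ValidΛ f → ∀ μ → ValidR (coeffᵣ f μ)
coeff-valid []            []       μ = valid-0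
coeff-valid ((c , ν) ∷ f) (v ∷ vs) μ = by-bool (isYes (ν ≟ˢ μ))
  where
  by-bool : ∀ b → ValidR (if b then c +ᵣ coeffᵣ f μ else coeffᵣ f μ)
  by-bool true  = NonZeroPoly-* (den c) (den (coeffᵣ f μ)) v (coeff-valid f vs μ)
  by-bool false = coeff-valid f vs μ

coeffᴷ : ∀ f → ValidΛ f → Mono → K
coeffᴷ f v μ = coeffᵣ f μ , coeff-valid f v μ

-- The validity of the concatenation is a separate argument: `≈ᴷ` does not see it, and callers
-- receive it from outside.
coeffᴷ-++ : ∀ f g v w u μ → coeffᴷ (f ++ g) u μ ≈ᴷ (coeffᴷ f v μ +ᴷ coeffᴷ g w μ)
coeffᴷ-++ []            g []       w u        μ = mk (un (Kᴿ.sym (Kᴿ.+-identityˡ (coeffᴷ g w μ))))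
coeffᴷ-++ ((c , ν) ∷ f) g (x ∷ v) w (y ∷ u) μ = mk (by-bool (isYes (ν ≟ˢ μ)))
  where
  cᴷ : K
  cᴷ = c , x
  ih = coeffᴷ-++ f g v w u μ
  by-bool : ∀ b → (if b then c +ᵣ coeffᵣ (f ++ g) μ else coeffᵣ (f ++ g) μ) ≈ᵣ
                  ((if b then c +ᵣ coeffᵣ f μ else coeffᵣ f μ) +ᵣ coeffᵣ g μ)
  by-bool true  = un (Kᴿ.trans (Kᴿ.+-congˡ {cᴷ} ih) (Kᴿ.sym (Kᴿ.+-assoc cᴷ (coeffᴷ f v μ) (coeffᴷ g w μ))))
  by-bool false = un ih

scale-valid : ∀ c f → ValidR c → ValidΛ f → ValidΛ (scaleΛ c f)
scale-valid c []            v []       = []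
scale-valid c ((d , ν) ∷ f) v (w ∷ ws) = NonZeroPoly-* (den c) (den d) v w ∷ scale-valid c f v ws

coeffᴷ-scale : ∀ c f (x : ValidR c) v u μ → coeffᴷ (scaleΛ c f) u μ ≈ᴷ ((c , x) *ᴷ coeffᴷ f v μ)
coeffᴷ-scale c []            x []      u        μ = mk (un (Kᴿ.sym (Kᴿ.zeroʳ (c , x))))
coeffᴷ-scale c ((d , ν) ∷ f) x (y ∷ v) (z ∷ u) μ = mk (by-bool (isYes (ν ≟ˢ μ)))
  where
  ih = coeffᴷ-scale c f x v u μ
  by-bool : ∀ b → (if b then (c *ᵣ d) +ᵣ coeffᵣ (scaleΛ c f) μ else coeffᵣ (scaleΛ c f) μ) ≈ᵣ
                  (c *ᵣ (if b then d +ᵣ coeffᵣ f μ else coeffᵣ f μ))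
  by-bool true  = un (Kᴿ.trans (Kᴿ.+-congˡ {(c , x) *ᴷ (d , y)} ih) (Kᴿ.sym (Kᴿ.distribˡ (c , x) (d , y) (coeffᴷ f v μ))))
  by-bool false = un ih

coeffᵣ-strip : ∀ f {μ ν} → strip μ ≡ strip ν → coeffᵣ f μ ≡ coeffᵣ f ν
coeffᵣ-strip []            e = refl
coeffᵣ-strip ((c , ρ) ∷ f) e =
  cong₂ (λ s x → if isYes (LP.≡-dec ℕ._≟_ (strip ρ) s) then c +ᵣ x else x) e (coeffᵣ-strip f e)

coeffᵣ-absent : ∀ f μ → All (λ x → strip (proj₂ x) ≢ strip μ) f → coeffᵣ f μ ≡ 0ᵣ
coeffᵣ-absent []            μ []         = refl
coeffᵣ-absent ((c , ν) ∷ f) μ (ne ∷ nes) = by-dec (ν ≟ˢ μ)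
  where
  by-dec : (D : Dec (strip ν ≡ strip μ)) → (if isYes D then c +ᵣ coeffᵣ f μ else coeffᵣ f μ) ≡ 0ᵣ
  by-dec (yes e) = ⊥-elim (ne e)
  by-dec (no _)  = coeffᵣ-absent f μ nes

lookup-injective : ∀ {A : Set} {xs : List A} → Unique xs → ∀ i j → lookup xs i ≡ lookup xs j → i ≡ j
lookup-injective (x∉ ∷ u) Fin.zero    Fin.zero    e = refl
lookup-injective (x∉ ∷ u) Fin.zero    (Fin.suc j) e = ⊥-elim (All.lookup x∉ (∈-lookup j) e)
lookup-injective (x∉ ∷ u) (Fin.suc i) Fin.zero    e = ⊥-elim (All.lookup x∉ (∈-lookup i) (sym e))
lookup-injective (x∉ ∷ u) (Fin.suc i) (Fin.suc j) e = cong Fin.suc (lookup-injective u i j e)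

-- Rows and columns are indexed by the same list of partitions, which makes the matrix square
-- without counting.
module Truncation (N : ℕ) where
  ps : List Partition
  ps = partitionsUpTo N

  n : ℕ
  n = length ps

  part : Fin n → Partition
  part = lookup ps

  mono : Fin n → Mono
  mono j = toMono (proj₁ (part j))

  part-sum : ∀ i → sum (proj₁ (part i)) ℕ.≤ N
  part-sum i = partitionsUpTo-sum N (∈-lookup i)

  mono-weight : ∀ i → weight (mono i) ℕ.≤ N
  mono-weight i = subst (ℕ._≤ N) (sym (weight-toMono (proj₁ (part i)))) (part-sum i)

  mono-strip-injective : ∀ i j → strip (mono i) ≡ strip (mono j) → i ≡ j
  mono-strip-injective i j e = lookup-injective (partitionsUpTo-unique N) i j (partition-≡
    (toMono-injective (proj₁ (part i)) (proj₁ (part j)) (proj₂ (part i)) (proj₂ (part j)) (strip≡⇒≃ {mono i} {mono j} e)))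

  specialised : Fin n → Fin n → ℚ
  specialised i j = coeffℚ (target 1 (part i)) (mono j)

  -- A kernel vector is read as a functional φ on power sums. It kills the vectors of the partitions
  -- of size at most `N` by the kernel equations, after cancelling the nonzero normalising constant,
  -- and the larger ones by homogeneity. So `nondegenerate` applies.
  kernel-free : ∀ (x : Fin n → ℚ) → (∀ i → ℚΣ.sum (λ j → specialised i j ℚ.* x j) ≡ 0ℚ) → ∀ j → x j ≡ 0ℚ
  kernel-free x ker i = begin
    x i
      ≡⟨ trans (cong (x i ℚ.*_) (indicator-yes (mono i ≟ˢ mono i) refl)) (ℚP.*-identityʳ (x i)) ⟨
    x i ℚ.* coefficient (mono i) (mono i)
      ≡⟨ ∑-single (λ j → x j ℚ.* coefficient (mono j) (mono i)) (allFin⁺ n) (∈-allFin i) (λ j j≢i →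
           trans (cong (x j ℚ.*_) (indicator-no (mono i ≟ˢ mono j) (λ e → j≢i (sym (mono-strip-injective i j e))))) (ℚP.*-zeroʳ (x j))) ⟨
    φ (mono i)
      ≡⟨ nondegenerate {φ} {N} φ-resp φ-above φ-annihilates (mono i) ⟩
    0ℚ ∎
    where
    open ≡-Reasoning
    φ : Functional
    φ μ = ∑ (allFin n) (λ j → x j ℚ.* coefficient (mono j) μ)
    φ-resp : Resp φ
    φ-resp e = ∑-cong (allFin n) (λ j → cong (x j ℚ.*_) (coefficient-resp (mono j) e))
    φ-outside : ∀ μ → (∀ j → weight μ ≢ weight (mono j)) → φ μ ≡ 0ℚ
    φ-outside μ ne = trans (∑-cong (allFin n) (λ j → trans (cong (x j ℚ.*_)
      (indicator-no (μ ≟ˢ mono j) (λ e → ne j (weight-cong (strip≡⇒≃ {μ} {mono j} e))))) (ℚP.*-zeroʳ (x j)))) (∑-zero (allFin n))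
    φ-above : ∀ μ → N ℕ.< weight μ → φ μ ≡ 0ℚ
    φ-above μ lt = φ-outside μ (λ j e → ℕP.<-irrefl refl (ℕP.<-≤-trans lt (ℕP.≤-trans (ℕP.≤-reflexive e) (mono-weight j))))
    pairing-φ : ∀ v → ⟪ φ , v ⟫ ≡ ∑ (allFin n) (λ j → x j ℚ.* ⟪ coefficient (mono j) , v ⟫)
    pairing-φ v = pairing-sum (allFin n) x (λ j → coefficient (mono j)) v
    row : ∀ i → ⟪ φ , target 1 (part i) ⟫ ≡ 0ℚ
    row i = begin
      ⟪ φ , target 1 (part i) ⟫
        ≡⟨ pairing-φ (target 1 (part i)) ⟩
      ∑ (allFin n) (λ j → x j ℚ.* ⟪ coefficient (mono j) , target 1 (part i) ⟫)
        ≡⟨ ∑-cong (allFin n) (λ j → trans (cong (x j ℚ.*_) (sym (coeffℚ≡pairing (target 1 (part i)) (mono j)))) (ℚP.*-comm (x j) (specialised i j))) ⟩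
      ∑ (allFin n) (λ j → specialised i j ℚ.* x j)
        ≡⟨ ∑-tabulate (λ j → j) (λ j → specialised i j ℚ.* x j) ⟩
      ℚΣ.sum (λ j → specialised i j ℚ.* x j)
        ≡⟨ ker i ⟩
      0ℚ ∎
    φ-annihilates : AnnihilatesX φ
    φ-annihilates λ′@(ks , _) = by-cases (sum ks ℕ.≤? N)
      where
      v : FVec
      v = Xprod 1 ks (ℤ.- + length ks) vacuumVec
      by-cases : Dec (sum ks ℕ.≤ N) → ⟪ φ , v ⟫ ≡ 0ℚ
      by-cases (yes le) = *≡0⇒ (cCoefInv≢0 (length ks)) (trans (sym (pairing-scaleV φ (cCoefInv (length ks) 1) v))
          (subst (λ p → ⟪ φ , target 1 p ⟫ ≡ 0ℚ) (sym (lookup-index λ′∈)) (row (index λ′∈))))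
        where λ′∈ = ∈-partitionsUpTo N λ′ le
      by-cases (no gt) = Operators.Xprod-vacuum-homogeneous 0 ks φ-resp
        (λ μ e → φ-above μ (subst (N ℕ.<_) (sym (ℤP.+-injective e)) (ℕP.≰⇒> gt)))

module Main (X′ : Partition → Λα) (isX′ : ∀ λ′ → IsXPrime λ′ (X′ λ′)) where
  entry : Partition → Mono → K
  entry λ′ = coeffᴷ (X′ λ′) (proj₁ (isX′ λ′))

  entry-homogeneous : ∀ λ′ μ → weight μ ≢ sum (proj₁ λ′) → entry λ′ μ ≈ᴷ 0ᴷ
  entry-homogeneous λ′ μ ne = vanishing-specialisations⇒≈0 (entry λ′ μ) (λ a →
    subst (Spec (suc a) (entry λ′ μ)) (target-homogeneous a λ′ μ ne) (proj₂ (isX′ λ′) a μ))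

  Terms : Set
  Terms = List (RatFun × Partition)

  ValidTerms : Terms → Set
  ValidTerms = All (λ t → ValidR (proj₁ t))

  linComb-valid : ∀ cs → ValidTerms cs → ValidΛ (linComb X′ cs)
  linComb-valid []              []       = []
  linComb-valid ((c , λ′) ∷ cs) (v ∷ vs) = AllP.++⁺ (scale-valid c (X′ λ′) v (proj₁ (isX′ λ′))) (linComb-valid cs vs)

  terms : ∀ cs → ValidTerms cs → List (K × Partition)
  terms []              []       = []
  terms ((c , λ′) ∷ cs) (v ∷ vs) = ((c , v) , λ′) ∷ terms cs vs

  coeffᴷ-linComb : ∀ cs vs u μ → coeffᴷ (linComb X′ cs) u μ ≈ᴷ KS.∑ (terms cs vs) (λ { (c , λ′) → c *ᴷ entry λ′ μ })
  coeffᴷ-linComb []              []       u μ = mk (≈ᵣ-refl {0ᵣ})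
  coeffᴷ-linComb ((c , λ′) ∷ cs) (v ∷ vs) u μ = Kᴿ.trans
    (coeffᴷ-++ (scaleΛ c (X′ λ′)) (linComb X′ cs) sv lv u μ)
    (Kᴿ.+-cong {coeffᴷ (scaleΛ c (X′ λ′)) sv μ} {(c , v) *ᴷ entry λ′ μ}
      (coeffᴷ-scale c (X′ λ′) v (proj₁ (isX′ λ′)) sv μ) (coeffᴷ-linComb cs vs lv μ))
    where
    sv = scale-valid c (X′ λ′) v (proj₁ (isX′ λ′))
    lv = linComb-valid cs vs

  module _ (N : ℕ) where
    open Truncation N
    open Elimination K-commutativeRing

    basis : (∀ (w : Fin n → K) → Σ (Fin n → K) λ c → ∀ j → KΣ.sum (λ i → c i *ᴷ entry (part i) (mono j)) ≈ᴷ w j) ×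
            (∀ (c : Fin n → K) → (∀ j → KΣ.sum (λ i → c i *ᴷ entry (part i) (mono j)) ≈ᴷ 0ᴷ) → ∀ i → c i ≈ᴷ 0ᴷ)
    basis = kernel-free⇒basis (Spec 1) (λ {x} {y} {p} {q} → Spec-* 1 {x} {y} {p} {q}) (λ {x} {y} {p} {q} → Spec-+ 1 {x} {y} {p} {q}) (λ {x} {p} → Spec-negated-inverse 1 {x} {p})
      n (λ i j → entry (part i) (mono j)) specialised (λ i j → proj₂ (isX′ (part i)) 0 (mono j)) kernel-free

  select : ∀ {A : Set} → Dec A → K → K
  select (yes _) c = c
  select (no _)  c = 0ᴷ

  select-yes : ∀ {A : Set} (D : Dec A) → A → ∀ c → select D c ≈ᴷ c
  select-yes (yes _) a c = Kᴿ.refl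
  select-yes (no ¬a) a c = ⊥-elim (¬a a)

  select-no : ∀ {A : Set} (D : Dec A) → ¬ A → ∀ c → select D c ≈ᴷ 0ᴷ
  select-no (yes a) ¬a c = ⊥-elim (¬a a)
  select-no (no _)  ¬a c = Kᴿ.refl

  -- Elimination wants a coefficient for every partition up to the bound, whereas `ts` is an
  -- arbitrary list. Partitions that do not occur receive 0.
  collect : List (K × Partition) → Partition → K
  collect ts λ₀ = KS.∑ ts (λ { (c , λ′) → select (λ′ ≟ᵖ λ₀) c })

  collect-∑ : ∀ N ts → All (λ t → sum (proj₁ (proj₂ t)) ℕ.≤ N) ts → ∀ μ →
    KS.∑ (partitionsUpTo N) (λ λ₀ → collect ts λ₀ *ᴷ entry λ₀ μ) ≈ᴷ KS.∑ ts (λ { (c , λ′) → c *ᴷ entry λ′ μ })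
  collect-∑ N ts bounds μ = begin
    KS.∑ ps (λ λ₀ → collect ts λ₀ *ᴷ entry λ₀ μ)
      ≈⟨ KS.∑-cong ps (λ λ₀ → Kᴿ.trans (Kᴿ.*-comm (collect ts λ₀) (entry λ₀ μ)) (Kᴿ.sym (KS.∑-* ts (entry λ₀ μ) (λ { (c , λ′) → select (λ′ ≟ᵖ λ₀) c })))) ⟩
    KS.∑ ps (λ λ₀ → KS.∑ ts (λ { (c , λ′) → entry λ₀ μ *ᴷ select (λ′ ≟ᵖ λ₀) c }))
      ≈⟨ KS.∑-swap ps ts (λ { λ₀ (c , λ′) → entry λ₀ μ *ᴷ select (λ′ ≟ᵖ λ₀) c }) ⟩
    KS.∑ ts (λ { (c , λ′) → KS.∑ ps (λ λ₀ → entry λ₀ μ *ᴷ select (λ′ ≟ᵖ λ₀) c) })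
      ≈⟨ KS.∑-cong-All (All.map (λ { {c , λ′} le → term c λ′ le }) bounds) ⟩
    KS.∑ ts (λ { (c , λ′) → c *ᴷ entry λ′ μ }) ∎
    where
    open ≈-Reasoning
    ps = partitionsUpTo N
    term : ∀ c λ′ → sum (proj₁ λ′) ℕ.≤ N → KS.∑ ps (λ λ₀ → entry λ₀ μ *ᴷ select (λ′ ≟ᵖ λ₀) c) ≈ᴷ (c *ᴷ entry λ′ μ)
    term c λ′ le = begin
      KS.∑ ps (λ λ₀ → entry λ₀ μ *ᴷ select (λ′ ≟ᵖ λ₀) c)
        ≈⟨ KS.∑-single (λ λ₀ → entry λ₀ μ *ᴷ select (λ′ ≟ᵖ λ₀) c) (partitionsUpTo-unique N) (∈-partitionsUpTo N λ′ le)
             (λ λ₀ ne → Kᴿ.trans (Kᴿ.*-congˡ {entry λ₀ μ} (select-no (λ′ ≟ᵖ λ₀) (λ e → ne (sym e)) c)) (Kᴿ.zeroʳ (entry λ₀ μ))) ⟩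
      entry λ′ μ *ᴷ select (λ′ ≟ᵖ λ′) c
        ≈⟨ Kᴿ.*-congˡ {entry λ′ μ} (select-yes (λ′ ≟ᵖ λ′) refl c) ⟩
      entry λ′ μ *ᴷ c
        ≈⟨ Kᴿ.*-comm (entry λ′ μ) c ⟩
      c *ᴷ entry λ′ μ ∎

  collect-unique : ∀ ts → Unique (map (λ t → proj₁ (proj₂ t)) ts) → All (λ t → collect ts (proj₂ t) ≈ᴷ proj₁ t) ts
  collect-unique []              []       = []
  collect-unique ((c , λ′) ∷ ts) (∉ ∷ u) =
    Kᴿ.trans (Kᴿ.+-cong {select (λ′ ≟ᵖ λ′) c} (select-yes (λ′ ≟ᵖ λ′) refl c)
      (KS.∑-zero-All (All.map (λ { {d , λ″} ne → select-no (λ″ ≟ᵖ λ′) (λ e → ne (cong proj₁ (sym e))) d }) ∉′))) (Kᴿ.+-identityʳ c) ∷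
    All.zipWith (λ { {d , λ″} (ne , eq) → Kᴿ.trans (Kᴿ.+-cong {select (λ′ ≟ᵖ λ″) c} (select-no (λ′ ≟ᵖ λ″) (λ e → ne (cong proj₁ e)) c) eq)
      (Kᴿ.+-identityˡ d) }) (∉′ , collect-unique ts u)
    where
    ∉′ : All (λ t → proj₁ λ′ ≢ proj₁ (proj₂ t)) ts
    ∉′ = AllP.map⁻ ∉

  totalSize : List (K × Partition) → ℕ
  totalSize []              = 0
  totalSize ((c , λ′) ∷ ts) = sum (proj₁ λ′) ℕ.+ totalSize ts

  totalSize-bound : ∀ ts → All (λ t → sum (proj₁ (proj₂ t)) ℕ.≤ totalSize ts) ts
  totalSize-bound []              = []
  totalSize-bound ((c , λ′) ∷ ts) = ℕP.m≤m+n (sum (proj₁ λ′)) (totalSize ts) ∷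
    All.map (λ le → ℕP.≤-trans le (ℕP.m≤n+m (totalSize ts) (sum (proj₁ λ′)))) (totalSize-bound ts)

  terms-partitions : ∀ cs vs → map (λ t → proj₁ (proj₂ t)) (terms cs vs) ≡ map (λ t → proj₁ (proj₂ t)) cs
  terms-partitions []             []       = refl
  terms-partitions ((c , λ′) ∷ cs) (v ∷ vs) = cong (proj₁ λ′ ∷_) (terms-partitions cs vs)

  terms-zero : ∀ cs vs → All (λ t → proj₁ t ≈ᴷ 0ᴷ) (terms cs vs) → All (λ t → proj₁ t ≈ᵣ 0ᵣ) cs
  terms-zero []              []       []       = []
  terms-zero ((c , λ′) ∷ cs) (v ∷ vs) (z ∷ zs) = un z ∷ terms-zero cs vs zs

  linIndep : LinIndep X′
  linIndep cs vs unique lin≈0 = terms-zero cs vs (All.zipWith (λ { {c , λ′} (eq , le) → Kᴿ.trans (Kᴿ.sym eq) (collected-zero λ′ le) })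
      (collect-unique ts (subst Unique (sym (terms-partitions cs vs)) unique) , totalSize-bound ts))
    where
    ts = terms cs vs
    -- A crude bound under which every partition occurring in `ts` is a row of the truncated matrix.
    N = totalSize ts
    open Truncation N
    column : ∀ j → KΣ.sum (λ i → collect ts (part i) *ᴷ entry (part i) (mono j)) ≈ᴷ 0ᴷ
    column j = begin
      KΣ.sum (λ i → collect ts (part i) *ᴷ entry (part i) (mono j))
        ≡⟨ ∑ᴷ-tabulate part (λ λ₀ → collect ts λ₀ *ᴷ entry λ₀ (mono j)) ⟨
      KS.∑ (tabulate part) (λ λ₀ → collect ts λ₀ *ᴷ entry λ₀ (mono j))
        ≡⟨ cong (λ xs → KS.∑ xs (λ λ₀ → collect ts λ₀ *ᴷ entry λ₀ (mono j))) (LP.tabulate-lookup ps) ⟩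
      KS.∑ ps (λ λ₀ → collect ts λ₀ *ᴷ entry λ₀ (mono j))
        ≈⟨ collect-∑ N ts (totalSize-bound ts) (mono j) ⟩
      KS.∑ ts (λ { (c , λ′) → c *ᴷ entry λ′ (mono j) })
        ≈⟨ coeffᴷ-linComb cs vs (linComb-valid cs vs) (mono j) ⟨
      coeffᴷ (linComb X′ cs) (linComb-valid cs vs) (mono j)
        ≈⟨ mk (lin≈0 (mono j)) ⟩
      0ᴷ ∎
      where open ≈-Reasoning
    collected-zero : ∀ λ′ → sum (proj₁ λ′) ℕ.≤ N → collect ts λ′ ≈ᴷ 0ᴷ
    collected-zero λ′ le = subst (λ p → collect ts p ≈ᴷ 0ᴷ) (sym (lookup-index i))
      (proj₂ (basis N) (λ i → collect ts (part i)) column (index i))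
      where i = ∈-partitionsUpTo N λ′ le

  totalWeight : Λα → ℕ
  totalWeight []            = 0
  totalWeight ((c , μ) ∷ f) = weight μ ℕ.+ totalWeight f

  totalWeight-bound : ∀ f → All (λ t → weight (proj₂ t) ℕ.≤ totalWeight f) f
  totalWeight-bound []            = []
  totalWeight-bound ((c , μ) ∷ f) = ℕP.m≤m+n (weight μ) (totalWeight f) ∷
    All.map (λ le → ℕP.≤-trans le (ℕP.m≤n+m (totalWeight f) (weight μ))) (totalWeight-bound f)

  tabulated : ∀ {m} → (Fin m → K) → (Fin m → Partition) → Terms
  tabulated c p = tabulate (λ i → proj₁ (c i) , p i)

  tabulated-valid : ∀ {m} (c : Fin m → K) (p : Fin m → Partition) → ValidTerms (tabulated c p)
  tabulated-valid c p = AllP.tabulate⁺ (λ i → proj₂ (c i))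

  coeffᴷ-tabulated : ∀ {m} (c : Fin m → K) (p : Fin m → Partition) u μ →
    coeffᴷ (linComb X′ (tabulated c p)) u μ ≈ᴷ KΣ.sum (λ i → c i *ᴷ entry (p i) μ)
  coeffᴷ-tabulated {zero}  c p u μ = mk (≈ᵣ-refl {0ᵣ})
  coeffᴷ-tabulated {suc m} c p u μ = Kᴿ.trans
    (coeffᴷ-++ (scaleΛ (proj₁ c₀) (X′ (p Fin.zero))) (linComb X′ (tabulated (c ∘ Fin.suc) (p ∘ Fin.suc))) sv lv u μ)
    (Kᴿ.+-cong {coeffᴷ (scaleΛ (proj₁ c₀) (X′ (p Fin.zero))) sv μ} {c₀ *ᴷ entry (p Fin.zero) μ}
      (coeffᴷ-scale (proj₁ c₀) (X′ (p Fin.zero)) (proj₂ c₀) (proj₁ (isX′ (p Fin.zero))) sv μ)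
      (coeffᴷ-tabulated (c ∘ Fin.suc) (p ∘ Fin.suc) lv μ))
    where
    c₀ : K
    c₀ = c Fin.zero
    sv = scale-valid (proj₁ c₀) (X′ (p Fin.zero)) (proj₂ c₀) (proj₁ (isX′ (p Fin.zero)))
    lv = linComb-valid (tabulated (c ∘ Fin.suc) (p ∘ Fin.suc)) (tabulated-valid (c ∘ Fin.suc) (p ∘ Fin.suc))

  module _ (f : Λα) (vf : ValidΛ f) (c : Fin (Truncation.n (totalWeight f)) → K)
           (solves : ∀ j → KΣ.sum (λ i → c i *ᴷ entry (Truncation.part (totalWeight f) i) (Truncation.mono (totalWeight f) j))
                           ≈ᴷ coeffᴷ f vf (Truncation.mono (totalWeight f) j)) where
    private
      N : ℕ
      N = totalWeight f
    open Truncation N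

    private
      g : Λα
      g = linComb X′ (tabulated c part)
      vg : ValidΛ g
      vg = linComb-valid (tabulated c part) (tabulated-valid c part)

    -- Every monomial of weight at most `N` is a column up to `≃`, and coefficients depend only on
    -- `strip μ`.
    low-weight : ∀ μ → weight μ ℕ.≤ N → coeffᵣ g μ ≈ᵣ coeffᵣ f μ
    low-weight μ le = transport (sym (coeffᵣ-strip g same)) (sym (coeffᵣ-strip f same))
      (un (Kᴿ.trans (coeffᴷ-tabulated c part vg (mono j)) (solves j)))
      where
      λ′ : Partition
      λ′ = proj₁ (toMono-surjective μ)
      λ′≃μ : toMono (proj₁ λ′) ≃ μ
      λ′≃μ = proj₂ (toMono-surjective μ)
      λ′∈ : λ′ ∈ ps
      λ′∈ = ∈-partitionsUpTo N λ′ (subst (ℕ._≤ N) (trans (sym (weight-cong λ′≃μ)) (weight-toMono (proj₁ λ′))) le)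
      j : Fin n
      j = index λ′∈
      same : strip μ ≡ strip (mono j)
      same = trans (sym (≃⇒strip≡ λ′≃μ)) (cong (λ p → strip (toMono (proj₁ p))) (lookup-index λ′∈))
      transport : ∀ {r r′ t t′ : RatFun} → r ≡ r′ → t ≡ t′ → r ≈ᵣ t → r′ ≈ᵣ t′
      transport refl refl e = e

    -- Both sides vanish: `f` has no monomial of this weight, and the rows used have size at most
    -- `N`, so their entries here are zero by homogeneity.
    high-weight : ∀ μ → ¬ weight μ ℕ.≤ N → coeffᵣ g μ ≈ᵣ coeffᵣ f μ
    high-weight μ gt = subst (coeffᵣ g μ ≈ᵣ_) (sym (coeffᵣ-absent f μ absent)) (un g≈0)
      where
      absent : All (λ t → strip (proj₂ t) ≢ strip μ) f
      absent = All.map (λ {t} le e → gt (subst (ℕ._≤ N) (weight-cong (strip≡⇒≃ {proj₂ t} {μ} e)) le)) (totalWeight-bound f)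
      g≈0 : coeffᴷ g vg μ ≈ᴷ 0ᴷ
      g≈0 = Kᴿ.trans (coeffᴷ-tabulated c part vg μ) (Kᴿ.trans
        (KΣ.sum-cong-≋ {n} (λ i → Kᴿ.trans (Kᴿ.*-congˡ {c i} (entry-homogeneous (part i) μ
           (λ e → gt (subst (ℕ._≤ N) (sym e) (part-sum i))))) (Kᴿ.zeroʳ (c i))))
        (KΣ.sum-replicate-zero n))

    tabulated≈f : g ≈Λ f
    tabulated≈f μ with weight μ ℕ.≤? N
    ... | yes le = low-weight μ le
    ... | no gt  = high-weight μ gt

  spans : Spans X′
  spans f vf = tabulated c part , tabulated-valid c part , tabulated≈f f vf c (proj₂ solution)
    where
    open Truncation (totalWeight f)
    solution = proj₁ (basis (totalWeight f)) (λ j → coeffᴷ f vf (mono j))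
    c : Fin n → K
    c = proj₁ solution

theorem3p14 : (X′ : Partition → Λα) → (∀ λ' → IsXPrime λ' (X′ λ')) → IsBasis X′
theorem3p14 X′ isX′ = Main.linIndep X′ isX′ , Main.spans X′ isX′
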